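{- Let $p$ be a prime, and let $s(n)_{n\geq 0}$ be a sequence of $p$-adic integers satisfying a linear recurrence $s(n+\ell)+a_{\ell-1}s(n+\ell-1)+\cdots+a_1 s(n+1)+a_0 s(n)=0$ for all $n\ge 0$, with constant coefficients $a_i\in\mathbb{Z}_p$ (so its characteristic polynomial $g(x)=x^\ell+a_{\ell-1}x^{\ell-1}+\cdots+a_0\in\mathbb{Z}_p[x]$ is monic). Then there exists an analytic approximate twisted interpolation of $s(n)_{n\geq 0}$ to $\mathbb{Z}_p$.
   Context: $\mathbb N=\{0,1,2,\dots\}$. Let $p$ be a prime, $q\ge1$ a power of $p$, and $s(n)_{n\ge0}$ a sequence of $p$-adic integers. Suppose $\mathbb N=\bigcup_{j\in J}A_j$ is a finite partition of $\mathbb N$ such that each $A_j$ is dense in $r_j+q\mathbb{Z}_p$ for some $0\le r_j\le q-1$; let $K$ be a finite extension of $\mathbb{Q}_p$ with its unique absolute value $|\cdot|_p$ extending that of $\mathbb{Q}_p$, and for each $j$ let $s_j:\mathbb{Z}_p\to K$ be continuous. The family $\{(s_j,A_j):j\in J\}$ is an approximate twisted interpolation of $s(n)_{n\ge 0}$ to $\mathbb{Z}_p$ if there are constants $C\ge 0$ and $0\le D<1$ with $|s(n)-s_j(n)|_p\le CD^n$ for all $n\in A_j$ and all $j\in J$. It is analytic if for each $j$ the function $x\mapsto s_j(qx+r_j)$, $x\in\mathbb{Z}_p$, is given by a power series in $x$ with coefficients in $K$ converging on all of $\mathbb{Z}_p$. -}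

module Defs where

open import Algebra.Apartness.Bundles using (HeytingField; HeytingCommutativeRing)
open import Algebra.Bundles using (CommutativeRing; RawRing)
open import Algebra.Morphism.Structures using (IsRingHomomorphism)
import Algebra.Definitions.RawMonoid as RawMonoidDefs
import Algebra.Definitions.RawSemiring as RawSemiringDefs
open import Data.Fin.Base using (Fin; toℕ)
open import Data.Integer.Base as ℤ using (ℤ; +_; +[1+_]; +<+)
import Data.Integer.Properties as ℤ
open import Data.Integer.Divisibility.Signed using (_∣_; divides; _∣?_; ∣-trans; ∣m∣n⇒∣m+n; ∣m⇒∣-m; ∣m⇒∣m*n; ∣n⇒∣m*n; *-cancelʳ-∣)
open import Data.Integer.Tactic.RingSolver using (solve-∀)
open import Data.Nat.Base as ℕ using (ℕ; zero; suc)
import Data.Nat.Properties as ℕ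
open import Data.Nat.Primality using (Prime; prime⇒nonZero; prime⇒nonTrivial)
open import Data.Product.Base using (∃; _×_; _,_; proj₁; proj₂)
open import Data.Rational.Base as ℚ using (ℚ; 0ℚ; 1ℚ; ½; ∣_∣; mkℚ)
import Data.Rational.Properties as ℚ
import Data.Rational.Unnormalised.Base as ℚᵘ
import Data.Rational.Unnormalised.Properties as ℚᵘ
open import Data.Rational.Solver using (module +-*-Solver)
open import Data.Sum.Base using (_⊎_; inj₁; inj₂; [_,_]′; map₂)
open import Level using (0ℓ)
open import Relation.Binary.PropositionalEquality using (_≡_; refl; sym; trans; cong; cong₂; subst)
open import Relation.Nullary.Decidable using (yes; no)
open import Relation.Nullary.Negation using (contradiction)
open import Relation.Unary using (Pred)

------------------------------------------------------------------------
-- Real numbers: Cauchy sequences of rationals, compared by the setoid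
-- equality _≃ᴿ_.

Cauchy : (ℕ → ℚ) → Set
Cauchy u = ∀ ε → 0ℚ ℚ.< ε → ∃ λ N → ∀ m n → N ℕ.≤ m → N ℕ.≤ n → ∣ u m ℚ.- u n ∣ ℚ.< ε

record ℝ : Set where
  constructor mkℝ
  field
    approx : ℕ → ℚ
    cauchy : Cauchy approx

open ℝ public

infix 4 _≃ᴿ_ _≤ᴿ_ _<ᴿ_
infixl 6 _+ᴿ_
infixl 7 _*ᴿ_
infixr 8 _^ᴿ_

_≃ᴿ_ : ℝ → ℝ → Set
x ≃ᴿ y = ∀ ε → 0ℚ ℚ.< ε → ∃ λ N → ∀ n → N ℕ.≤ n → ∣ approx x n ℚ.- approx y n ∣ ℚ.< ε

_≤ᴿ_ : ℝ → ℝ → Set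
x ≤ᴿ y = ∀ ε → 0ℚ ℚ.< ε → ∃ λ N → ∀ n → N ℕ.≤ n → approx x n ℚ.< approx y n ℚ.+ ε

_<ᴿ_ : ℝ → ℝ → Set
x <ᴿ y = ∃ λ ε → 0ℚ ℚ.< ε × ∃ λ N → ∀ n → N ℕ.≤ n → approx x n ℚ.+ ε ℚ.< approx y n

fromℚ : ℚ → ℝ
fromℚ a = mkℝ (λ _ → a) λ ε 0<ε → 0 , λ _ _ _ _ →
  subst (ℚ._< ε) (sym (cong ∣_∣ (ℚ.+-inverseʳ a))) 0<ε

0ᴿ 1ᴿ : ℝ
0ᴿ = fromℚ 0ℚ
1ᴿ = fromℚ 1ℚ

half+half : ∀ ε → ½ ℚ.* ε ℚ.+ ½ ℚ.* ε ≡ ε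
half+half ε = trans (sym (ℚ.*-distribʳ-+ ε ½ ½)) (ℚ.*-identityˡ ε)

0<half : ∀ {ε} → 0ℚ ℚ.< ε → 0ℚ ℚ.< ½ ℚ.* ε
0<half = ℚ.*-monoʳ-<-pos ½

∣sum∣< : ∀ {a} b c {β γ} → a ≡ b ℚ.+ c → ∣ b ∣ ℚ.< β → ∣ c ∣ ℚ.< γ → ∣ a ∣ ℚ.< β ℚ.+ γ
∣sum∣< b c refl ∣b∣<β ∣c∣<γ = ℚ.≤-<-trans (ℚ.∣p+q∣≤∣p∣+∣q∣ b c) (ℚ.+-mono-< ∣b∣<β ∣c∣<γ)

+-regroup : ∀ a b c d → (a ℚ.+ b) ℚ.- (c ℚ.+ d) ≡ (a ℚ.- c) ℚ.+ (b ℚ.- d)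
+-regroup = solve 4 (λ a b c d → (a :+ b) :- (c :+ d) := (a :- c) :+ (b :- d)) refl
  where open +-*-Solver

*-regroup : ∀ a b c d → a ℚ.* b ℚ.- c ℚ.* d ≡ a ℚ.* (b ℚ.- d) ℚ.+ d ℚ.* (a ℚ.- c)
*-regroup = solve 4 (λ a b c d → a :* b :- c :* d := a :* (b :- d) :+ d :* (a :- c)) refl
  where open +-*-Solver

bound : ∀ x → ∃ λ B → 0ℚ ℚ.< B × ∃ λ N → ∀ n → N ℕ.≤ n → ∣ approx x n ∣ ℚ.< B
bound x with cauchy x 1ℚ (ℚ.positive⁻¹ 1ℚ)
... | N , close = ∣ approx x N ∣ ℚ.+ 1ℚ
                , ℚ.<-≤-trans (ℚ.positive⁻¹ 1ℚ) (ℚ.+-monoˡ-≤ 1ℚ (ℚ.0≤∣p∣ (approx x N)))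
                , N , λ n N≤n → ℚ.≤-<-trans (split (approx x n) (approx x N))
                                            (ℚ.+-monoʳ-< ∣ approx x N ∣ (close n N N≤n ℕ.≤-refl))
  where
  split : ∀ a b → ∣ a ∣ ℚ.≤ ∣ b ∣ ℚ.+ ∣ a ℚ.- b ∣
  split a b = subst (λ c → ∣ c ∣ ℚ.≤ ∣ b ∣ ℚ.+ ∣ a ℚ.- b ∣)
    (solve 2 (λ a b → b :+ (a :- b) := a) refl a b) (ℚ.∣p+q∣≤∣p∣+∣q∣ b (a ℚ.- b))
    where open +-*-Solver

∣product∣< : ∀ a b {B δ} → 0ℚ ℚ.< B → ∣ a ∣ ℚ.< B → ∣ b ∣ ℚ.< δ → ∣ a ℚ.* b ∣ ℚ.< B ℚ.* δ
∣product∣< a b {B} {δ} 0<B ∣a∣<B ∣b∣<δ =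
  subst (ℚ._< B ℚ.* δ) (sym (ℚ.∣p*q∣≡∣p∣*∣q∣ a b))
    (ℚ.≤-<-trans
      (ℚ.*-monoʳ-≤-nonNeg ∣ b ∣ {{ℚ.nonNegative (ℚ.0≤∣p∣ b)}} (ℚ.<⇒≤ ∣a∣<B))
      (ℚ.*-monoʳ-<-pos B {{ℚ.positive 0<B}} ∣b∣<δ))

split-ε : ∀ A B ε → 0ℚ ℚ.< A → 0ℚ ℚ.< B → 0ℚ ℚ.< ε → ∃ λ δ → 0ℚ ℚ.< δ × A ℚ.* δ ℚ.+ B ℚ.* δ ≡ ε
split-ε A B ε 0<A 0<B 0<ε = δ , 0<δ , eq
  where
  C>0 : ℚ.Positive (A ℚ.+ B)
  C>0 = ℚ.positive (ℚ.+-mono-< 0<A 0<B)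
  i : ℚ
  i = ℚ.1/_ (A ℚ.+ B) {{ℚ.pos⇒nonZero (A ℚ.+ B) {{C>0}}}}
  δ : ℚ
  δ = ε ℚ.* i
  0<δ : 0ℚ ℚ.< δ
  0<δ = ℚ.positive⁻¹ δ {{ℚ.pos*pos⇒pos ε {{ℚ.positive 0<ε}} i {{ℚ.1/pos⇒pos (A ℚ.+ B) {{C>0}}}}}}
  eq : A ℚ.* δ ℚ.+ B ℚ.* δ ≡ ε
  eq = trans (regroup A B ε i)
    (trans (cong (ε ℚ.*_) (ℚ.*-inverseʳ (A ℚ.+ B) {{ℚ.pos⇒nonZero (A ℚ.+ B) {{C>0}}}})) (ℚ.*-identityʳ ε))
    where
    regroup : ∀ a b e i → a ℚ.* (e ℚ.* i) ℚ.+ b ℚ.* (e ℚ.* i) ≡ e ℚ.* ((a ℚ.+ b) ℚ.* i)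
    regroup = solve 4 (λ a b e i → a :* (e :* i) :+ b :* (e :* i) := e :* ((a :+ b) :* i)) refl
      where open +-*-Solver

*-close : ∀ a b c d {A B δ ε} → 0ℚ ℚ.< A → 0ℚ ℚ.< B → A ℚ.* δ ℚ.+ B ℚ.* δ ≡ ε →
          ∣ a ∣ ℚ.< A → ∣ d ∣ ℚ.< B → ∣ a ℚ.- c ∣ ℚ.< δ → ∣ b ℚ.- d ∣ ℚ.< δ →
          ∣ a ℚ.* b ℚ.- c ℚ.* d ∣ ℚ.< ε
*-close a b c d 0<A 0<B eq ∣a∣<A ∣d∣<B a~c b~d = subst (∣ a ℚ.* b ℚ.- c ℚ.* d ∣ ℚ.<_) eq
  (∣sum∣< (a ℚ.* (b ℚ.- d)) (d ℚ.* (a ℚ.- c)) (*-regroup a b c d)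
    (∣product∣< a (b ℚ.- d) 0<A ∣a∣<A b~d) (∣product∣< d (a ℚ.- c) 0<B ∣d∣<B a~c))

_+ᴿ_ : ℝ → ℝ → ℝ
approx (x +ᴿ y) n = approx x n ℚ.+ approx y n
cauchy (x +ᴿ y) ε 0<ε with cauchy x (½ ℚ.* ε) (0<half 0<ε) | cauchy y (½ ℚ.* ε) (0<half 0<ε)
... | M , p | N , q = M ℕ.⊔ N , λ m n m≥ n≥ → subst (_ ℚ.<_) (half+half ε)
  (∣sum∣< (approx x m ℚ.- approx x n) (approx y m ℚ.- approx y n)
    (+-regroup (approx x m) (approx y m) (approx x n) (approx y n))
    (p m n (ℕ.≤-trans (ℕ.m≤m⊔n M N) m≥) (ℕ.≤-trans (ℕ.m≤m⊔n M N) n≥))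
    (q m n (ℕ.≤-trans (ℕ.m≤n⊔m M N) m≥) (ℕ.≤-trans (ℕ.m≤n⊔m M N) n≥)))

_*ᴿ_ : ℝ → ℝ → ℝ
approx (x *ᴿ y) n = approx x n ℚ.* approx y n
cauchy (x *ᴿ y) ε 0<ε = N₁ ℕ.⊔ N₂ ℕ.⊔ (N₃ ℕ.⊔ N₄) , λ m n m≥ n≥ →
  *-close (approx x m) (approx y m) (approx x n) (approx y n) 0<A 0<B eq
    (∣x∣<A m (ℕ.≤-trans ≤₁ m≥)) (∣y∣<B n (ℕ.≤-trans ≤₂ n≥))
    (x-close m n (ℕ.≤-trans ≤₃ m≥) (ℕ.≤-trans ≤₃ n≥))
    (y-close m n (ℕ.≤-trans ≤₄ m≥) (ℕ.≤-trans ≤₄ n≥))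
  where
  bx = bound x
  by = bound y
  A = proj₁ bx
  B = proj₁ by
  0<A = proj₁ (proj₂ bx)
  0<B = proj₁ (proj₂ by)
  N₁ = proj₁ (proj₂ (proj₂ bx))
  N₂ = proj₁ (proj₂ (proj₂ by))
  ∣x∣<A = proj₂ (proj₂ (proj₂ bx))
  ∣y∣<B = proj₂ (proj₂ (proj₂ by))
  sp = split-ε A B ε 0<A 0<B 0<ε
  δ = proj₁ sp
  eq = proj₂ (proj₂ sp)
  N₃ = proj₁ (cauchy x δ (proj₁ (proj₂ sp)))
  N₄ = proj₁ (cauchy y δ (proj₁ (proj₂ sp)))
  x-close = proj₂ (cauchy x δ (proj₁ (proj₂ sp)))
  y-close = proj₂ (cauchy y δ (proj₁ (proj₂ sp)))
  ≤₁ : N₁ ℕ.≤ N₁ ℕ.⊔ N₂ ℕ.⊔ (N₃ ℕ.⊔ N₄)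
  ≤₁ = ℕ.≤-trans (ℕ.m≤m⊔n N₁ N₂) (ℕ.m≤m⊔n (N₁ ℕ.⊔ N₂) (N₃ ℕ.⊔ N₄))
  ≤₂ : N₂ ℕ.≤ N₁ ℕ.⊔ N₂ ℕ.⊔ (N₃ ℕ.⊔ N₄)
  ≤₂ = ℕ.≤-trans (ℕ.m≤n⊔m N₁ N₂) (ℕ.m≤m⊔n (N₁ ℕ.⊔ N₂) (N₃ ℕ.⊔ N₄))
  ≤₃ : N₃ ℕ.≤ N₁ ℕ.⊔ N₂ ℕ.⊔ (N₃ ℕ.⊔ N₄)
  ≤₃ = ℕ.≤-trans (ℕ.m≤m⊔n N₃ N₄) (ℕ.m≤n⊔m (N₁ ℕ.⊔ N₂) (N₃ ℕ.⊔ N₄))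
  ≤₄ : N₄ ℕ.≤ N₁ ℕ.⊔ N₂ ℕ.⊔ (N₃ ℕ.⊔ N₄)
  ≤₄ = ℕ.≤-trans (ℕ.m≤n⊔m N₃ N₄) (ℕ.m≤n⊔m (N₁ ℕ.⊔ N₂) (N₃ ℕ.⊔ N₄))

_^ᴿ_ : ℝ → ℕ → ℝ
x ^ᴿ zero  = 1ᴿ
x ^ᴿ suc n = x *ᴿ x ^ᴿ n

------------------------------------------------------------------------

module Padic (p : ℕ) (p-prime : Prime p) where

  instance
    p≢0 : ℕ.NonZero p
    p≢0 = prime⇒nonZero p-prime

  p^n≢0 : ∀ n → ℕ.NonZero (p ℕ.^ n)
  p^n≢0 n = ℕ.m^n≢0 p n

  p^ : ℕ → ℤ
  p^ n = + (p ℕ.^ n)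

  p^-+ : ∀ m n → p^ (m ℕ.+ n) ≡ p^ m ℤ.* p^ n
  p^-+ m n = trans (cong +_ (ℕ.^-distribˡ-+-* p m n)) (ℤ.pos-* (p ℕ.^ m) (p ℕ.^ n))

  ----------------------------------------------------------------------
  -- ℤₚ is the inverse limit of the rings ℤ/pⁿℤ; residue x n represents
  -- the component of x in ℤ/pⁿℤ.

  infix 4 _≡_mod-p^_

  record _≡_mod-p^_ (a b : ℤ) (n : ℕ) : Set where
    constructor mk-mod
    field
      p^∣ : p^ n ∣ a ℤ.- b

  open _≡_mod-p^_ public

  record ℤₚ : Set where
    constructor mkℤₚ
    field
      residue  : ℕ → ℤ
      coherent : ∀ n → residue (suc n) ≡ residue n mod-p^ n

  open ℤₚ public

  infix 4 _≈ᶻ_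

  record _≈ᶻ_ (x y : ℤₚ) : Set where
    constructor mk≈ᶻ
    field
      mod : ∀ n → residue x n ≡ residue y n mod-p^ n

  open _≈ᶻ_ public

  ∣-by : ∀ {k a b} → a ≡ b → k ∣ a → k ∣ b
  ∣-by refl k∣a = k∣a

  mod-≡ : ∀ {a b n} → a ≡ b → a ≡ b mod-p^ n
  mod-≡ {a} refl = mk-mod (divides (+ 0) (ℤ.+-inverseʳ a))

  mod-sym : ∀ {a b n} → a ≡ b mod-p^ n → b ≡ a mod-p^ n
  mod-sym {a} {b} d = mk-mod (∣-by (lem a b) (∣m⇒∣-m (p^∣ d)))
    where
    lem : ∀ a b → ℤ.- (a ℤ.- b) ≡ b ℤ.- a
    lem = solve-∀

  mod-trans : ∀ {a b c n} → a ≡ b mod-p^ n → b ≡ c mod-p^ n → a ≡ c mod-p^ n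
  mod-trans {a} {b} {c} d e = mk-mod (∣-by (lem a b c) (∣m∣n⇒∣m+n (p^∣ d) (p^∣ e)))
    where
    lem : ∀ a b c → (a ℤ.- b) ℤ.+ (b ℤ.- c) ≡ a ℤ.- c
    lem = solve-∀

  mod-+ : ∀ {a b c d n} → a ≡ b mod-p^ n → c ≡ d mod-p^ n → a ℤ.+ c ≡ b ℤ.+ d mod-p^ n
  mod-+ {a} {b} {c} {d} e f = mk-mod (∣-by (lem a b c d) (∣m∣n⇒∣m+n (p^∣ e) (p^∣ f)))
    where
    lem : ∀ a b c d → (a ℤ.- b) ℤ.+ (c ℤ.- d) ≡ (a ℤ.+ c) ℤ.- (b ℤ.+ d)
    lem = solve-∀

  mod-* : ∀ {a b c d n} → a ≡ b mod-p^ n → c ≡ d mod-p^ n → a ℤ.* c ≡ b ℤ.* d mod-p^ n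
  mod-* {a} {b} {c} {d} e f = mk-mod (∣-by (lem a b c d) (∣m∣n⇒∣m+n (∣m⇒∣m*n c (p^∣ e)) (∣n⇒∣m*n b (p^∣ f))))
    where
    lem : ∀ a b c d → (a ℤ.- b) ℤ.* c ℤ.+ b ℤ.* (c ℤ.- d) ≡ a ℤ.* c ℤ.- b ℤ.* d
    lem = solve-∀

  mod-neg : ∀ {a b n} → a ≡ b mod-p^ n → ℤ.- a ≡ ℤ.- b mod-p^ n
  mod-neg {a} {b} d = mk-mod (∣-by (lem a b) (∣m⇒∣-m (p^∣ d)))
    where
    lem : ∀ a b → ℤ.- (a ℤ.- b) ≡ ℤ.- a ℤ.- (ℤ.- b)
    lem = solve-∀

  infixl 6 _+ᶻ_
  infixl 7 _*ᶻ_
  infix  8 -ᶻ_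

  _+ᶻ_ : ℤₚ → ℤₚ → ℤₚ
  residue  (x +ᶻ y) n = residue x n ℤ.+ residue y n
  coherent (x +ᶻ y) n = mod-+ (coherent x n) (coherent y n)

  _*ᶻ_ : ℤₚ → ℤₚ → ℤₚ
  residue  (x *ᶻ y) n = residue x n ℤ.* residue y n
  coherent (x *ᶻ y) n = mod-* (coherent x n) (coherent y n)

  -ᶻ_ : ℤₚ → ℤₚ
  residue  (-ᶻ x) n = ℤ.- residue x n
  coherent (-ᶻ x) n = mod-neg (coherent x n)

  fromℤ : ℤ → ℤₚ
  residue  (fromℤ a) _ = a
  coherent (fromℤ a) n = mod-≡ refl

  fromℕ : ℕ → ℤₚ
  fromℕ n = fromℤ (+ n)

  pointwise : ∀ {x y} → (∀ n → residue x n ≡ residue y n) → x ≈ᶻ y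
  pointwise eq = mk≈ᶻ λ n → mod-≡ (eq n)

  ℤₚ-commutativeRing : CommutativeRing 0ℓ 0ℓ
  ℤₚ-commutativeRing = record
    { Carrier = ℤₚ ; _≈_ = _≈ᶻ_ ; _+_ = _+ᶻ_ ; _*_ = _*ᶻ_ ; -_ = -ᶻ_
    ; 0# = fromℤ (+ 0) ; 1# = fromℤ (+ 1)
    ; isCommutativeRing = record
      { isRing = record
        { +-isAbelianGroup = record
          { isGroup = record
            { isMonoid = record
              { isSemigroup = record
                { isMagma = record
                  { isEquivalence = record
                    { refl  = pointwise λ _ → refl
                    ; sym   = λ e → mk≈ᶻ λ n → mod-sym (mod e n)
                    ; trans = λ e f → mk≈ᶻ λ n → mod-trans (mod e n) (mod f n)
                    }
                  ; ∙-cong = λ e f → mk≈ᶻ λ n → mod-+ (mod e n) (mod f n)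
                  }
                ; assoc = λ x y z → pointwise λ n → ℤ.+-assoc (residue x n) (residue y n) (residue z n)
                }
              ; identity = (λ x → pointwise λ n → ℤ.+-identityˡ (residue x n))
                         , (λ x → pointwise λ n → ℤ.+-identityʳ (residue x n))
              }
            ; inverse = (λ x → pointwise λ n → ℤ.+-inverseˡ (residue x n))
                      , (λ x → pointwise λ n → ℤ.+-inverseʳ (residue x n))
            ; ⁻¹-cong = λ e → mk≈ᶻ λ n → mod-neg (mod e n)
            }
          ; comm = λ x y → pointwise λ n → ℤ.+-comm (residue x n) (residue y n)
          }
        ; *-cong = λ e f → mk≈ᶻ λ n → mod-* (mod e n) (mod f n)
        ; *-assoc = λ x y z → pointwise λ n → ℤ.*-assoc (residue x n) (residue y n) (residue z n)
        ; *-identity = (λ x → pointwise λ n → ℤ.*-identityˡ (residue x n))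
                     , (λ x → pointwise λ n → ℤ.*-identityʳ (residue x n))
        ; distrib = (λ x y z → pointwise λ n → ℤ.*-distribˡ-+ (residue x n) (residue y n) (residue z n))
                  , (λ x y z → pointwise λ n → ℤ.*-distribʳ-+ (residue x n) (residue y n) (residue z n))
        }
      ; *-comm = λ x y → pointwise λ n → ℤ.*-comm (residue x n) (residue y n)
      }
    }

  ----------------------------------------------------------------------
  -- ℚₚ is the localisation ℤₚ[1/p]; x /p^ k stands for x / pᵏ.

  infix 5 _/p^_

  record ℚₚ : Set where
    constructor _/p^_
    field
      num : ℤₚ
      exp : ℕ

  open ℚₚ public

  infix 4 _≈ᵠ_

  record _≈ᵠ_ (x y : ℚₚ) : Set where
    constructor mk≈ᵠ
    field
      cross : num x *ᶻ fromℤ (p^ (exp y)) ≈ᶻ num y *ᶻ fromℤ (p^ (exp x))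

  open _≈ᵠ_ public

  infixl 6 _+ᵠ_
  infixl 7 _*ᵠ_
  infix  8 -ᵠ_

  _+ᵠ_ _*ᵠ_ : ℚₚ → ℚₚ → ℚₚ
  (x /p^ k) +ᵠ (y /p^ l) = x *ᶻ fromℤ (p^ l) +ᶻ y *ᶻ fromℤ (p^ k) /p^ k ℕ.+ l
  (x /p^ k) *ᵠ (y /p^ l) = x *ᶻ y /p^ k ℕ.+ l

  -ᵠ_ : ℚₚ → ℚₚ
  -ᵠ (x /p^ k) = -ᶻ x /p^ k

  fromℤₚ : ℤₚ → ℚₚ
  fromℤₚ x = x /p^ 0

  cancel-p^ : ∀ x k → x *ᶻ fromℤ (p^ k) ≈ᶻ fromℤ (+ 0) → x ≈ᶻ fromℤ (+ 0)
  cancel-p^ x k e = mk≈ᶻ λ n → mod-trans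
    (mod-sym (shift n k))
    (mk-mod (∣-by (sym (sub0 (residue x (n ℕ.+ k))))
      (*-cancelʳ-∣ (p^ k) {{p^n≢0 k}}
        (subst (_∣ residue x (n ℕ.+ k) ℤ.* p^ k) (p^-+ n k)
          (∣-by (sub0 _) (p^∣ (mod e (n ℕ.+ k))))))))
    where
    sub0 : ∀ a → a ℤ.- + 0 ≡ a
    sub0 = ℤ.+-identityʳ
    weaken : ∀ {a b} n k → a ≡ b mod-p^ (n ℕ.+ k) → a ≡ b mod-p^ n
    weaken n k e = mk-mod (∣-trans (divides (p^ k) (trans (p^-+ n k) (ℤ.*-comm (p^ n) (p^ k)))) (p^∣ e))
    shift : ∀ n k → residue x (n ℕ.+ k) ≡ residue x n mod-p^ n
    shift n zero    = mod-≡ (cong (residue x) (ℕ.+-identityʳ n))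
    shift n (suc k) = subst (λ i → residue x i ≡ residue x n mod-p^ n) (sym (ℕ.+-suc n k))
      (mod-trans (weaken n k (coherent x (n ℕ.+ k))) (shift n k))

  ≈ᵠ-trans : ∀ {x y z} → x ≈ᵠ y → y ≈ᵠ z → x ≈ᵠ z
  ≈ᵠ-trans {x} {y} {z} e f = mk≈ᵠ (mk≈ᶻ λ n → mk-mod (∣-by (sub0 _) (p^∣ (mod zero′ n))))
    where
    sub0 : ∀ a → a ℤ.- + 0 ≡ a
    sub0 = ℤ.+-identityʳ
    P = p^ (exp x)
    Q = p^ (exp y)
    R = p^ (exp z)
    d : ℤₚ
    d = num x *ᶻ fromℤ R +ᶻ -ᶻ (num z *ᶻ fromℤ P)
    lem : ∀ a b c P Q R → (a ℤ.* Q ℤ.- b ℤ.* P) ℤ.* R ℤ.+ (b ℤ.* R ℤ.- c ℤ.* Q) ℤ.* P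
                        ≡ (a ℤ.* R ℤ.- c ℤ.* P) ℤ.* Q ℤ.- + 0
    lem = solve-∀
    zero′ : d ≈ᶻ fromℤ (+ 0)
    zero′ = cancel-p^ d (exp y) (mk≈ᶻ λ n →
      mk-mod (∣-by (lem (residue (num x) n) (residue (num y) n) (residue (num z) n) P Q R)
        (∣m∣n⇒∣m+n (∣m⇒∣m*n R (p^∣ (mod (cross e) n))) (∣m⇒∣m*n P (p^∣ (mod (cross f) n))))))

  ≈ᵠ-sym : ∀ {x y} → x ≈ᵠ y → y ≈ᵠ x
  ≈ᵠ-sym e = mk≈ᵠ (CommutativeRing.sym ℤₚ-commutativeRing (cross e))

  pointwiseᵠ : ∀ {x y} → (∀ n → residue (num x) n ℤ.* p^ (exp y) ≡ residue (num y) n ℤ.* p^ (exp x)) → x ≈ᵠ y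
  pointwiseᵠ eq = mk≈ᵠ (pointwise eq)

  +ᵠ-cong : ∀ {x y u v} → x ≈ᵠ y → u ≈ᵠ v → x +ᵠ u ≈ᵠ y +ᵠ v
  +ᵠ-cong {x /p^ i} {y /p^ j} {u /p^ k} {v /p^ l} e f = mk≈ᵠ (mk≈ᶻ λ n → mk-mod (∣-by
    (trans (lem (residue x n) (residue y n) (residue u n) (residue v n) (p^ i) (p^ j) (p^ k) (p^ l))
      (cong₂ (λ s t → (residue x n ℤ.* p^ k ℤ.+ residue u n ℤ.* p^ i) ℤ.* s ℤ.- (residue y n ℤ.* p^ l ℤ.+ residue v n ℤ.* p^ j) ℤ.* t) (sym (p^-+ j l)) (sym (p^-+ i k))))
    (∣m∣n⇒∣m+n (∣m⇒∣m*n (p^ k ℤ.* p^ l) (p^∣ (mod (cross e) n))) (∣m⇒∣m*n (p^ i ℤ.* p^ j) (p^∣ (mod (cross f) n))))))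
    where
    lem : ∀ a b c d I J K L → (a ℤ.* J ℤ.- b ℤ.* I) ℤ.* (K ℤ.* L) ℤ.+ (c ℤ.* L ℤ.- d ℤ.* K) ℤ.* (I ℤ.* J)
                            ≡ (a ℤ.* K ℤ.+ c ℤ.* I) ℤ.* (J ℤ.* L) ℤ.- (b ℤ.* L ℤ.+ d ℤ.* J) ℤ.* (I ℤ.* K)
    lem = solve-∀

  *ᵠ-cong : ∀ {x y u v} → x ≈ᵠ y → u ≈ᵠ v → x *ᵠ u ≈ᵠ y *ᵠ v
  *ᵠ-cong {x /p^ i} {y /p^ j} {u /p^ k} {v /p^ l} e f = mk≈ᵠ (mk≈ᶻ λ n → mk-mod (∣-by
    (trans (lem (residue x n) (residue y n) (residue u n) (residue v n) (p^ i) (p^ j) (p^ k) (p^ l))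
      (cong₂ (λ s t → (residue x n ℤ.* residue u n) ℤ.* s ℤ.- (residue y n ℤ.* residue v n) ℤ.* t) (sym (p^-+ j l)) (sym (p^-+ i k))))
    (∣m∣n⇒∣m+n (∣m⇒∣m*n (residue u n ℤ.* p^ l) (p^∣ (mod (cross e) n))) (∣m⇒∣m*n (residue y n ℤ.* p^ i) (p^∣ (mod (cross f) n))))))
    where
    lem : ∀ a b c d I J K L → (a ℤ.* J ℤ.- b ℤ.* I) ℤ.* (c ℤ.* L) ℤ.+ (c ℤ.* L ℤ.- d ℤ.* K) ℤ.* (b ℤ.* I)
                            ≡ (a ℤ.* c) ℤ.* (J ℤ.* L) ℤ.- (b ℤ.* d) ℤ.* (I ℤ.* K)
    lem = solve-∀

  -ᵠ-cong : ∀ {x y} → x ≈ᵠ y → -ᵠ x ≈ᵠ -ᵠ y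
  -ᵠ-cong {x /p^ i} {y /p^ j} e = mk≈ᵠ (mk≈ᶻ λ n →
    mk-mod (∣-by (lem (residue x n) (residue y n) (p^ i) (p^ j)) (∣m⇒∣-m (p^∣ (mod (cross e) n)))))
    where
    lem : ∀ a b I J → ℤ.- (a ℤ.* J ℤ.- b ℤ.* I) ≡ (ℤ.- a) ℤ.* J ℤ.- (ℤ.- b) ℤ.* I
    lem = solve-∀

  +ᵠ-assoc : ∀ x y z → (x +ᵠ y) +ᵠ z ≈ᵠ x +ᵠ (y +ᵠ z)
  +ᵠ-assoc (x /p^ i) (y /p^ j) (z /p^ k) = pointwiseᵠ λ n →
    law (residue x n) (residue y n) (residue z n) (p^ i) (p^ j) (p^ k)
      (p^-+ i j) (p^-+ j k) (p^-+ i (j ℕ.+ k)) (p^-+ (i ℕ.+ j) k)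
    where
    lem : ∀ a b c I J K → ((a ℤ.* J ℤ.+ b ℤ.* I) ℤ.* K ℤ.+ c ℤ.* (I ℤ.* J)) ℤ.* (I ℤ.* (J ℤ.* K))
                        ≡ (a ℤ.* (J ℤ.* K) ℤ.+ (b ℤ.* K ℤ.+ c ℤ.* J) ℤ.* I) ℤ.* ((I ℤ.* J) ℤ.* K)
    lem = solve-∀
    law : ∀ a b c I J K {IJ JK S T} → IJ ≡ I ℤ.* J → JK ≡ J ℤ.* K → S ≡ I ℤ.* JK → T ≡ IJ ℤ.* K →
          ((a ℤ.* J ℤ.+ b ℤ.* I) ℤ.* K ℤ.+ c ℤ.* IJ) ℤ.* S ≡ (a ℤ.* JK ℤ.+ (b ℤ.* K ℤ.+ c ℤ.* J) ℤ.* I) ℤ.* T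
    law a b c I J K refl refl refl refl = lem a b c I J K

  +ᵠ-comm : ∀ x y → x +ᵠ y ≈ᵠ y +ᵠ x
  +ᵠ-comm (x /p^ i) (y /p^ j) = pointwiseᵠ λ n →
    cong₂ ℤ._*_ (ℤ.+-comm (residue x n ℤ.* p^ j) (residue y n ℤ.* p^ i)) (cong p^ (ℕ.+-comm j i))

  +ᵠ-identityˡ : ∀ x → fromℤₚ (fromℤ (+ 0)) +ᵠ x ≈ᵠ x
  +ᵠ-identityˡ (x /p^ i) = pointwiseᵠ λ n → lem (residue x n) (p^ i)
    where
    lem : ∀ a I → (+ 0 ℤ.* I ℤ.+ a ℤ.* + 1) ℤ.* I ≡ a ℤ.* I
    lem = solve-∀

  +ᵠ-inverseˡ : ∀ x → -ᵠ x +ᵠ x ≈ᵠ fromℤₚ (fromℤ (+ 0))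
  +ᵠ-inverseˡ (x /p^ i) = pointwiseᵠ λ n → lem (residue x n) (p^ i) (p^ (i ℕ.+ i))
    where
    lem : ∀ a I J → ((ℤ.- a) ℤ.* I ℤ.+ a ℤ.* I) ℤ.* + 1 ≡ + 0 ℤ.* J
    lem = solve-∀

  *ᵠ-assoc : ∀ x y z → (x *ᵠ y) *ᵠ z ≈ᵠ x *ᵠ (y *ᵠ z)
  *ᵠ-assoc (x /p^ i) (y /p^ j) (z /p^ k) = pointwiseᵠ λ n →
    cong₂ ℤ._*_ (ℤ.*-assoc (residue x n) (residue y n) (residue z n)) (cong p^ (sym (ℕ.+-assoc i j k)))

  *ᵠ-comm : ∀ x y → x *ᵠ y ≈ᵠ y *ᵠ x
  *ᵠ-comm (x /p^ i) (y /p^ j) = pointwiseᵠ λ n →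
    cong₂ ℤ._*_ (ℤ.*-comm (residue x n) (residue y n)) (cong p^ (ℕ.+-comm j i))

  *ᵠ-identityˡ : ∀ x → fromℤₚ (fromℤ (+ 1)) *ᵠ x ≈ᵠ x
  *ᵠ-identityˡ (x /p^ i) = pointwiseᵠ λ n → cong (ℤ._* p^ i) (ℤ.*-identityˡ (residue x n))

  *ᵠ-distribˡ : ∀ x y z → x *ᵠ (y +ᵠ z) ≈ᵠ x *ᵠ y +ᵠ x *ᵠ z
  *ᵠ-distribˡ (x /p^ i) (y /p^ j) (z /p^ k) = pointwiseᵠ λ n →
    law (residue x n) (residue y n) (residue z n) (p^ i) (p^ j) (p^ k)
      (p^-+ i j) (p^-+ i k) (p^-+ (i ℕ.+ j) (i ℕ.+ k))
      (trans (p^-+ i (j ℕ.+ k)) (cong (p^ i ℤ.*_) (p^-+ j k)))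
    where
    lem : ∀ a b c I J K → (a ℤ.* (b ℤ.* K ℤ.+ c ℤ.* J)) ℤ.* ((I ℤ.* J) ℤ.* (I ℤ.* K))
                        ≡ ((a ℤ.* b) ℤ.* (I ℤ.* K) ℤ.+ (a ℤ.* c) ℤ.* (I ℤ.* J)) ℤ.* (I ℤ.* (J ℤ.* K))
    lem = solve-∀
    law : ∀ a b c I J K {IJ IK S T} → IJ ≡ I ℤ.* J → IK ≡ I ℤ.* K → S ≡ IJ ℤ.* IK → T ≡ I ℤ.* (J ℤ.* K) →
          (a ℤ.* (b ℤ.* K ℤ.+ c ℤ.* J)) ℤ.* S ≡ ((a ℤ.* b) ℤ.* IK ℤ.+ (a ℤ.* c) ℤ.* IJ) ℤ.* T
    law a b c I J K refl refl refl refl = lem a b c I J K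

  0ᵠ 1ᵠ : ℚₚ
  0ᵠ = fromℤₚ (fromℤ (+ 0))
  1ᵠ = fromℤₚ (fromℤ (+ 1))

  +ᵠ-identityʳ : ∀ x → x +ᵠ 0ᵠ ≈ᵠ x
  +ᵠ-identityʳ x = ≈ᵠ-trans {x +ᵠ 0ᵠ} {0ᵠ +ᵠ x} {x} (+ᵠ-comm x 0ᵠ) (+ᵠ-identityˡ x)

  +ᵠ-inverseʳ : ∀ x → x +ᵠ -ᵠ x ≈ᵠ 0ᵠ
  +ᵠ-inverseʳ x = ≈ᵠ-trans {x +ᵠ -ᵠ x} { -ᵠ x +ᵠ x} {0ᵠ} (+ᵠ-comm x (-ᵠ x)) (+ᵠ-inverseˡ x)

  *ᵠ-identityʳ : ∀ x → x *ᵠ 1ᵠ ≈ᵠ x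
  *ᵠ-identityʳ x = ≈ᵠ-trans {x *ᵠ 1ᵠ} {1ᵠ *ᵠ x} {x} (*ᵠ-comm x 1ᵠ) (*ᵠ-identityˡ x)

  *ᵠ-distribʳ : ∀ x y z → (y +ᵠ z) *ᵠ x ≈ᵠ y *ᵠ x +ᵠ z *ᵠ x
  *ᵠ-distribʳ x y z = ≈ᵠ-trans {(y +ᵠ z) *ᵠ x} {x *ᵠ (y +ᵠ z)} {y *ᵠ x +ᵠ z *ᵠ x} (*ᵠ-comm (y +ᵠ z) x)
    (≈ᵠ-trans {x *ᵠ (y +ᵠ z)} {x *ᵠ y +ᵠ x *ᵠ z} {y *ᵠ x +ᵠ z *ᵠ x} (*ᵠ-distribˡ x y z)
      (+ᵠ-cong {x *ᵠ y} {y *ᵠ x} {x *ᵠ z} {z *ᵠ x} (*ᵠ-comm x y) (*ᵠ-comm x z)))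

  ℚₚ-commutativeRing : CommutativeRing 0ℓ 0ℓ
  ℚₚ-commutativeRing = record
    { Carrier = ℚₚ ; _≈_ = _≈ᵠ_ ; _+_ = _+ᵠ_ ; _*_ = _*ᵠ_ ; -_ = -ᵠ_
    ; 0# = 0ᵠ ; 1# = 1ᵠ
    ; isCommutativeRing = record
      { isRing = record
        { +-isAbelianGroup = record
          { isGroup = record
            { isMonoid = record
              { isSemigroup = record
                { isMagma = record
                  { isEquivalence = record { refl = pointwiseᵠ λ _ → refl ; sym = ≈ᵠ-sym ; trans = ≈ᵠ-trans }
                  ; ∙-cong = +ᵠ-cong
                  }
                ; assoc = +ᵠ-assoc
                }
              ; identity = +ᵠ-identityˡ , +ᵠ-identityʳ
              }
            ; inverse = +ᵠ-inverseˡ , +ᵠ-inverseʳ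
            ; ⁻¹-cong = -ᵠ-cong
            }
          ; comm = +ᵠ-comm
          }
        ; *-cong = *ᵠ-cong
        ; *-assoc = *ᵠ-assoc
        ; *-identity = *ᵠ-identityˡ , *ᵠ-identityʳ
        ; distrib = *ᵠ-distribˡ , *ᵠ-distribʳ
        }
      ; *-comm = *ᵠ-comm
      }
    }

  ----------------------------------------------------------------------

  p^- : ℕ → ℚ
  p^- n = ℚ._/_ (+ 1) (p ℕ.^ n) {{p^n≢0 n}}

  -- min (ordₚ x) n, where ordₚ is the p-adic valuation
  ord≤ : ℤₚ → ℕ → ℕ
  ord≤ x zero    = 0
  ord≤ x (suc n) with p^ (suc n) ∣? residue x (suc n)
  ... | yes _ = suc n
  ... | no  _ = ord≤ x n

  ord≤-full : ∀ x n → p^ n ∣ residue x n → ord≤ x n ≡ n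
  ord≤-full x zero    _ = refl
  ord≤-full x (suc n) d with p^ (suc n) ∣? residue x (suc n)
  ... | yes _ = refl
  ... | no ¬d = contradiction d ¬d

  p^∣-pred : ∀ x n → p^ (suc n) ∣ residue x (suc n) → p^ n ∣ residue x n
  p^∣-pred x n d = ∣-by (lem (residue x (suc n)) (residue x n))
    (∣m∣n⇒∣m+n (∣-trans (divides (+ p) (ℤ.pos-* p (p ℕ.^ n))) d) (∣m⇒∣-m (p^∣ (coherent x n))))
    where
    lem : ∀ a b → a ℤ.+ ℤ.- (a ℤ.- b) ≡ b
    lem = solve-∀

  p^∣-≤ : ∀ x {m n} → n ℕ.≤′ m → p^ m ∣ residue x m → p^ n ∣ residue x n
  p^∣-≤ x ℕ.≤′-refl     d = d
  p^∣-≤ x (ℕ.≤′-step l) d = p^∣-≤ x l (p^∣-pred x _ d)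

  ord≤-stable : ∀ x {m n} → n ℕ.≤′ m → ord≤ x m ≡ ord≤ x n ⊎ (n ℕ.≤ ord≤ x m × ord≤ x n ≡ n)
  ord≤-stable x ℕ.≤′-refl = inj₁ refl
  ord≤-stable x {suc m} {n} (ℕ.≤′-step l) with p^ (suc m) ∣? residue x (suc m)
  ... | yes d = inj₂ (ℕ.m≤n⇒m≤1+n (ℕ.≤′⇒≤ l) , ord≤-full x n (p^∣-≤ x (ℕ.≤′-step l) d))
  ... | no  _ = ord≤-stable x l

  1/-antitone : ∀ a b .{{_ : ℕ.NonZero a}} .{{_ : ℕ.NonZero b}} → a ℕ.≤ b → + 1 ℚ./ b ℚ.≤ + 1 ℚ./ a
  1/-antitone (suc a) (suc b) a≤b = ℚ.toℚᵘ-cancel-≤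
    (ℚᵘ.≤-respˡ-≃ (ℚᵘ.≃-sym (ℚ.toℚᵘ-fromℚᵘ (ℚᵘ.mkℚᵘ (+ 1) b)))
    (ℚᵘ.≤-respʳ-≃ (ℚᵘ.≃-sym (ℚ.toℚᵘ-fromℚᵘ (ℚᵘ.mkℚᵘ (+ 1) a)))
      (ℚᵘ.*≤* (ℤ.*-monoˡ-≤-nonNeg (+ 1) (ℤ.+≤+ a≤b)))))

  0<1/ : ∀ a .{{_ : ℕ.NonZero a}} → 0ℚ ℚ.< + 1 ℚ./ a
  0<1/ (suc a) = ℚ.toℚᵘ-cancel-<
    (ℚᵘ.<-respʳ-≃ (ℚᵘ.≃-sym (ℚ.toℚᵘ-fromℚᵘ (ℚᵘ.mkℚᵘ (+ 1) a))) (ℚᵘ.*<* (+<+ (ℕ.s≤s ℕ.z≤n))))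

  1/<ε : ∀ ε → 0ℚ ℚ.< ε → ∀ a .{{_ : ℕ.NonZero a}} → ℚ.↧ₙ ε ℕ.< a → + 1 ℚ./ a ℚ.< ε
  1/<ε ε@(mkℚ +[1+ u ] v _) _ (suc a) v<a = ℚ.toℚᵘ-cancel-<
    (ℚᵘ.<-respˡ-≃ (ℚᵘ.≃-sym (ℚ.toℚᵘ-fromℚᵘ (ℚᵘ.mkℚᵘ (+ 1) a)))
      (ℚᵘ.*<* (+<+ (ℕ.<-≤-trans (subst (ℕ._< suc a) (sym (ℕ.+-identityʳ (suc v))) v<a) (ℕ.m≤m+n (suc a) (u ℕ.* suc a))))))
  1/<ε (mkℚ (+ 0) _ _)       (ℚ.*<* (+<+ ())) _ _
  1/<ε (mkℚ (ℤ.-[1+ _ ]) _ _) (ℚ.*<* ())       _ _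

  n<p^n : ∀ n → n ℕ.< p ℕ.^ n
  n<p^n zero    = ℕ.s≤s ℕ.z≤n
  n<p^n (suc n) = ℕ.≤-<-trans (n<p^n n)
    (ℕ.^-monoʳ-< p (ℕ.nonTrivial⇒n>1 p {{prime⇒nonTrivial p-prime}}) (ℕ.n<1+n n))

  p^-antitone : ∀ {m n} → m ℕ.≤ n → p^- n ℚ.≤ p^- m
  p^-antitone {m} {n} m≤n = 1/-antitone (p ℕ.^ m) (p ℕ.^ n) {{p^n≢0 m}} {{p^n≢0 n}} (ℕ.^-monoʳ-≤ p m≤n)

  0≤p^- : ∀ n → 0ℚ ℚ.≤ p^- n
  0≤p^- n = ℚ.<⇒≤ (0<1/ (p ℕ.^ n) {{p^n≢0 n}})

  ∣-∣-comm : ∀ a b → ∣ a ℚ.- b ∣ ≡ ∣ b ℚ.- a ∣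
  ∣-∣-comm a b = trans (sym (ℚ.∣-p∣≡∣p∣ (a ℚ.- b))) (cong ∣_∣ (flip a b))
    where
    flip : ∀ a b → ℚ.- (a ℚ.- b) ≡ b ℚ.- a
    flip = solve 2 (λ a b → :- (a :- b) := b :- a) refl
      where open +-*-Solver

  0≤a≤b⇒∣a-b∣≤b : ∀ a b → 0ℚ ℚ.≤ a → a ℚ.≤ b → ∣ a ℚ.- b ∣ ℚ.≤ b
  0≤a≤b⇒∣a-b∣≤b a b 0≤a a≤b = subst (ℚ._≤ b)
    (sym (trans (∣-∣-comm a b) (ℚ.0≤p⇒∣p∣≡p (subst (ℚ._≤ b ℚ.- a) (ℚ.+-inverseʳ a) (ℚ.+-monoˡ-≤ (ℚ.- a) a≤b)))))
    (subst (b ℚ.- a ℚ.≤_) (ℚ.+-identityʳ b) (ℚ.+-monoʳ-≤ b (ℚ.neg-antimono-≤ 0≤a)))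

  p^-close : ∀ {N u v} → u ≡ v ⊎ (N ℕ.≤ v × v ℕ.≤ u) → ∣ p^- u ℚ.- p^- v ∣ ℚ.≤ p^- N
  p^-close {N} {u} (inj₁ refl) = ℚ.≤-trans (ℚ.≤-reflexive (cong ∣_∣ (ℚ.+-inverseʳ (p^- u)))) (0≤p^- N)
  p^-close {N} {u} {v} (inj₂ (N≤v , v≤u)) = ℚ.≤-trans
    (0≤a≤b⇒∣a-b∣≤b (p^- u) (p^- v) (0≤p^- u) (p^-antitone {v} {u} v≤u))
    (p^-antitone {N} {v} N≤v)

  ord≤-close : ∀ x {N m n} → N ℕ.≤ n → n ℕ.≤ m → ord≤ x m ≡ ord≤ x n ⊎ (N ℕ.≤ ord≤ x n × ord≤ x n ℕ.≤ ord≤ x m)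
  ord≤-close x {N} {m} {n} N≤n n≤m = map₂
    (λ (n≤v , eq) → subst (N ℕ.≤_) (sym eq) N≤n , subst (ℕ._≤ ord≤ x m) (sym eq) n≤v)
    (ord≤-stable x (ℕ.≤⇒≤′ n≤m))

  -- |x|ₚ as the limit of p^(- min (ordₚ x) n), which also yields |0|ₚ = 0.
  ∣_∣ᶻ : ℤₚ → ℝ
  approx ∣ x ∣ᶻ n = p^- (ord≤ x n)
  cauchy ∣ x ∣ᶻ ε 0<ε = N , close
    where
    N = ℚ.↧ₙ ε
    p^-N<ε : p^- N ℚ.< ε
    p^-N<ε = 1/<ε ε 0<ε (p ℕ.^ N) {{p^n≢0 N}} (n<p^n N)
    close : ∀ m n → N ℕ.≤ m → N ℕ.≤ n → ∣ p^- (ord≤ x m) ℚ.- p^- (ord≤ x n) ∣ ℚ.< ε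
    close m n N≤m N≤n = [ (λ m≤n → subst (ℚ._< ε) (∣-∣-comm (p^- (ord≤ x n)) (p^- (ord≤ x m)))
                              (ℚ.≤-<-trans (p^-close {N} {ord≤ x n} {ord≤ x m} (ord≤-close x N≤m m≤n)) p^-N<ε))
                        , (λ n≤m → ℚ.≤-<-trans (p^-close {N} {ord≤ x m} {ord≤ x n} (ord≤-close x N≤n n≤m)) p^-N<ε)
                        ]′ (ℕ.≤-total m n)

  ∣_∣ᵠ : ℚₚ → ℝ
  ∣ x /p^ k ∣ᵠ = fromℚ (p^ k ℚ./ 1) *ᴿ ∣ x ∣ᶻ

  ----------------------------------------------------------------------

  -- K is a field in the constructive sense (an element is invertible iff
  -- it is apart from 0, and apartness is tight); finite over ℚₚ means
  -- having a finite ℚₚ-basis.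
  record FiniteExtension : Set₁ where
    field
      heytingField : HeytingField 0ℓ 0ℓ 0ℓ

    open HeytingField heytingField public

    commutativeRing : CommutativeRing 0ℓ 0ℓ
    commutativeRing = HeytingCommutativeRing.commutativeRing heytingCommutativeRing

    open CommutativeRing commutativeRing public using (rawRing; +-rawMonoid)
    open RawMonoidDefs +-rawMonoid public using (sum)
    open RawSemiringDefs (RawRing.rawSemiring rawRing) public using (_^_)

    field
      ι                  : ℚₚ → Carrier
      ι-isHomomorphism   : IsRingHomomorphism (CommutativeRing.rawRing ℚₚ-commutativeRing) rawRing ι
      degree             : ℕ
      basis              : Fin degree → Carrier
      basis-spans        : ∀ x → ∃ λ (c : Fin degree → ℚₚ) → x ≈ sum (λ i → ι (c i) * basis i)
      basis-independent  : ∀ (c : Fin degree → ℚₚ) → sum (λ i → ι (c i) * basis i) ≈ 0# →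
                           ∀ i → c i ≈ᵠ 0ᵠ

    ιᶻ : ℤₚ → Carrier
    ιᶻ x = ι (fromℤₚ x)

  -- The absolute values on K extending |·|ₚ. There is only one, so being
  -- given one is the same as being given "the" extension of |·|ₚ to K.
  record AbsoluteValue (K : FiniteExtension) : Set where
    open FiniteExtension K
    field
      ∥_∥       : Carrier → ℝ
      cong-∥∥   : ∀ {x y} → x ≈ y → ∥ x ∥ ≃ᴿ ∥ y ∥
      nonNeg    : ∀ x → 0ᴿ ≤ᴿ ∥ x ∥
      definite  : ∀ x → ∥ x ∥ ≃ᴿ 0ᴿ → x ≈ 0#
      mult      : ∀ x y → ∥ x * y ∥ ≃ᴿ ∥ x ∥ *ᴿ ∥ y ∥
      triangle  : ∀ x y → ∥ x + y ∥ ≤ᴿ ∥ x ∥ +ᴿ ∥ y ∥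
      extends   : ∀ x → ∥ ι x ∥ ≃ᴿ ∣ x ∣ᵠ

  ----------------------------------------------------------------------

  _∈_+_ℤₚ : ℤₚ → ℕ → ℕ → Set
  x ∈ r + q ℤₚ = ∃ λ z → x ≈ᶻ fromℕ r +ᶻ fromℕ q *ᶻ z

  record IsDenseIn_+_ℤₚ (r q : ℕ) (A : Pred ℕ 0ℓ) : Set where
    field
      subset : ∀ n → A n → fromℕ n ∈ r + q ℤₚ
      dense  : ∀ x → x ∈ r + q ℤₚ → ∀ ε → 0ᴿ <ᴿ ε → ∃ λ n → A n × ∣ fromℕ n +ᶻ -ᶻ x ∣ᶻ <ᴿ ε

  -- Density makes every A j nonempty.
  record TwistedPartition : Set₁ where
    field
      e        : ℕ
      size     : ℕ

    q : ℕ
    q = p ℕ.^ e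

    J : Set
    J = Fin size

    field
      A        : J → Pred ℕ 0ℓ
      cover    : ∀ n → ∃ λ j → A j n
      disjoint : ∀ i j n → A i n → A j n → i ≡ j
      r        : J → ℕ
      r<q      : ∀ j → r j ℕ.< q
      A-dense  : ∀ j → IsDenseIn r j + q ℤₚ (A j)

  module _ {K : FiniteExtension} (abs : AbsoluteValue K) where
    open FiniteExtension K
    open AbsoluteValue abs

    -- A continuous f automatically respects _≈ᶻ_: if x ≈ᶻ y then
    -- |y - x|ₚ = 0, so ∥ f y - f x ∥ is below every ε.
    Continuous : (ℤₚ → Carrier) → Set
    Continuous f = ∀ x ε → 0ᴿ <ᴿ ε → ∃ λ δ → 0ᴿ <ᴿ δ ×
      (∀ y → ∣ y +ᶻ -ᶻ x ∣ᶻ <ᴿ δ → ∥ f y - f x ∥ <ᴿ ε)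

    _ConvergesTo_ : (ℕ → Carrier) → Carrier → Set
    u ConvergesTo l = ∀ ε → 0ᴿ <ᴿ ε → ∃ λ N → ∀ n → N ℕ.≤ n → ∥ u n - l ∥ <ᴿ ε

    IsPowerSeriesOnℤₚ : (ℤₚ → Carrier) → Set
    IsPowerSeriesOnℤₚ f = ∃ λ (c : ℕ → Carrier) → ∀ x →
      (λ n → sum {n} (λ i → c (toℕ i) * ιᶻ x ^ toℕ i)) ConvergesTo f x

  record ApproximateTwistedInterpolation (s : ℕ → ℤₚ) : Set₁ where
    field
      partition : TwistedPartition
      K         : FiniteExtension
      abs       : AbsoluteValue K

    open TwistedPartition partition public
    open FiniteExtension K using (Carrier; _-_; ιᶻ)
    open AbsoluteValue abs using (∥_∥)

    field
      sⱼ            : J → ℤₚ → Carrier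
      sⱼ-continuous : ∀ j → Continuous abs (sⱼ j)
      C D           : ℝ
      0≤C           : 0ᴿ ≤ᴿ C
      0≤D           : 0ᴿ ≤ᴿ D
      D<1           : D <ᴿ 1ᴿ
      approximates  : ∀ j n → A j n → ∥ ιᶻ (s n) - sⱼ j (fromℕ n) ∥ ≤ᴿ C *ᴿ D ^ᴿ n

  IsAnalytic : ∀ {s} → ApproximateTwistedInterpolation s → Set
  IsAnalytic I = ∀ j → IsPowerSeriesOnℤₚ abs (λ x → sⱼ j (fromℕ q *ᶻ x +ᶻ fromℕ (r j)))
    where open ApproximateTwistedInterpolation I

  open RawMonoidDefs (CommutativeRing.+-rawMonoid ℤₚ-commutativeRing) public using () renaming (sum to sumᶻ)

  SatisfiesRecurrence : ∀ {ℓ} → (Fin ℓ → ℤₚ) → (ℕ → ℤₚ) → Set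
  SatisfiesRecurrence {ℓ} a s = ∀ n → s (n ℕ.+ ℓ) +ᶻ sumᶻ (λ i → a i *ᶻ s (n ℕ.+ toℕ i)) ≈ᶻ fromℕ 0

{-# OPTIONS --safe #-}
-- Let B be the shift by N on the ℤₚ-module V of solutions of the recurrence.
-- V/p²V is finite, so for suitable N = pᵉ(pᶠ - 1) one has B² ≡ B mod p² on V;
-- as V is saturated, B² = B + p²T with T : V → V commuting with B. Hence
--   Bᵏ = Σᵢ C(k - i, i) p²ⁱTⁱ + Σᵢ C(k - 1 - i, i) p²ⁱTⁱ (B - 1),
-- the sums being over those i with natural k - i and k - 1 - i. Now replace the
-- binomial coefficients by the corresponding polynomials in k and sum over all i:
-- this changes the value only in the terms with i ≥ k, which vanish mod pᵏ, and
-- since pⁱ/i! ∈ ℤₚ the result is a series Σ pⁱQᵢ(k) with Qᵢ ∈ ℤₚ[k] of degree at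
-- most i, i.e. a power series in k converging on ℤₚ. On n = j + kN, the number
-- k is an affine function of ⌊n/pᵉ⌋ over ℤₚ, because pᶠ - 1 is a unit. So K = ℚₚ
-- suffices, with A_j the residue classes modulo N; neither the roots of the
-- characteristic polynomial nor the idempotent lim B^(pᵏ) are needed.

module Submission where

open import Defs
open import Algebra.Apartness.Bundles using (HeytingField)
open import Algebra.Bundles using (AbelianGroup; CommutativeRing; RawRing)
import Algebra.Definitions.RawSemiring as RawSemiringDefs
import Algebra.Morphism.Construct.Identity as Identity
open import Algebra.Morphism.Structures using (IsRingHomomorphism)
import Algebra.Properties.CommutativeSemigroup as CommutativeSemigroupProperties
import Algebra.Properties.Group as GroupProperties
import Algebra.Properties.Ring as RingProperties
import Algebra.Properties.Semiring.Sum as SemiringSum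
import Algebra.Solver.Ring as RingSolver
open import Algebra.Solver.Ring.AlmostCommutativeRing using (_-Raw-AlmostCommutative⟶_; fromCommutativeRing)
open import Algebra.Structures using (IsCommutativeRing)
open import Data.Fin.Base using (Fin; zero; toℕ; fromℕ<; funToFin; finToFun)
import Data.Fin.Properties as Fin
open import Data.Integer.Base as ℤ using (ℤ; +_; _%ℕ_; _/ℕ_)
open import Data.Integer.DivMod using (a≡a%ℕn+[a/ℕn]*n; n%ℕd<d)
open import Data.Integer.Divisibility.Signed as ℤ∣ using (_∣_; divides; _∣?_; ∣⇒∣ᵤ; ∣-refl; ∣-trans; ∣m∣n⇒∣m-n; ∣n⇒∣m*n; *-cancelʳ-∣)
import Data.Integer.Properties as ℤ
open import Data.Integer.Tactic.RingSolver using (solve-∀)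
open import Data.Maybe.Base using (Maybe; just; nothing)
open import Data.Nat.Base as ℕ using (ℕ; zero; suc; _!)
open import Data.Nat.Combinatorics using (_C_; nCk+nC[k+1]≡[n+1]C[k+1])
open import Data.Nat.Coprimality using (prime⇒coprime; coprime-Bézout)
import Data.Nat.DivMod as ℕ
import Data.Nat.Divisibility as ℕ∣
open import Data.Nat.GCD using (module Bézout)
open import Data.Nat.Induction using (<-rec)
open import Data.Nat.Primality using (Prime; prime⇒nonZero; prime⇒nonTrivial; euclidsLemma)
import Data.Nat.Properties as ℕ
open import Data.Product.Base using (∃; ∃₂; _×_; _,_; proj₁; proj₂)
open import Data.Rational.Base as ℚ using (ℚ; 0ℚ; 1ℚ; ½; ∣_∣)
import Data.Rational.Properties as ℚ
open import Data.Rational.Solver using (module +-*-Solver)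
import Data.Rational.Unnormalised.Base as ℚᵘ
import Data.Rational.Unnormalised.Properties as ℚᵘ
open import Data.Sum.Base using (_⊎_; inj₁; inj₂; [_,_]′) renaming (map to ⊎-map)
open import Data.Vec.Functional using (foldr)
open import Function.Base using (_∘_)
open import Level using (0ℓ)
import Relation.Binary.Reasoning.Setoid as SetoidReasoning
open import Relation.Binary.PropositionalEquality using (_≡_; refl; sym; trans; cong; cong₂; subst; subst₂; module ≡-Reasoning)
open import Relation.Nullary.Decidable using (Dec; yes; no)
open import Relation.Nullary.Negation using (¬_; contradiction)
open import Relation.Unary using (Pred)

-- The obstacle is that a₀ may be divisible by p. A power of the shift is only close to an
-- idempotent. The relation B² = B + p²T needs no decomposition of V along that idempotent: it makes
-- Bᵏ obey a two-step recursion, solved by Fibonacci polynomials in p²T. The exponent 2 in p² splits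
-- p²ⁱ into two factors pⁱ. One clears the denominator i!, the other makes the series converge; for
-- p = 2 the numbers pⁱ/i! alone do not tend to 0. One N has to serve all of V at once, because the
-- expansion of s also involves T s, T(T s) and so on. Therefore N is a multiple of the factorial of
-- the number of windows modulo p², which bounds every preperiod and every period. On the class of j
-- modulo N the error at n = j + kN is at most p⁻ᵏ. A rational D < 1 with Dᴺ ≥ 1/p turns this into C
-- Dⁿ, and C = p pays for the remainder j < N.

module Summation {a} {A : Set a} (_+_ : A → A → A) (0# : A) where

  -- Depends on the operations alone, so that the same sum is meant in a ring and in each of its
  -- quotients `ring/p^ n`.
  Σ< : ℕ → (ℕ → A) → A
  Σ< zero    f = 0#
  Σ< (suc n) f = f 0 + Σ< n (f ∘ suc)

-- Finite sums in a commutative ring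

module FiniteSums {c ℓ} (R : CommutativeRing c ℓ) where

  open CommutativeRing R renaming (refl to ≈-refl; sym to ≈-sym; trans to ≈-trans)
  open Summation _+_ 0#
  open CommutativeSemigroupProperties +-commutativeSemigroup using (interchange)

  Σ<-cong< : ∀ n {f g} → (∀ i → i ℕ.< n → f i ≈ g i) → Σ< n f ≈ Σ< n g
  Σ<-cong< zero    e = ≈-refl
  Σ<-cong< (suc n) e = +-cong (e 0 (ℕ.s≤s ℕ.z≤n)) (Σ<-cong< n λ i i<n → e (suc i) (ℕ.s≤s i<n))

  Σ<-cong : ∀ n {f g} → (∀ i → f i ≈ g i) → Σ< n f ≈ Σ< n g
  Σ<-cong n e = Σ<-cong< n λ i _ → e i

  Σ<-0 : ∀ n {f} → (∀ i → f i ≈ 0#) → Σ< n f ≈ 0#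
  Σ<-0 zero    e = ≈-refl
  Σ<-0 (suc n) e = ≈-trans (+-cong (e 0) (Σ<-0 n (e ∘ suc))) (+-identityˡ 0#)

  Σ<-+ : ∀ n f g → Σ< n (λ i → f i + g i) ≈ Σ< n f + Σ< n g
  Σ<-+ zero    f g = ≈-sym (+-identityˡ 0#)
  Σ<-+ (suc n) f g = ≈-trans (+-congˡ (Σ<-+ n (f ∘ suc) (g ∘ suc))) (interchange (f 0) (g 0) (Σ< n (f ∘ suc)) (Σ< n (g ∘ suc)))

  Σ<-*ˡ : ∀ n x f → x * Σ< n f ≈ Σ< n (λ i → x * f i)
  Σ<-*ˡ zero    x f = zeroʳ x
  Σ<-*ˡ (suc n) x f = ≈-trans (distribˡ x (f 0) (Σ< n (f ∘ suc))) (+-congˡ (Σ<-*ˡ n x (f ∘ suc)))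

  Σ<-*ʳ : ∀ n x f → Σ< n f * x ≈ Σ< n (λ i → f i * x)
  Σ<-*ʳ n x f = ≈-trans (*-comm (Σ< n f) x) (≈-trans (Σ<-*ˡ n x f) (Σ<-cong n λ i → *-comm x (f i)))

  Σ<-swap : ∀ k n (f : ℕ → ℕ → Carrier) → Σ< k (λ i → Σ< n (f i)) ≈ Σ< n (λ j → Σ< k (λ i → f i j))
  Σ<-swap zero    n f = ≈-sym (Σ<-0 n λ _ → ≈-refl)
  Σ<-swap (suc k) n f = ≈-trans (+-congˡ (Σ<-swap k n (f ∘ suc))) (≈-sym (Σ<-+ n (f 0) (λ j → Σ< k (λ i → f (suc i) j))))

  Σ<-last : ∀ n f → Σ< (suc n) f ≈ Σ< n f + f n
  Σ<-last zero    f = +-comm (f 0) 0#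
  Σ<-last (suc n) f = ≈-trans (+-congˡ (Σ<-last n (f ∘ suc))) (≈-sym (+-assoc (f 0) (Σ< n (f ∘ suc)) (f (suc n))))

  -- Both sides are the sum of `g i` over i ≤ n, once with the last and once with the first term
  -- split off.
  geometric : ∀ n t (g : ℕ → Carrier) → (∀ i → g (suc i) ≈ t * g i) → Σ< n g + g n ≈ g 0 + t * Σ< n g
  geometric zero    t g step = ≈-trans (+-identityˡ (g 0)) (≈-sym (≈-trans (+-congˡ (zeroʳ t)) (+-identityʳ (g 0))))
  geometric (suc n) t g step = ≈-trans
    (+-cong (≈-trans (Σ<-last n g) (geometric n t g step)) (step n))
    (≈-trans (+-assoc (g 0) (t * Σ< n g) (t * g n))
      (+-congˡ (≈-trans (≈-sym (distribˡ t (Σ< n g) (g n))) (*-congˡ (≈-sym (Σ<-last n g))))))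

-- Quotient rings and Heyting fields

module _ {c ℓ} (R : CommutativeRing c ℓ) where

  open CommutativeRing R

  -- Serves for the congruences modulo pⁿ, which thereby inherit all lemmas on sums and equational
  -- reasoning.
  quotientRing : (_~_ : Carrier → Carrier → Set ℓ) →
    (∀ {x y} → x ≈ y → x ~ y) → (∀ {x y} → x ~ y → y ~ x) → (∀ {x y z} → x ~ y → y ~ z → x ~ z) →
    (∀ {x y u v} → x ~ y → u ~ v → (x + u) ~ (y + v)) → (∀ {x y u v} → x ~ y → u ~ v → (x * u) ~ (y * v)) →
    (∀ {x y} → x ~ y → (- x) ~ (- y)) → CommutativeRing c ℓ
  quotientRing _~_ ≈⇒~ ~-sym ~-trans ~-+ ~-* ~-neg = record
    { Carrier = Carrier ; _≈_ = _~_ ; _+_ = _+_ ; _*_ = _*_ ; -_ = -_ ; 0# = 0# ; 1# = 1#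
    ; isCommutativeRing = record
      { isRing = record
        { +-isAbelianGroup = record
          { isGroup = record
            { isMonoid = record
              { isSemigroup = record
                { isMagma = record
                  { isEquivalence = record { refl = ≈⇒~ (CommutativeRing.refl R) ; sym = ~-sym ; trans = ~-trans }
                  ; ∙-cong = ~-+
                  }
                ; assoc = λ x y z → ≈⇒~ (+-assoc x y z)
                }
              ; identity = (λ x → ≈⇒~ (+-identityˡ x)) , (λ x → ≈⇒~ (+-identityʳ x))
              }
            ; inverse = (λ x → ≈⇒~ (-‿inverseˡ x)) , (λ x → ≈⇒~ (-‿inverseʳ x))
            ; ⁻¹-cong = ~-neg
            }
          ; comm = λ x y → ≈⇒~ (+-comm x y)
          }
        ; *-cong = ~-*
        ; *-assoc = λ x y z → ≈⇒~ (*-assoc x y z)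
        ; *-identity = (λ x → ≈⇒~ (*-identityˡ x)) , (λ x → ≈⇒~ (*-identityʳ x))
        ; distrib = (λ x y z → ≈⇒~ (distribˡ x y z)) , (λ x y z → ≈⇒~ (distribʳ x y z))
        }
      ; *-comm = λ x y → ≈⇒~ (*-comm x y)
      }
    }

-- Apartness from 0 as a predicate of one variable. `split-+` becomes cotransitivity of the relation
-- `NonZero (x - y)`, and `split-*` together with `one` shows that invertible elements are apart
-- from 0.
record IsNonZero (R : CommutativeRing 0ℓ 0ℓ) (NonZero : CommutativeRing.Carrier R → Set) : Set where
  open CommutativeRing R
  field
    resp     : ∀ {x y} → x ≈ y → NonZero x → NonZero y
    split-+  : ∀ x y → NonZero (x + y) → NonZero x ⊎ NonZero y
    split-*  : ∀ x y → NonZero (x * y) → NonZero x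
    unneg    : ∀ x → NonZero (- x) → NonZero x
    one      : NonZero 1#
    zero∉    : ¬ NonZero 0#
    tight    : ∀ x → ¬ NonZero x → x ≈ 0#
    inverse  : ∀ x → NonZero x → ∃ λ y → x * y ≈ 1#

heytingField : ∀ (R : CommutativeRing 0ℓ 0ℓ) {NonZero} → IsNonZero R NonZero → HeytingField 0ℓ 0ℓ 0ℓ
heytingField R {NonZero} nz = record
  { _#_ = λ x y → NonZero (x - y)
  ; isHeytingField = record
    { isHeytingCommutativeRing = record
      { isCommutativeRing = isCommutativeRing
      ; isApartnessRelation = record
        { irrefl  = λ {x} {y} → irrefl x y
        ; sym     = λ {x} {y} x#y → unneg (y - x) (resp (flip x y) x#y)
        ; cotrans = λ {x} {y} x#y z → split-+ (x - z) (z - y) (resp (insert x y z) x#y)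
        }
      ; #⇒invertible = λ {x} {y} x#y → invertible (x - y) (inverse (x - y) x#y)
      ; invertible⇒# = λ {x} {y} (z , _ , e) → split-* (x - y) z (resp (≈-sym e) one)
      }
    ; tight = λ x y → (λ ¬x#y → -‿cancel x y (tight (x - y) ¬x#y)) , irrefl x y
    }
  }
  where
  open CommutativeRing R renaming (sym to ≈-sym; trans to ≈-trans; zero to *-zero)
  open IsNonZero nz
  open RingProperties ring using (-‿involutive; -‿+-comm)
  irrefl : ∀ x y → x ≈ y → ¬ NonZero (x - y)
  irrefl x y x≈y x#y = zero∉ (resp (≈-trans (+-congʳ x≈y) (-‿inverseʳ y)) x#y)
  flip : ∀ x y → x - y ≈ - (y - x)
  flip x y = ≈-trans (+-comm x (- y)) (≈-trans (+-congˡ (≈-sym (-‿involutive x))) (-‿+-comm y (- x)))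
  insert : ∀ x y z → x - y ≈ (x - z) + (z - y)
  insert x y z = ≈-sym (≈-trans (+-assoc x (- z) (z - y))
    (+-congˡ (≈-trans (≈-sym (+-assoc (- z) z (- y))) (≈-trans (+-congʳ (-‿inverseˡ z)) (+-identityˡ (- y))))))
  -‿cancel : ∀ x y → x - y ≈ 0# → x ≈ y
  -‿cancel x y e = ≈-trans (≈-sym (+-identityʳ x)) (≈-trans (+-congˡ (≈-sym (-‿inverseˡ y)))
    (≈-trans (≈-sym (+-assoc x (- y) y)) (≈-trans (+-congʳ e) (+-identityˡ y))))
  invertible : ∀ x → (∃ λ y → x * y ≈ 1#) → ∃ λ y → y * x ≈ 1# × x * y ≈ 1#
  invertible x (y , e) = y , ≈-trans (*-comm y x) e , e

-- Elementary number theory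

-- The equal remainders cancel and leave (b / d ∸ a / d) d. With truncated subtraction this also
-- covers b < a.
%-≡⇒∣∸ : ∀ {a b} d .{{_ : ℕ.NonZero d}} → a ℕ.% d ≡ b ℕ.% d → d ℕ∣.∣ b ℕ.∸ a
%-≡⇒∣∸ {a} {b} d eq = subst (d ℕ∣.∣_)
  (trans (ℕ.*-distribʳ-∸ d (b ℕ./ d) (a ℕ./ d))
    (trans (sym (ℕ.[m+n]∸[m+o]≡n∸o (b ℕ.% d) (b ℕ./ d ℕ.* d) (a ℕ./ d ℕ.* d)))
      (cong₂ ℕ._∸_ (sym (ℕ.m≡m%n+[m/n]*n b d)) (trans (cong (ℕ._+ a ℕ./ d ℕ.* d) (sym eq)) (sym (ℕ.m≡m%n+[m/n]*n a d))))))
  (ℕ∣.n∣m*n (b ℕ./ d ℕ.∸ a ℕ./ d))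

-- Two of the M + 1 powers p⁰, ..., pᴹ agree modulo M, say those with exponents i < j; then e = i
-- and `suc f` = j - i. The pigeonhole principle avoids splitting M into its p-part and a part prime
-- to p.
∣p^e*[p^f-1] : ∀ p M .{{_ : ℕ.NonZero M}} → ∃₂ λ e f → M ℕ∣.∣ p ℕ.^ e ℕ.* (p ℕ.^ suc f ℕ.∸ 1)
∣p^e*[p^f-1] p M = from-collision (Fin.pigeonhole (ℕ.n<1+n M) (λ i → fromℕ< (ℕ.m%n<n (p ℕ.^ toℕ i) M)))
  where
  from-collision : (∃₂ λ (i j : Fin (suc M)) → toℕ i ℕ.< toℕ j ×
                     fromℕ< (ℕ.m%n<n (p ℕ.^ toℕ i) M) ≡ fromℕ< (ℕ.m%n<n (p ℕ.^ toℕ j) M)) →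
                   ∃₂ λ e f → M ℕ∣.∣ p ℕ.^ e ℕ.* (p ℕ.^ suc f ℕ.∸ 1)
  from-collision (i , j , i<j , eq) = e , f , subst (M ℕ∣.∣_) difference
    (%-≡⇒∣∸ M (trans (sym (Fin.toℕ-fromℕ< _)) (trans (cong toℕ eq) (Fin.toℕ-fromℕ< _))))
    where
    e = toℕ i
    f = toℕ j ℕ.∸ suc e
    difference : p ℕ.^ toℕ j ℕ.∸ p ℕ.^ e ≡ p ℕ.^ e ℕ.* (p ℕ.^ suc f ℕ.∸ 1)
    difference = begin
      p ℕ.^ toℕ j ℕ.∸ p ℕ.^ e                           ≡⟨ cong (λ k → p ℕ.^ k ℕ.∸ p ℕ.^ e) (trans (sym (ℕ.m+[n∸m]≡n i<j)) (sym (ℕ.+-suc e f))) ⟩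
      p ℕ.^ (e ℕ.+ suc f) ℕ.∸ p ℕ.^ e                   ≡⟨ cong₂ ℕ._∸_ (ℕ.^-distribˡ-+-* p e (suc f)) (sym (ℕ.*-identityʳ (p ℕ.^ e))) ⟩
      p ℕ.^ e ℕ.* p ℕ.^ suc f ℕ.∸ p ℕ.^ e ℕ.* 1         ≡⟨ ℕ.*-distribˡ-∸ (p ℕ.^ e) (p ℕ.^ suc f) 1 ⟨
      p ℕ.^ e ℕ.* (p ℕ.^ suc f ℕ.∸ 1)                   ∎
      where open ≡-Reasoning

module _ {p : ℕ} (p-prime : Prime p) where

  private
    instance
      p-nonZero : ℕ.NonZero p
      p-nonZero = prime⇒nonZero p-prime

    1<p : 1 ℕ.< p
    1<p = ℕ.nonTrivial⇒n>1 p {{prime⇒nonTrivial p-prime}}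

  ∤-* : ∀ {a b} → ¬ p ℕ∣.∣ a → ¬ p ℕ∣.∣ b → ¬ p ℕ∣.∣ a ℕ.* b
  ∤-* {a} {b} p∤a p∤b p∣ab with euclidsLemma a b p-prime p∣ab
  ... | inj₁ p∣a = p∤a p∣a
  ... | inj₂ p∣b = p∤b p∣b

  p∤1 : ¬ p ℕ∣.∣ 1
  p∤1 p∣1 = ℕ.<⇒≱ 1<p (ℕ∣.∣⇒≤ p∣1)

  -- The exponent of p in i! is ⌊i/p⌋ plus its exponent in ⌊i/p⌋!
  !-p-part : ∀ i → ∃₂ λ j r → ∃ λ u → i ≡ j ℕ.* p ℕ.+ r × r ℕ.< p × ¬ p ℕ∣.∣ u × i ! ≡ p ℕ.^ j ℕ.* j ! ℕ.* u
  !-p-part zero    = 0 , 0 , 1 , refl , ℕ.<-trans (ℕ.s≤s ℕ.z≤n) 1<p , p∤1 , refl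
  !-p-part (suc i) with !-p-part i
  ... | j , r , u , i≡ , r<p , p∤u , i!≡ with suc r ℕ.<? p
  ...   | yes 1+r<p = j , suc r , suc i ℕ.* u , 1+i≡ , 1+r<p , ∤-* p∤1+i p∤u ,
                      trans (cong (suc i ℕ.*_) i!≡) (swap (suc i) (p ℕ.^ j ℕ.* j !) u)
    where
    1+i≡ : suc i ≡ j ℕ.* p ℕ.+ suc r
    1+i≡ = trans (cong suc i≡) (sym (ℕ.+-suc (j ℕ.* p) r))
    p∤1+i : ¬ p ℕ∣.∣ suc i
    p∤1+i p∣1+i = ℕ.<⇒≱ 1+r<p (ℕ∣.∣⇒≤ (ℕ∣.∣m+n∣m⇒∣n (subst (p ℕ∣.∣_) 1+i≡ p∣1+i) (ℕ∣.n∣m*n j)))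
    swap : ∀ a b c → a ℕ.* (b ℕ.* c) ≡ b ℕ.* (a ℕ.* c)
    swap a b c = trans (sym (ℕ.*-assoc a b c)) (trans (cong (ℕ._* c) (ℕ.*-comm a b)) (ℕ.*-assoc b a c))
  ...   | no  1+r≮p = suc j , 0 , u , trans 1+i≡ (sym (ℕ.+-identityʳ _)) , ℕ.<-trans (ℕ.s≤s ℕ.z≤n) 1<p , p∤u ,
                      trans (cong₂ ℕ._*_ 1+i≡ i!≡) (regroup p j (p ℕ.^ j) (j !) u)
    where
    1+i≡ : suc i ≡ suc j ℕ.* p
    1+i≡ = trans (cong suc i≡) (trans (sym (ℕ.+-suc (j ℕ.* p) r))
             (trans (cong (j ℕ.* p ℕ.+_) (ℕ.≤-antisym r<p (ℕ.≮⇒≥ 1+r≮p))) (ℕ.+-comm (j ℕ.* p) p)))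
    regroup : ∀ p j q f u → suc j ℕ.* p ℕ.* (q ℕ.* f ℕ.* u) ≡ p ℕ.* q ℕ.* (suc j ℕ.* f) ℕ.* u
    regroup p j q f u = trans (sym (ℕ.*-assoc (suc j ℕ.* p) (q ℕ.* f) u)) (cong (ℕ._* u)
      (trans (cong (ℕ._* (q ℕ.* f)) (ℕ.*-comm (suc j) p)) (trans (ℕ.*-assoc p (suc j) (q ℕ.* f))
        (trans (cong (p ℕ.*_) (trans (sym (ℕ.*-assoc (suc j) q f)) (trans (cong (ℕ._* f) (ℕ.*-comm (suc j) q)) (ℕ.*-assoc q (suc j) f))))
          (sym (ℕ.*-assoc p q (suc j ℕ.* f)))))))

  -- With j = ⌊i/p⌋ the exponent of p in i! is j + v, where v ≤ j is the exponent in j!, and 2j ≤ pj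
  -- ≤ i. The bound is cruder than Legendre's formula but suffices for every p.
  !-valuation : ∀ i → ∃₂ λ v u → v ℕ.≤ i × ¬ p ℕ∣.∣ u × i ! ≡ p ℕ.^ v ℕ.* u
  !-valuation = <-rec _ step
    where
    step : ∀ i → (∀ {j} → j ℕ.< i → ∃₂ λ v u → v ℕ.≤ j × ¬ p ℕ∣.∣ u × j ! ≡ p ℕ.^ v ℕ.* u) →
           ∃₂ λ v u → v ℕ.≤ i × ¬ p ℕ∣.∣ u × i ! ≡ p ℕ.^ v ℕ.* u
    step zero    rec = 0 , 1 , ℕ.z≤n , p∤1 , refl
    step i@(suc _) rec with !-p-part i
    ... | j , r , u , i≡ , r<p , p∤u , i!≡ with j
    ...   | zero  = 0 , u , ℕ.z≤n , p∤u , trans i!≡ (cong (ℕ._* u) (ℕ.*-identityˡ 1))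
    ...   | j@(suc j′) = combine (rec (ℕ.≤-trans (ℕ.s≤s (ℕ.m≤n+m j j′)) j+j≤i))
      where
      j+j≤i : j ℕ.+ j ℕ.≤ i
      j+j≤i = ℕ.≤-trans (ℕ.≤-trans (ℕ.≤-reflexive (trans (cong (j ℕ.+_) (sym (ℕ.+-identityʳ j))) (ℕ.*-comm 2 j)))
                (ℕ.*-monoʳ-≤ j 1<p)) (ℕ.≤-trans (ℕ.m≤m+n (j ℕ.* p) r) (ℕ.≤-reflexive (sym i≡)))
      combine : (∃₂ λ v u → v ℕ.≤ j × ¬ p ℕ∣.∣ u × j ! ≡ p ℕ.^ v ℕ.* u) →
                ∃₂ λ v u → v ℕ.≤ i × ¬ p ℕ∣.∣ u × i ! ≡ p ℕ.^ v ℕ.* u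
      combine (v , u′ , v≤j , p∤u′ , j!≡) = j ℕ.+ v , u′ ℕ.* u , ℕ.≤-trans (ℕ.+-monoʳ-≤ j v≤j) j+j≤i , ∤-* p∤u′ p∤u , (begin
        i !                                        ≡⟨ i!≡ ⟩
        p ℕ.^ j ℕ.* j ! ℕ.* u                      ≡⟨ cong (λ t → p ℕ.^ j ℕ.* t ℕ.* u) j!≡ ⟩
        p ℕ.^ j ℕ.* (p ℕ.^ v ℕ.* u′) ℕ.* u         ≡⟨ cong (ℕ._* u) (ℕ.*-assoc (p ℕ.^ j) (p ℕ.^ v) u′) ⟨
        p ℕ.^ j ℕ.* p ℕ.^ v ℕ.* u′ ℕ.* u           ≡⟨ ℕ.*-assoc (p ℕ.^ j ℕ.* p ℕ.^ v) u′ u ⟩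
        p ℕ.^ j ℕ.* p ℕ.^ v ℕ.* (u′ ℕ.* u)         ≡⟨ cong (ℕ._* (u′ ℕ.* u)) (ℕ.^-distribˡ-+-* p j v) ⟨
        p ℕ.^ (j ℕ.+ v) ℕ.* (u′ ℕ.* u)             ∎)
        where open ≡-Reasoning

  -- Bézout's identity for p and the remainder r = a % p: a number strictly between 0 and p is
  -- coprime to p. Replacing r by a changes the product by a multiple of p.
  modular-inverse : ∀ a → ¬ p ℕ∣.∣ a → ∃ λ w → + p ℤ∣.∣ + a ℤ.* w ℤ.- + 1
  modular-inverse a p∤a = extend (bézout (coprime-Bézout (prime⇒coprime p-prime {{ℕ.≢-nonZero r≢0}} (ℕ.m%n<n a p))))
    where
    r = a ℕ.% p
    r≢0 : ¬ r ≡ 0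
    r≢0 r≡0 = p∤a (ℕ∣.m%n≡0⇒n∣m a p r≡0)
    bézout : Bézout.Identity 1 p r → ∃ λ w → + p ℤ∣.∣ + r ℤ.* w ℤ.- + 1
    bézout (Bézout.+- u v eq) = ℤ.- + v , ℤ∣.divides (ℤ.- + u)
      (trans (lem (+ r) (+ v)) (trans (cong ℤ.-_ (trans (cong (ℤ._+_ (+ 1)) (sym (ℤ.pos-* v r)))
        (trans (sym (ℤ.pos-+ 1 (v ℕ.* r))) (trans (cong +_ eq) (ℤ.pos-* u p))))) (ℤ.neg-distribˡ-* (+ u) (+ p))))
      where
      lem : ∀ r v → r ℤ.* (ℤ.- v) ℤ.- + 1 ≡ ℤ.- (+ 1 ℤ.+ v ℤ.* r)
      lem = solve-∀
    bézout (Bézout.-+ u v eq) = + v , ℤ∣.divides (+ u)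
      (trans (cong (ℤ._- + 1) (trans (ℤ.*-comm (+ r) (+ v)) (trans (sym (ℤ.pos-* v r))
        (trans (cong +_ (sym eq)) (trans (ℤ.pos-+ 1 (u ℕ.* p)) (cong (ℤ._+_ (+ 1)) (ℤ.pos-* u p))))))) (lem (+ u ℤ.* + p)))
      where
      lem : ∀ a → + 1 ℤ.+ a ℤ.- + 1 ≡ a
      lem = solve-∀
    extend : (∃ λ w → + p ℤ∣.∣ + r ℤ.* w ℤ.- + 1) → ∃ λ w → + p ℤ∣.∣ + a ℤ.* w ℤ.- + 1
    extend (w , ℤ∣.divides t eq) = w , ℤ∣.divides (t ℤ.+ + (a ℕ./ p) ℤ.* w)
      (trans (cong (λ x → x ℤ.* w ℤ.- + 1) (trans (cong +_ (ℕ.m≡m%n+[m/n]*n a p))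
               (trans (ℤ.pos-+ r (a ℕ./ p ℕ.* p)) (cong (ℤ._+_ (+ r)) (ℤ.pos-* (a ℕ./ p) p)))))
        (trans (lem₁ (+ r) (+ (a ℕ./ p)) (+ p) w) (trans (cong (ℤ._+ + (a ℕ./ p) ℤ.* + p ℤ.* w) eq) (lem₂ t (+ (a ℕ./ p)) (+ p) w))))
      where
      lem₁ : ∀ r q p w → (r ℤ.+ q ℤ.* p) ℤ.* w ℤ.- + 1 ≡ r ℤ.* w ℤ.- + 1 ℤ.+ q ℤ.* p ℤ.* w
      lem₁ = solve-∀
      lem₂ : ∀ t q p w → t ℤ.* p ℤ.+ q ℤ.* p ℤ.* w ≡ (t ℤ.+ q ℤ.* w) ℤ.* p
      lem₂ = solve-∀

-- The coefficients of the Fibonacci polynomials: if B² = B + t, then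
-- Bᵏ = Σᵢ fib (k + 1) i tⁱ + Σᵢ fib k i tⁱ (B - 1).
fib : ℕ → ℕ → ℕ
fib zero    i = 0
fib (suc k) i = (k ℕ.∸ i) C i

-- Pascal's rule, as long as the subtractions are exact. Beyond that point truncation makes the
-- upper entries 0 while the lower ones are positive, so all three coefficients vanish.
fib-rec : ∀ k i → fib (suc (suc k)) (suc i) ≡ fib (suc k) (suc i) ℕ.+ fib k i
fib-rec zero    i = trans (cong (_C suc i) (ℕ.0∸n≡0 i)) refl
fib-rec (suc k) i with i ℕ.≤? k
... | yes i≤k = trans (cong (_C suc i) (ℕ.+-∸-assoc 1 i≤k))
                  (trans (sym (nCk+nC[k+1]≡[n+1]C[k+1] (k ℕ.∸ i) i)) (ℕ.+-comm ((k ℕ.∸ i) C i) ((k ℕ.∸ i) C suc i)))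
... | no  i≰k = vanish i (ℕ.≰⇒> i≰k)
  where
  vanish : ∀ i → k ℕ.< i → (suc k ℕ.∸ i) C suc i ≡ (k ℕ.∸ i) C suc i ℕ.+ (k ℕ.∸ i) C i
  vanish (suc i) (ℕ.s≤s k≤i) rewrite ℕ.m≤n⇒m∸n≡0 k≤i | ℕ.m≤n⇒m∸n≡0 (ℕ.m≤n⇒m≤1+n k≤i) = refl

-- An axiomatic description of ℤₚ.
record PadicRing (p : ℕ) : Set₁ where
  infix  4 _≈_ _≈[_]_
  infixl 6 _+_
  infixl 7 _*_ _/p^_
  infix  8 -_
  field
    Carrier : Set
    _≈_     : Carrier → Carrier → Set
    _+_ _*_ : Carrier → Carrier → Carrier
    -_      : Carrier → Carrier
    fromℤ   : ℤ → Carrier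
    isCommutativeRing : IsCommutativeRing _≈_ _+_ _*_ -_ (fromℤ (+ 0)) (fromℤ (+ 1))
    fromℤ-+ : ∀ a b → fromℤ (a ℤ.+ b) ≈ fromℤ a + fromℤ b
    fromℤ-* : ∀ a b → fromℤ (a ℤ.* b) ≈ fromℤ a * fromℤ b
    fromℤ-‿ : ∀ a → fromℤ (ℤ.- a) ≈ - fromℤ a
    -- x ≈[ n ] y is congruence modulo pⁿ.
    _≈[_]_    : Carrier → ℕ → Carrier → Set
    ≈⇒≈[]     : ∀ {n x y} → x ≈ y → x ≈[ n ] y
    ≈[]⇒≈     : ∀ {x y} → (∀ n → x ≈[ n ] y) → x ≈ y
    ≈[]-sym   : ∀ {n x y} → x ≈[ n ] y → y ≈[ n ] x
    ≈[]-trans : ∀ {n x y z} → x ≈[ n ] y → y ≈[ n ] z → x ≈[ n ] z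
    ≈[]-+     : ∀ {n x y u v} → x ≈[ n ] y → u ≈[ n ] v → x + u ≈[ n ] y + v
    ≈[]-*     : ∀ {n x y u v} → x ≈[ n ] y → u ≈[ n ] v → x * u ≈[ n ] y * v
    ≈[]-‿     : ∀ {n x y} → x ≈[ n ] y → - x ≈[ n ] - y
    ≈[]-≤     : ∀ {m n x y} → m ℕ.≤ n → x ≈[ n ] y → x ≈[ m ] y
    p^∣⇒≈[]   : ∀ {n a b} → + (p ℕ.^ n) ∣ a ℤ.- b → fromℤ a ≈[ n ] fromℤ b
    ≈[]⇒p^∣   : ∀ {n a b} → fromℤ a ≈[ n ] fromℤ b → + (p ℕ.^ n) ∣ a ℤ.- b
    residue   : Carrier → ℕ → ℤ
    ≈[]-residue : ∀ x n → x ≈[ n ] fromℤ (residue x n)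
    limit     : (x : ℕ → Carrier) → (∀ n → x (suc n) ≈[ n ] x n) → Carrier
    limit-≈[] : ∀ x stable n → limit x stable ≈[ n ] x n
    p^*-cong[]   : ∀ e {n x y} → x ≈[ n ] y → fromℤ (+ (p ℕ.^ e)) * x ≈[ e ℕ.+ n ] fromℤ (+ (p ℕ.^ e)) * y
    p^*-cancel[] : ∀ e {n x y} → fromℤ (+ (p ℕ.^ e)) * x ≈[ e ℕ.+ n ] fromℤ (+ (p ℕ.^ e)) * y → x ≈[ n ] y
    _/p^_     : Carrier → ℕ → Carrier
    /p^-exact : ∀ e {x} → x ≈[ e ] fromℤ (+ 0) → fromℤ (+ (p ℕ.^ e)) * (x /p^ e) ≈ x

  ring : CommutativeRing 0ℓ 0ℓ
  ring = record { isCommutativeRing = isCommutativeRing }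

  ring/p^ : ℕ → CommutativeRing 0ℓ 0ℓ
  ring/p^ n = quotientRing ring (_≈[ n ]_) ≈⇒≈[] ≈[]-sym ≈[]-trans ≈[]-+ ≈[]-* ≈[]-‿

-- Series, units and factorials in ℤₚ

module Theory {p : ℕ} (p-prime : Prime p) (Z : PadicRing p) where

  open PadicRing Z
  open CommutativeRing ring
    using (0#; 1#; _-_; setoid; semiring; +-cong; +-congˡ; +-congʳ; *-cong; *-congˡ; *-congʳ; -‿cong; +-assoc; *-assoc; *-comm;
           +-identityˡ; +-identityʳ; *-identityˡ; *-identityʳ; -‿inverseʳ; zeroˡ; zeroʳ; distribˡ; distribʳ)
    renaming (refl to ≈-refl; sym to ≈-sym; trans to ≈-trans; reflexive to ≈-reflexive)
  open Summation _+_ 0# public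
  open RawSemiringDefs (RawRing.rawSemiring (CommutativeRing.rawRing ring)) using (_^_)

  private
    instance
      p-nonZero : ℕ.NonZero p
      p-nonZero = prime⇒nonZero p-prime

  module Sums = FiniteSums ring
  module Sums[] (n : ℕ) = FiniteSums (ring/p^ n)
  module Mod (n : ℕ) where
    open CommutativeRing (ring/p^ n) public
      renaming (refl to ≈[]-refl; setoid to setoid[]; +-congˡ to +-congˡ[]; +-congʳ to +-congʳ[]; *-congˡ to *-congˡ[]; *-congʳ to *-congʳ[])
      using ()

  ℤ-rawRing : RawRing 0ℓ 0ℓ
  ℤ-rawRing = CommutativeRing.rawRing ℤ.+-*-commutativeRing

  fromℤ-homomorphism : ℤ-rawRing -Raw-AlmostCommutative⟶ fromCommutativeRing ring
  fromℤ-homomorphism = record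
    { ⟦_⟧ = fromℤ ; +-homo = fromℤ-+ ; *-homo = fromℤ-* ; -‿homo = fromℤ-‿ ; 0-homo = ≈-refl ; 1-homo = ≈-refl }

  _coeff≟_ : ∀ a b → Maybe (fromℤ a ≈ fromℤ b)
  a coeff≟ b with a ℤ.≟ b
  ... | yes refl = just ≈-refl
  ... | no  _    = nothing

  module Solver = RingSolver ℤ-rawRing (fromCommutativeRing ring) fromℤ-homomorphism _coeff≟_
  open Solver using (solve; con; _:+_; _:*_; _:-_; :-_; _:=_)

  fromℕ : ℕ → Carrier
  fromℕ n = fromℤ (+ n)

  fromℕ-+ : ∀ m n → fromℕ (m ℕ.+ n) ≈ fromℕ m + fromℕ n
  fromℕ-+ m n = ≈-trans (≈-reflexive (cong fromℤ (ℤ.pos-+ m n))) (fromℤ-+ (+ m) (+ n))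

  fromℕ-* : ∀ m n → fromℕ (m ℕ.* n) ≈ fromℕ m * fromℕ n
  fromℕ-* m n = ≈-trans (≈-reflexive (cong fromℤ (ℤ.pos-* m n))) (fromℤ-* (+ m) (+ n))

  p^ : ℕ → Carrier
  p^ n = fromℕ (p ℕ.^ n)

  p^-+ : ∀ m n → p^ (m ℕ.+ n) ≈ p^ m * p^ n
  p^-+ m n = ≈-trans (≈-reflexive (cong fromℕ (ℕ.^-distribˡ-+-* p m n))) (fromℕ-* (p ℕ.^ m) (p ℕ.^ n))

  p^*-cancel : ∀ e {x y} → p^ e * x ≈ p^ e * y → x ≈ y
  p^*-cancel e px≈py = ≈[]⇒≈ λ n → p^*-cancel[] e (≈⇒≈[] px≈py)

  p^*≈[]0 : ∀ n x → p^ n * x ≈[ n ] 0#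
  p^*≈[]0 n x = ≈[]-trans (≈[]-* (p^∣⇒≈[] (divides (+ 1) (trans (ℤ.+-identityʳ (+ (p ℕ.^ n))) (sym (ℤ.*-identityˡ (+ (p ℕ.^ n))))))) (Mod.≈[]-refl n)) (≈⇒≈[] (zeroˡ x))

  -- The sum of all pⁱuᵢ. With the weight pⁱ built in, every sequence u is summable, and its first n
  -- terms determine the sum modulo pⁿ.
  Σ∞ : (ℕ → Carrier) → Carrier
  Σ∞ u = limit (λ n → Σ< n (λ i → p^ i * u i)) λ n →
    ≈[]-trans (Sums[].Σ<-last n n (λ i → p^ i * u i))
      (≈[]-trans (Mod.+-congˡ[] n (p^*≈[]0 n (u n))) (≈⇒≈[] (+-identityʳ (Σ< n (λ i → p^ i * u i)))))

  Σ∞-partial : ∀ n u → Σ∞ u ≈[ n ] Σ< n (λ i → p^ i * u i)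
  Σ∞-partial n u = limit-≈[] _ _ n

  Σ∞-cong[] : ∀ {n u v} → (∀ i → u i ≈[ n ] v i) → Σ∞ u ≈[ n ] Σ∞ v
  Σ∞-cong[] {n} {u} {v} e = ≈[]-trans (Σ∞-partial n u)
    (≈[]-trans (Sums[].Σ<-cong n n λ i → Mod.*-congˡ[] n (e i)) (≈[]-sym (Σ∞-partial n v)))

  -- The geometric series of pz, whose powers of p are the weights of `Σ∞`.
  1-pz-inverse : ∀ z → (1# - p^ 1 * z) * Σ∞ (z ^_) ≈ 1#
  1-pz-inverse z = ≈[]⇒≈ inverse
    where
    t : Carrier
    t = p^ 1 * z
    g : ℕ → Carrier
    g i = p^ i * z ^ i
    step : ∀ i → g (suc i) ≈ t * g i
    step i = ≈-trans (*-congʳ (p^-+ 1 i))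
      (lem₁ (p^ 1) (p^ i) z (z ^ i))
      where
      lem₁ : ∀ a b z zi → a * b * (z * zi) ≈ a * z * (b * zi)
      lem₁ = solve 4 (λ a b z zi → a :* b :* (z :* zi) := a :* z :* (b :* zi)) ≈-refl
    inverse : ∀ n → (1# - t) * Σ∞ (z ^_) ≈[ n ] 1#
    inverse n = begin
      (1# - t) * Σ∞ (z ^_)   ≈⟨ *-congˡ[] (Σ∞-partial n (z ^_)) ⟩
      (1# - t) * S           ≈⟨ ≈⇒≈[] (lem₂ t S) ⟩
      -- Modulo pⁿ the 0 may be replaced by `g n`, which completes the left side of `geometric`.
      S + 0# - t * S         ≈⟨ +-congʳ[] (+-congˡ[] (p^*≈[]0 n (z ^ n))) ⟨
      S + g n - t * S        ≈⟨ +-congʳ[] (Sums[].geometric n n t g λ i → ≈⇒≈[] (step i)) ⟩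
      g 0 + t * S - t * S    ≈⟨ ≈⇒≈[] (lem₃ (t * S)) ⟩
      1#                     ∎
      where
      open Mod n
      open SetoidReasoning setoid[]
      S : Carrier
      S = Σ< n g
      lem₂ : ∀ t s → (1# - t) * s ≈ s + 0# - t * s
      lem₂ = solve 2 (λ t s → (con (+ 1) :- t) :* s := s :+ con (+ 0) :- t :* s) ≈-refl
      lem₃ : ∀ a → 1# * 1# + a - a ≈ 1#
      lem₃ = solve 1 (λ a → con (+ 1) :* con (+ 1) :+ a :- a := con (+ 1)) ≈-refl

  -- An inverse modulo p lifts: xw has the form 1 - pz and is inverted by the geometric series.
  unit-inverse : ∀ x w → x * w ≈[ 1 ] 1# → ∃ λ v → x * v ≈ 1#
  unit-inverse x w xw≈1 = w * Σ∞ (z ^_) , (begin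
    x * (w * Σ∞ (z ^_))           ≈⟨ *-assoc x w (Σ∞ (z ^_)) ⟨
    (x * w) * Σ∞ (z ^_)           ≈⟨ *-congʳ (lem (x * w)) ⟩
    (1# - d) * Σ∞ (z ^_)          ≈⟨ *-congʳ (+-congˡ (-‿cong (/p^-exact 1 d≈0))) ⟨
    (1# - p^ 1 * z) * Σ∞ (z ^_)   ≈⟨ 1-pz-inverse z ⟩
    1#                            ∎)
    where
    open SetoidReasoning setoid
    d z : Carrier
    d = 1# - x * w
    z = d /p^ 1
    lem : ∀ a → a ≈ 1# - (1# - a)
    lem = solve 1 (λ a → a := con (+ 1) :- (con (+ 1) :- a)) ≈-refl
    d≈0 : d ≈[ 1 ] 0#
    d≈0 = ≈[]-trans (Mod.+-congˡ[] 1 (≈[]-‿ xw≈1)) (≈⇒≈[] (-‿inverseʳ 1#))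

  p∤⇒unit : ∀ a → ¬ p ℕ∣.∣ a → ∃ λ v → fromℕ a * v ≈ 1#
  p∤⇒unit a p∤a = unit-inverse (fromℕ a) (fromℤ (proj₁ inv))
    (≈[]-trans (≈⇒≈[] (≈-sym (fromℤ-* (+ a) (proj₁ inv))))
      (p^∣⇒≈[] (subst (λ t → + t ∣ + a ℤ.* proj₁ inv ℤ.- + 1) (sym (ℕ.*-identityʳ p)) (proj₂ inv))))
    where inv = modular-inverse p-prime a p∤a

  -- This ρ is pⁱ/i!. It lies in ℤₚ because i! = pᵛu with v ≤ i and u prime to p, so it equals pⁱ⁻ᵛ
  -- times the inverse of u.
  p^/! : ∀ i → ∃ λ ρ → ρ * fromℕ (i !) ≈ p^ i
  p^/! i = divide (!-valuation p-prime i)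
    where
    open SetoidReasoning setoid
    lem : ∀ a b c d → a * b * (c * d) ≈ a * c * (d * b)
    lem = solve 4 (λ a b c d → a :* b :* (c :* d) := a :* c :* (d :* b)) ≈-refl
    divide : (∃₂ λ v u → v ℕ.≤ i × ¬ p ℕ∣.∣ u × i ! ≡ p ℕ.^ v ℕ.* u) → ∃ λ ρ → ρ * fromℕ (i !) ≈ p^ i
    divide (v , u , v≤i , p∤u , i!≡) = p^ (i ℕ.∸ v) * u⁻¹ , (begin
      p^ (i ℕ.∸ v) * u⁻¹ * fromℕ (i !)              ≈⟨ *-congˡ (≈-trans (≈-reflexive (cong fromℕ i!≡)) (fromℕ-* (p ℕ.^ v) u)) ⟩
      p^ (i ℕ.∸ v) * u⁻¹ * (p^ v * fromℕ u)         ≈⟨ lem (p^ (i ℕ.∸ v)) u⁻¹ (p^ v) (fromℕ u) ⟩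
      p^ (i ℕ.∸ v) * p^ v * (fromℕ u * u⁻¹)         ≈⟨ *-cong (≈-sym (p^-+ (i ℕ.∸ v) v)) (proj₂ (p∤⇒unit u p∤u)) ⟩
      p^ (i ℕ.∸ v ℕ.+ v) * 1#                       ≈⟨ *-identityʳ _ ⟩
      p^ (i ℕ.∸ v ℕ.+ v)                            ≈⟨ ≈-reflexive (cong p^ (ℕ.m∸n+n≡m v≤i)) ⟩
      p^ i                                          ∎)
      where
      u⁻¹ = proj₁ (p∤⇒unit u p∤u)

  -- Polynomials and power series

  -- A polynomial function of degree at most i. Requiring `eval` for every length n > i forces the
  -- coefficients beyond i to vanish, while keeping them an infinite sequence, so that polynomials
  -- of different degrees can be summed coefficientwise.
  record IsPolynomial (i : ℕ) (f : Carrier → Carrier) : Set where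
    constructor polynomial
    field
      coeff : ℕ → Carrier
      eval  : ∀ n y → i ℕ.< n → Σ< n (λ d → coeff d * y ^ d) ≈ f y

  open IsPolynomial public

  constant : ∀ c → IsPolynomial 0 (λ _ → c)
  coeff (constant c) zero    = c
  coeff (constant c) (suc _) = 0#
  eval  (constant c) (suc n) y _ = ≈-trans (+-cong (*-identityʳ c) (Sums.Σ<-0 n λ d → zeroˡ (y ^ suc d))) (+-identityʳ c)

  linear-* : ∀ α u {i f} → IsPolynomial i f → IsPolynomial (suc i) (λ y → (α + u * y) * f y)
  linear-* α u {i} {f} P = polynomial e λ { (suc n) y (ℕ.s≤s i<n) → eval-e n y i<n }
    where
    e : ℕ → Carrier
    e zero    = α * coeff P 0
    e (suc d) = α * coeff P (suc d) + u * coeff P d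
    lem₀ : ∀ α a s → α * a * 1# + α * s ≈ α * (a * 1# + s)
    lem₀ = solve 3 (λ α a s → α :* a :* con (+ 1) :+ α :* s := α :* (a :* con (+ 1) :+ s)) ≈-refl
    lem₁ : ∀ α u a b y z → (α * a + u * b) * (y * z) ≈ α * (a * (y * z)) + u * y * (b * z)
    lem₁ = solve 6 (λ α u a b y z → (α :* a :+ u :* b) :* (y :* z) := α :* (a :* (y :* z)) :+ u :* y :* (b :* z)) ≈-refl
    eval-e : ∀ n y → i ℕ.< n → Σ< (suc n) (λ d → e d * y ^ d) ≈ (α + u * y) * f y
    eval-e n y i<n = begin
      e 0 * 1# + Σ< n (λ d → e (suc d) * y ^ suc d)                        ≈⟨ +-congˡ (Sums.Σ<-cong n λ d → lem₁ α u (coeff P (suc d)) (coeff P d) y (y ^ d)) ⟩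
      e 0 * 1# + Σ< n (λ d → α * t (suc d) + u * y * t d)                  ≈⟨ +-congˡ (Sums.Σ<-+ n (λ d → α * t (suc d)) (λ d → u * y * t d)) ⟩
      e 0 * 1# + (Σ< n (λ d → α * t (suc d)) + Σ< n (λ d → u * y * t d))   ≈⟨ +-congˡ (+-cong (≈-sym (Sums.Σ<-*ˡ n α (t ∘ suc))) (≈-sym (Sums.Σ<-*ˡ n (u * y) t))) ⟩
      e 0 * 1# + (α * Σ< n (t ∘ suc) + u * y * Σ< n t)                     ≈⟨ +-assoc (e 0 * 1#) (α * Σ< n (t ∘ suc)) (u * y * Σ< n t) ⟨
      e 0 * 1# + α * Σ< n (t ∘ suc) + u * y * Σ< n t                       ≈⟨ +-congʳ (lem₀ α (coeff P 0) (Σ< n (t ∘ suc))) ⟩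
      α * Σ< (suc n) t + u * y * Σ< n t                                    ≈⟨ +-cong (*-congˡ (eval P (suc n) y (ℕ.m<n⇒m<1+n i<n))) (*-congˡ (eval P n y i<n)) ⟩
      α * f y + u * y * f y                                                ≈⟨ distribʳ (f y) α (u * y) ⟨
      (α + u * y) * f y                                                    ∎
      where
      open SetoidReasoning setoid
      t : ℕ → Carrier
      t d = coeff P d * y ^ d

  scale : ∀ c {i f} → IsPolynomial i f → IsPolynomial i (λ y → c * f y)
  scale c {i} {f} P = polynomial (λ d → c * coeff P d) λ n y i<n →
    ≈-trans (Sums.Σ<-cong n λ d → *-assoc c (coeff P d) (y ^ d))
      (≈-trans (≈-sym (Sums.Σ<-*ˡ n c (λ d → coeff P d * y ^ d))) (*-congˡ (eval P n y i<n)))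

  add : ∀ {i f g} → IsPolynomial i f → IsPolynomial i g → IsPolynomial i (λ y → f y + g y)
  add P Q = polynomial (λ d → coeff P d + coeff Q d) λ n y i<n →
    ≈-trans (Sums.Σ<-cong n λ d → distribʳ (y ^ d) (coeff P d) (coeff Q d))
      (≈-trans (Sums.Σ<-+ n (λ d → coeff P d * y ^ d) (λ d → coeff Q d * y ^ d)) (+-cong (eval P n y i<n) (eval Q n y i<n)))

  polynomial-cong : ∀ {i f g} → (∀ y → f y ≈ g y) → IsPolynomial i f → IsPolynomial i g
  polynomial-cong f≈g P = polynomial (coeff P) λ n y i<n → ≈-trans (eval P n y i<n) (f≈g y)

  polynomial-≈[] : ∀ {i f n x y} → IsPolynomial i f → x ≈[ n ] y → f x ≈[ n ] f y
  polynomial-≈[] {i} {f} {n} {x} {y} P x≈y = ≈[]-trans (≈⇒≈[] (≈-sym (eval P (suc i) x ℕ.≤-refl)))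
    (≈[]-trans (Sums[].Σ<-cong n (suc i) λ d → ≈[]-* (Mod.≈[]-refl n {coeff P d}) (pow d)) (≈⇒≈[] (eval P (suc i) y ℕ.≤-refl)))
    where
    pow : ∀ d → x ^ d ≈[ n ] y ^ d
    pow zero    = Mod.≈[]-refl n
    pow (suc d) = ≈[]-* x≈y (pow d)

  module _ {Q : ℕ → Carrier → Carrier} (P : ∀ i → IsPolynomial i (Q i)) where

    series : Carrier → Carrier
    series y = Σ∞ (λ i → Q i y)

    -- Obtained by exchanging the sums over i and d. Only the indices i ≥ d contribute, since `Q i`
    -- has degree at most i.
    series-coeff : ℕ → Carrier
    series-coeff d = Σ∞ (λ i → coeff (P i) d)

    series-≈[] : ∀ {n x y} → x ≈[ n ] y → series x ≈[ n ] series y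
    series-≈[] x≈y = Σ∞-cong[] λ i → polynomial-≈[] (P i) x≈y

    -- Modulo pⁿ only the indices i < n matter, and for these the degree of `Q i` is below n. So
    -- both sums can be cut at the same n and exchanged as finite sums.
    series-partial : ∀ n y → Σ< n (λ d → series-coeff d * y ^ d) ≈[ n ] series y
    series-partial n y = begin
      Σ< n (λ d → series-coeff d * y ^ d)                              ≈⟨ Σ<-cong n (λ d → *-congʳ[] (Σ∞-partial n (λ i → coeff (P i) d))) ⟩
      Σ< n (λ d → Σ< n (λ i → p^ i * coeff (P i) d) * y ^ d)           ≈⟨ Σ<-cong n (λ d → Σ<-*ʳ n (y ^ d) (λ i → p^ i * coeff (P i) d)) ⟩
      Σ< n (λ d → Σ< n (λ i → p^ i * coeff (P i) d * y ^ d))           ≈⟨ Σ<-swap n n (λ d i → p^ i * coeff (P i) d * y ^ d) ⟩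
      Σ< n (λ i → Σ< n (λ d → p^ i * coeff (P i) d * y ^ d))           ≈⟨ Σ<-cong n (λ i → Σ<-cong n λ d → ≈⇒≈[] (*-assoc (p^ i) (coeff (P i) d) (y ^ d))) ⟩
      Σ< n (λ i → Σ< n (λ d → p^ i * (coeff (P i) d * y ^ d)))         ≈⟨ Σ<-cong n (λ i → Σ<-*ˡ n (p^ i) (λ d → coeff (P i) d * y ^ d)) ⟨
      Σ< n (λ i → p^ i * Σ< n (λ d → coeff (P i) d * y ^ d))           ≈⟨ Σ<-cong< n (λ i i<n → ≈⇒≈[] (*-congˡ (eval (P i) n y i<n))) ⟩
      Σ< n (λ i → p^ i * Q i y)                                        ≈⟨ Σ∞-partial n (λ i → Q i y) ⟨
      series y                                                         ∎
      where
      open Mod n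
      open Sums[] n
      open SetoidReasoning setoid[]

  -- Falling factorials and binomial coefficients

  infix 8 _↓_

  -- The falling factorial x (x - 1) ⋯ (x - i + 1), that is, i! times the binomial polynomial.
  _↓_ : Carrier → ℕ → Carrier
  x ↓ zero  = 1#
  x ↓ suc i = (x - fromℕ i) * x ↓ i

  ↓-cong : ∀ {x y} i → x ≈ y → x ↓ i ≈ y ↓ i
  ↓-cong zero    x≈y = ≈-refl
  ↓-cong (suc i) x≈y = *-cong (+-congʳ x≈y) (↓-cong i x≈y)

  fromℕ-suc : ∀ n → fromℕ (suc n) ≈ 1# + fromℕ n
  fromℕ-suc n = fromℕ-+ 1 n

  -- Splits off the first factor, whereas the definition splits off the last; comparing the two
  -- gives Pascal's rule.
  ↓-shift : ∀ x i → (1# + x) ↓ suc i ≈ (1# + x) * x ↓ i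
  ↓-shift x zero    = lem x
    where
    lem : ∀ x → (1# + x - 0#) * 1# ≈ (1# + x) * 1#
    lem = solve 1 (λ x → (con (+ 1) :+ x :- con (+ 0)) :* con (+ 1) := (con (+ 1) :+ x) :* con (+ 1)) ≈-refl
  ↓-shift x (suc i) = begin
    (1# + x - fromℕ (suc i)) * (1# + x) ↓ suc i       ≈⟨ *-cong (+-congˡ (-‿cong (fromℕ-suc i))) (↓-shift x i) ⟩
    (1# + x - (1# + fromℕ i)) * ((1# + x) * x ↓ i)    ≈⟨ lem x (fromℕ i) (x ↓ i) ⟩
    (1# + x) * ((x - fromℕ i) * x ↓ i)                ∎
    where
    open SetoidReasoning setoid
    lem : ∀ x i y → (1# + x - (1# + i)) * ((1# + x) * y) ≈ (1# + x) * ((x - i) * y)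
    lem = solve 3 (λ x i y → (con (+ 1) :+ x :- (con (+ 1) :+ i)) :* ((con (+ 1) :+ x) :* y)
                          := (con (+ 1) :+ x) :* ((x :- i) :* y)) ≈-refl

  0↓suc : ∀ i → 0# ↓ suc i ≈ 0#
  0↓suc zero    = solve 0 ((con (+ 0) :- con (+ 0)) :* con (+ 1) := con (+ 0)) ≈-refl
  0↓suc (suc i) = ≈-trans (*-congˡ (0↓suc i)) (zeroʳ (0# - fromℕ (suc i)))

  -- Induction by Pascal's rule: writing the first factor 1 + d as (1 + i) + (d - i) splits the
  -- falling factorial of 1 + d into two falling factorials of d.
  ↓-binomial : ∀ d i → fromℕ d ↓ i ≈ fromℕ (d C i) * fromℕ (i !)
  ↓-binomial d       zero    = ≈-sym (*-identityʳ 1#)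
  ↓-binomial zero    (suc i) = ≈-trans (0↓suc i) (≈-sym (zeroˡ (fromℕ (suc i !))))
  ↓-binomial (suc d) (suc i) = begin
    fromℕ (suc d) ↓ suc i                             ≈⟨ ↓-cong (suc i) (fromℕ-suc d) ⟩
    (1# + fromℕ d) ↓ suc i                            ≈⟨ ↓-shift (fromℕ d) i ⟩
    (1# + fromℕ d) * fromℕ d ↓ i                      ≈⟨ lem₁ (fromℕ d) (fromℕ i) (fromℕ d ↓ i) ⟩
    (1# + fromℕ i) * fromℕ d ↓ i + fromℕ d ↓ suc i    ≈⟨ +-cong (*-congˡ (↓-binomial d i)) (↓-binomial d (suc i)) ⟩
    (1# + fromℕ i) * (fromℕ (d C i) * fromℕ (i !)) + fromℕ (d C suc i) * fromℕ (suc i !)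
                                                      ≈⟨ +-congʳ (lem₂ (1# + fromℕ i) (fromℕ (d C i)) (fromℕ (i !))) ⟩
    fromℕ (d C i) * ((1# + fromℕ i) * fromℕ (i !)) + fromℕ (d C suc i) * fromℕ (suc i !)
                                                      ≈⟨ +-congʳ (*-congˡ (≈-trans (*-congʳ (≈-sym (fromℕ-suc i))) (≈-sym (fromℕ-* (suc i) (i !))))) ⟩
    fromℕ (d C i) * fromℕ (suc i !) + fromℕ (d C suc i) * fromℕ (suc i !)
                                                      ≈⟨ distribʳ (fromℕ (suc i !)) (fromℕ (d C i)) (fromℕ (d C suc i)) ⟨
    (fromℕ (d C i) + fromℕ (d C suc i)) * fromℕ (suc i !)
                                                      ≈⟨ *-congʳ (≈-trans (≈-sym (fromℕ-+ (d C i) (d C suc i))) (≈-reflexive (cong fromℕ (nCk+nC[k+1]≡[n+1]C[k+1] d i)))) ⟩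
    fromℕ (suc d C suc i) * fromℕ (suc i !)           ∎
    where
    open SetoidReasoning setoid
    lem₁ : ∀ d i y → (1# + d) * y ≈ (1# + i) * y + (d - i) * y
    lem₁ = solve 3 (λ d i y → (con (+ 1) :+ d) :* y := (con (+ 1) :+ i) :* y :+ (d :- i) :* y) ≈-refl
    lem₂ : ∀ a b c → a * (b * c) ≈ b * (a * c)
    lem₂ = solve 3 (λ a b c → a :* (b :* c) := b :* (a :* c)) ≈-refl

  ↓-polynomial : ∀ α u i → IsPolynomial i (λ y → (α + u * y) ↓ i)
  ↓-polynomial α u zero    = constant 1#
  ↓-polynomial α u (suc i) = polynomial-cong
    (λ y → *-congʳ (lem α (fromℕ i) (u * y))) (linear-* (α - fromℕ i) u (↓-polynomial α u i))
    where
    lem : ∀ α i t → α - i + t ≈ α + t - i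
    lem = solve 3 (λ α i t → α :- i :+ t := α :+ t :- i) ≈-refl

  -- Solutions of the recurrence

  sum : ∀ {n} → (Fin n → Carrier) → Carrier
  sum = foldr _+_ 0#

  module FinSums = SemiringSum semiring

  -- The number of possible windows of ℓ consecutive terms modulo p².
  states : ℕ → ℕ
  states ℓ = (p ℕ.^ 2) ℕ.^ ℓ

  module Recurrence {ℓ : ℕ} (a : Fin ℓ → Carrier) where

    record Solution (s : ℕ → Carrier) : Set where
      constructor solution
      field
        law : ∀ n → s (n ℕ.+ ℓ) + sum (λ i → a i * s (n ℕ.+ toℕ i)) ≈ 0#

    open Solution public

    solution-shift : ∀ {s} k → Solution s → Solution (λ n → s (n ℕ.+ k))
    solution-shift {s} k S = solution λ n → ≈-trans
      (+-cong (≈-reflexive (cong s (swap n ℓ k)))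
        (FinSums.sum-cong-≋ λ i → *-congˡ {a i} (≈-reflexive (cong s (swap n (toℕ i) k)))))
      (law S (n ℕ.+ k))
      where
      swap : ∀ a b c → a ℕ.+ b ℕ.+ c ≡ a ℕ.+ c ℕ.+ b
      swap a b c = trans (ℕ.+-assoc a b c) (trans (cong (a ℕ.+_) (ℕ.+-comm b c)) (sym (ℕ.+-assoc a c b)))

    solution-cong : ∀ {s t} → (∀ n → s n ≈ t n) → Solution s → Solution t
    solution-cong {s} {t} s≈t S = solution λ n → ≈-trans (+-cong (≈-sym (s≈t (n ℕ.+ ℓ)))
      (FinSums.sum-cong-≋ λ i → *-congˡ {a i} (≈-sym (s≈t (n ℕ.+ toℕ i))))) (law S n)

    solution-+ : ∀ {s t} → Solution s → Solution t → Solution (λ n → s n + t n)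
    solution-+ {s} {t} S T = solution λ n → begin
      s (n ℕ.+ ℓ) + t (n ℕ.+ ℓ) + sum (λ i → a i * (s (n ℕ.+ toℕ i) + t (n ℕ.+ toℕ i)))
        ≈⟨ +-congˡ (FinSums.sum-cong-≋ λ i → distribˡ (a i) (s (n ℕ.+ toℕ i)) (t (n ℕ.+ toℕ i))) ⟩
      s (n ℕ.+ ℓ) + t (n ℕ.+ ℓ) + sum (λ i → a i * s (n ℕ.+ toℕ i) + a i * t (n ℕ.+ toℕ i))
        ≈⟨ +-congˡ (FinSums.∑-distrib-+ (λ i → a i * s (n ℕ.+ toℕ i)) (λ i → a i * t (n ℕ.+ toℕ i))) ⟩
      s (n ℕ.+ ℓ) + t (n ℕ.+ ℓ) + (sum (λ i → a i * s (n ℕ.+ toℕ i)) + sum (λ i → a i * t (n ℕ.+ toℕ i)))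
        ≈⟨ lem (s (n ℕ.+ ℓ)) (t (n ℕ.+ ℓ)) _ _ ⟩
      (s (n ℕ.+ ℓ) + sum (λ i → a i * s (n ℕ.+ toℕ i))) + (t (n ℕ.+ ℓ) + sum (λ i → a i * t (n ℕ.+ toℕ i)))
        ≈⟨ +-cong (law S n) (law T n) ⟩
      0# + 0# ≈⟨ +-identityˡ 0# ⟩
      0# ∎
      where
      open SetoidReasoning setoid
      lem : ∀ a b c d → a + b + (c + d) ≈ a + c + (b + d)
      lem = solve 4 (λ a b c d → a :+ b :+ (c :+ d) := a :+ c :+ (b :+ d)) ≈-refl

    scaled : ∀ (s : ℕ → Carrier) c n → c * s (n ℕ.+ ℓ) + sum (λ i → a i * (c * s (n ℕ.+ toℕ i))) ≈
                       c * (s (n ℕ.+ ℓ) + sum (λ i → a i * s (n ℕ.+ toℕ i)))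
    scaled s c n = ≈-sym (≈-trans (distribˡ c (s (n ℕ.+ ℓ)) (sum (λ i → a i * s (n ℕ.+ toℕ i))))
      (+-congˡ (≈-trans (FinSums.*-distribˡ-sum c (λ i → a i * s (n ℕ.+ toℕ i)))
        (FinSums.sum-cong-≋ λ i → lem c (a i) (s (n ℕ.+ toℕ i))))))
      where
      lem : ∀ c a s → c * (a * s) ≈ a * (c * s)
      lem = solve 3 (λ c a s → c :* (a :* s) := a :* (c :* s)) ≈-refl

    solution-* : ∀ {s} c → Solution s → Solution (λ n → c * s n)
    solution-* {s} c S = solution λ n → ≈-trans (scaled s c n) (≈-trans (*-congˡ (law S n)) (zeroʳ c))

    -- Saturation of the module of solutions, from the absence of p-torsion in ℤₚ. It makes `T` map
    -- solutions to solutions.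
    solution-cancel : ∀ {s} e → Solution (λ n → p^ e * s n) → Solution s
    solution-cancel {s} e S = solution λ n → p^*-cancel e
      (≈-trans (≈-sym (scaled s (p^ e) n)) (≈-trans (law S n) (≈-sym (zeroʳ (p^ e)))))

    -- As the recurrence is monic, each term is a combination of the ℓ terms before it, so equal
    -- windows have equal continuations. This works forwards only, since a₀ need not be a unit;
    -- hence the preperiod.
    window-determines : ∀ {s} m i j → Solution s → (∀ t → t ℕ.< ℓ → s (i ℕ.+ t) ≈[ m ] s (j ℕ.+ t)) →
             ∀ t → s (i ℕ.+ t) ≈[ m ] s (j ℕ.+ t)
    window-determines {s} m i j S initial t = go (suc t) t (ℕ.m≤m+n (suc t) ℓ)
      where
      solve-top : ∀ k → s (k ℕ.+ ℓ) ≈ - sum (λ τ → a τ * s (k ℕ.+ toℕ τ))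
      solve-top k = ≈-trans (lem (s (k ℕ.+ ℓ)) (sum (λ τ → a τ * s (k ℕ.+ toℕ τ)))) (≈-trans (+-congʳ (law S k)) (+-identityˡ _))
        where
        lem : ∀ x y → x ≈ x + y - y
        lem = solve 2 (λ x y → x := x :+ y :- y) ≈-refl
      sum-≈[] : ∀ {n} {f g : Fin n → Carrier} → (∀ i → f i ≈[ m ] g i) → sum f ≈[ m ] sum g
      sum-≈[] {zero}  e = Mod.≈[]-refl m
      sum-≈[] {suc n} e = ≈[]-+ (e Fin.zero) (sum-≈[] (e ∘ Fin.suc))
      go : ∀ k t → t ℕ.< k ℕ.+ ℓ → s (i ℕ.+ t) ≈[ m ] s (j ℕ.+ t)
      go zero    t t<ℓ = initial t t<ℓ
      go (suc k) t (ℕ.s≤s t≤k+ℓ) with ℕ.m≤n⇒m<n∨m≡n t≤k+ℓ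
      ... | inj₁ t<k+ℓ = go k t t<k+ℓ
      ... | inj₂ refl  = ≈[]-trans (≈⇒≈[] (top i)) (≈[]-trans (≈[]-‿ (sum-≈[] λ τ → ≈[]-* (Mod.≈[]-refl m {a τ}) (inner τ)))
                           (≈⇒≈[] (≈-sym (top j))))
        where
        top : ∀ i → s (i ℕ.+ (k ℕ.+ ℓ)) ≈ - sum (λ τ → a τ * s (i ℕ.+ k ℕ.+ toℕ τ))
        top i = ≈-trans (≈-reflexive (cong s (sym (ℕ.+-assoc i k ℓ)))) (solve-top (i ℕ.+ k))
        inner : ∀ τ → s (i ℕ.+ k ℕ.+ toℕ τ) ≈[ m ] s (j ℕ.+ k ℕ.+ toℕ τ)
        inner τ = ≈[]-trans (≈⇒≈[] (≈-reflexive (cong s (ℕ.+-assoc i k (toℕ τ)))))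
          (≈[]-trans (go k (k ℕ.+ toℕ τ) (ℕ.+-monoʳ-< k (Fin.toℕ<n τ))) (≈⇒≈[] (≈-reflexive (cong s (sym (ℕ.+-assoc j k (toℕ τ)))))))

    private
      instance
        p²-nonZero : ℕ.NonZero (p ℕ.^ 2)
        p²-nonZero = ℕ.m^n≢0 p 2

      states-nonZero : ℕ.NonZero (states ℓ)
      states-nonZero = ℕ.m^n≢0 (p ℕ.^ 2) ℓ

      digit : Carrier → Fin (p ℕ.^ 2)
      digit x = fromℕ< (n%ℕd<d (residue x 2) (p ℕ.^ 2))

      digit-injective : ∀ {x y} → digit x ≡ digit y → x ≈[ 2 ] y
      digit-injective {x} {y} eq = ≈[]-trans (≈[]-residue x 2) (≈[]-trans (p^∣⇒≈[] (divides (x′ /ℕ q ℤ.- y′ /ℕ q) difference)) (≈[]-sym (≈[]-residue y 2)))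
        where
        q = p ℕ.^ 2
        x′ = residue x 2
        y′ = residue y 2
        same : x′ %ℕ q ≡ y′ %ℕ q
        same = trans (sym (Fin.toℕ-fromℕ< _)) (trans (cong toℕ eq) (Fin.toℕ-fromℕ< _))
        lem : ∀ r b c q → r ℤ.+ b ℤ.* q ℤ.- (r ℤ.+ c ℤ.* q) ≡ (b ℤ.- c) ℤ.* q
        lem = solve-∀
        difference : x′ ℤ.- y′ ≡ (x′ /ℕ q ℤ.- y′ /ℕ q) ℤ.* + q
        difference = trans (cong₂ ℤ._-_ (a≡a%ℕn+[a/ℕn]*n x′ q) (trans (a≡a%ℕn+[a/ℕn]*n y′ q) (cong (λ r → + r ℤ.+ (y′ /ℕ q) ℤ.* + q) (sym same))))
          (lem (+ (x′ %ℕ q)) (x′ /ℕ q) (y′ /ℕ q) (+ q))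

    -- Two of the first `states ℓ` + 1 windows agree modulo p², and then so do all later terms. The
    -- bounds on the preperiod `i` and the period `suc d` involve only p and ℓ, not s.
    collision : ∀ {s} → Solution s → ∃₂ λ i d → i ℕ.≤ states ℓ × suc d ℕ.≤ states ℓ × ∀ t → s (i ℕ.+ t) ≈[ 2 ] s (i ℕ.+ suc d ℕ.+ t)
    collision {s} S = from-pigeonhole (Fin.pigeonhole (ℕ.n<1+n (states ℓ)) (code ∘ toℕ))
      where
      state : ℕ → Fin ℓ → Fin (p ℕ.^ 2)
      state n t = digit (s (n ℕ.+ toℕ t))
      code : ℕ → Fin (states ℓ)
      code n = funToFin (state n)
      from-pigeonhole : (∃₂ λ (i j : Fin (suc (states ℓ))) → toℕ i ℕ.< toℕ j × code (toℕ i) ≡ code (toℕ j)) →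
        ∃₂ λ i d → i ℕ.≤ states ℓ × suc d ℕ.≤ states ℓ × ∀ t → s (i ℕ.+ t) ≈[ 2 ] s (i ℕ.+ suc d ℕ.+ t)
      from-pigeonhole (i , j , i<j , eq) = toℕ i , d , ℕ.≤-pred (Fin.toℕ<n i) ,
        ℕ.≤-trans (ℕ.m≤n+m (suc d) (toℕ i)) (ℕ.≤-trans (ℕ.≤-reflexive i+1+d≡j) (ℕ.≤-pred (Fin.toℕ<n j))) ,
        window-determines 2 (toℕ i) (toℕ i ℕ.+ suc d) S initial
        where
        d = toℕ j ℕ.∸ suc (toℕ i)
        i+1+d≡j : toℕ i ℕ.+ suc d ≡ toℕ j
        i+1+d≡j = trans (ℕ.+-suc (toℕ i) d) (ℕ.m+[n∸m]≡n i<j)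
        same-state : ∀ τ → state (toℕ i) τ ≡ state (toℕ j) τ
        same-state τ = trans (sym (Fin.finToFun-funToFin (state (toℕ i)) τ))
          (trans (cong (λ c → finToFun c τ) eq) (Fin.finToFun-funToFin (state (toℕ j)) τ))
        initial : ∀ t → t ℕ.< ℓ → s (toℕ i ℕ.+ t) ≈[ 2 ] s (toℕ i ℕ.+ suc d ℕ.+ t)
        initial t t<ℓ = subst (λ t → s (toℕ i ℕ.+ t) ≈[ 2 ] s (toℕ i ℕ.+ suc d ℕ.+ t)) (Fin.toℕ-fromℕ< t<ℓ)
          (subst (λ j → s (toℕ i ℕ.+ toℕ (fromℕ< t<ℓ)) ≈[ 2 ] s (j ℕ.+ toℕ (fromℕ< t<ℓ))) (sym i+1+d≡j)
            (digit-injective (same-state (fromℕ< t<ℓ))))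

    -- The preperiod and the period modulo p² are at most the number of states, so N serves for all solutions at once.
    periodic : ∀ N .{{_ : ℕ.NonZero N}} → states ℓ ! ℕ∣.∣ N → ∀ {s} → Solution s → ∀ n → s (n ℕ.+ N ℕ.+ N) ≈[ 2 ] s (n ℕ.+ N)
    periodic N states!∣N {s} S n = from-collision (collision S)
      where
      from-collision : (∃₂ λ i d → i ℕ.≤ states ℓ × suc d ℕ.≤ states ℓ × ∀ t → s (i ℕ.+ t) ≈[ 2 ] s (i ℕ.+ suc d ℕ.+ t)) →
                       s (n ℕ.+ N ℕ.+ N) ≈[ 2 ] s (n ℕ.+ N)
      from-collision (i , d , i≤states , d≤states , step) = from-multiple
        (ℕ∣.∣-trans (ℕ∣.∣-trans (ℕ∣.m∣m*n (d !)) (ℕ∣.m≤n⇒m!∣n! d≤states)) states!∣N)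
        where
        step′ : ∀ m → i ℕ.≤ m → s (m ℕ.+ suc d) ≈[ 2 ] s m
        step′ m i≤m = ≈[]-sym (≈[]-trans (≈⇒≈[] (≈-reflexive (cong s (sym i+t≡m))))
          (≈[]-trans (step (m ℕ.∸ i)) (≈⇒≈[] (≈-reflexive (cong s
            (trans (ℕ.+-assoc i (suc d) (m ℕ.∸ i)) (trans (cong (i ℕ.+_) (ℕ.+-comm (suc d) (m ℕ.∸ i)))
              (trans (sym (ℕ.+-assoc i (m ℕ.∸ i) (suc d))) (cong (ℕ._+ suc d) i+t≡m)))))))))
          where
          i+t≡m : i ℕ.+ (m ℕ.∸ i) ≡ m
          i+t≡m = ℕ.m+[n∸m]≡n i≤m
        iterate : ∀ c m → i ℕ.≤ m → s (m ℕ.+ c ℕ.* suc d) ≈[ 2 ] s m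
        iterate zero    m i≤m = ≈⇒≈[] (≈-reflexive (cong s (ℕ.+-identityʳ m)))
        iterate (suc c) m i≤m = ≈[]-trans (≈⇒≈[] (≈-reflexive (cong s (sym (ℕ.+-assoc m (suc d) (c ℕ.* suc d))))))
          (≈[]-trans (iterate c (m ℕ.+ suc d) (ℕ.≤-trans i≤m (ℕ.m≤m+n m (suc d)))) (step′ m i≤m))
        states≤N : states ℓ ℕ.≤ N
        states≤N = ℕ.≤-trans (ℕ∣.∣⇒≤ {{states ℓ ℕ.!≢0}} (n∣n! (states ℓ) {{states-nonZero}})) (ℕ∣.∣⇒≤ states!∣N)
          where
          n∣n! : ∀ n .{{_ : ℕ.NonZero n}} → n ℕ∣.∣ n !
          n∣n! (suc n) = ℕ∣.m∣m*n (n !)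
        from-multiple : suc d ℕ∣.∣ N → s (n ℕ.+ N ℕ.+ N) ≈[ 2 ] s (n ℕ.+ N)
        from-multiple (ℕ∣.divides c N≡) = subst (λ M → s (n ℕ.+ N ℕ.+ M) ≈[ 2 ] s (n ℕ.+ N)) (sym N≡)
          (iterate c (n ℕ.+ N) (ℕ.≤-trans i≤states (ℕ.≤-trans states≤N (ℕ.m≤n+m N n))))

  -- The expansion of Bᵏ and its interpolation by a power series

  module Interpolation {ℓ : ℕ} (a : Fin ℓ → Carrier) (N : ℕ) .{{_ : ℕ.NonZero N}} (states!∣N : states ℓ ! ℕ∣.∣ N) where

    open Recurrence a

    -- p² T = B² - B, where B is the shift by N.
    T : (ℕ → Carrier) → ℕ → Carrier
    T s n = (s (n ℕ.+ N ℕ.+ N) - s (n ℕ.+ N)) /p^ 2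

    T-exact : ∀ {s} → Solution s → ∀ n → p^ 2 * T s n ≈ s (n ℕ.+ N ℕ.+ N) - s (n ℕ.+ N)
    T-exact {s} S n = /p^-exact 2
      (≈[]-trans (Mod.+-congʳ[] 2 (periodic N states!∣N S n)) (≈⇒≈[] (-‿inverseʳ (s (n ℕ.+ N)))))

    T-solution : ∀ {s} → Solution s → Solution (T s)
    T-solution {s} S = solution-cancel 2 (solution-cong (λ n → ≈-trans (lem (s (n ℕ.+ N ℕ.+ N)) (s (n ℕ.+ N))) (≈-sym (T-exact S n)))
      (solution-+ (solution-shift N (solution-shift N S)) (solution-* (fromℤ (ℤ.- + 1)) (solution-shift N S))))
      where
      lem : ∀ x y → x + fromℤ (ℤ.- + 1) * y ≈ x - y
      lem = solve 2 (λ x y → x :+ con (ℤ.- + 1) :* y := x :- y) ≈-refl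

    -- The new `T` is applied innermost, so that `w₀ s (suc i)` is `w₀ (T s) i` by definition, as
    -- used in `term-rec`.
    Tⁱ : ℕ → (ℕ → Carrier) → ℕ → Carrier
    Tⁱ zero    s = s
    Tⁱ (suc i) s = Tⁱ i (T s)

    module _ (r : ℕ) where

      -- The values at r of Tⁱs and (B - 1)Tⁱs.
      w₀ w₁ : (ℕ → Carrier) → ℕ → Carrier
      w₀ s i = Tⁱ i s r
      w₁ s i = Tⁱ i s (r ℕ.+ N) - Tⁱ i s r

      -- The i-th term of both sums for Bᵏ taken together. The factor p²ⁱ is kept as two factors pⁱ:
      -- one is the weight in `Σ∞`, the other turns into `ρ i` times i!.
      term : (ℕ → Carrier) → ℕ → ℕ → Carrier
      term s k i = p^ i * p^ i * (fromℕ (fib (suc k) i) * w₀ s i + fromℕ (fib k i) * w₁ s i)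

      term-cong : ∀ s k i {α β} → fib (suc k) i ≡ α → fib k i ≡ β → term s k i ≈ p^ i * p^ i * (fromℕ α * w₀ s i + fromℕ β * w₁ s i)
      term-cong s k i refl refl = ≈-refl

      -- The relation Bᵏ⁺² = Bᵏ⁺¹ + p²TBᵏ term by term, through the recursion of the Fibonacci
      -- coefficients.
      term-rec : ∀ s k i → term s (suc (suc k)) (suc i) ≈ term s (suc k) (suc i) + p^ 2 * term (T s) k i
      term-rec s k i = begin
        P * P * (fromℕ (fib (3 ℕ.+ k) (suc i)) * W₀ + fromℕ (fib (2 ℕ.+ k) (suc i)) * W₁)
          ≈⟨ *-congˡ (+-cong (*-congʳ (fib-+ (suc k))) (*-congʳ (fib-+ k))) ⟩
        P * P * ((a₁ + b₁) * W₀ + (a₀ + b₀) * W₁)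
          ≈⟨ lem₁ P a₁ b₁ W₀ a₀ b₀ W₁ ⟩
        P * P * (a₁ * W₀ + a₀ * W₁) + P * P * (b₁ * W₀ + b₀ * W₁)
          ≈⟨ +-congˡ (*-congʳ (≈-trans (*-cong (p^-+ 1 i) (p^-+ 1 i)) (≈-trans (lem₂ (p^ 1) (p^ i)) (*-congʳ (≈-sym (p^-+ 1 1)))))) ⟩
        P * P * (a₁ * W₀ + a₀ * W₁) + p^ 2 * (p^ i * p^ i) * (b₁ * W₀ + b₀ * W₁)
          ≈⟨ +-congˡ (*-assoc (p^ 2) (p^ i * p^ i) (b₁ * W₀ + b₀ * W₁)) ⟩
        term s (suc k) (suc i) + p^ 2 * term (T s) k i ∎
        where
        open SetoidReasoning setoid
        P = p^ (suc i)
        W₀ = w₀ s (suc i)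
        W₁ = w₁ s (suc i)
        a₁ = fromℕ (fib (2 ℕ.+ k) (suc i))
        a₀ = fromℕ (fib (1 ℕ.+ k) (suc i))
        b₁ = fromℕ (fib (1 ℕ.+ k) i)
        b₀ = fromℕ (fib k i)
        fib-+ : ∀ k → fromℕ (fib (2 ℕ.+ k) (suc i)) ≈ fromℕ (fib (1 ℕ.+ k) (suc i)) + fromℕ (fib k i)
        fib-+ k = ≈-trans (≈-reflexive (cong fromℕ (fib-rec k i))) (fromℕ-+ (fib (1 ℕ.+ k) (suc i)) (fib k i))
        lem₁ : ∀ P a₁ b₁ x a₀ b₀ y → P * P * ((a₁ + b₁) * x + (a₀ + b₀) * y) ≈ P * P * (a₁ * x + a₀ * y) + P * P * (b₁ * x + b₀ * y)
        lem₁ = solve 7 (λ P a₁ b₁ x a₀ b₀ y → P :* P :* ((a₁ :+ b₁) :* x :+ (a₀ :+ b₀) :* y)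
                                           := P :* P :* (a₁ :* x :+ a₀ :* y) :+ P :* P :* (b₁ :* x :+ b₀ :* y)) ≈-refl
        lem₂ : ∀ x y → x * y * (x * y) ≈ x * x * (y * y)
        lem₂ = solve 2 (λ x y → x :* y :* (x :* y) := x :* x :* (y :* y)) ≈-refl

      -- Two-step induction on k from Bᵏ⁺² = Bᵏ⁺¹ + p²TBᵏ, for all solutions at once since T s
      -- enters. The length M is left free because the sum for T s, shifted by one index, is one
      -- term shorter than the sum for s.
      expansion : ∀ k M → k ℕ.< M → ∀ {s} → Solution s → s (r ℕ.+ k ℕ.* N) ≈ Σ< M (term s k)
      expansion zero (suc M) _ {s} S = ≈-sym (begin
        term s 0 0 + Σ< M (term s 0 ∘ suc)   ≈⟨ +-cong (lem₁ (w₀ s 0) (w₁ s 0)) (Sums.Σ<-0 M λ i → lem₂ (p^ (suc i)) (w₀ s (suc i)) (w₁ s (suc i))) ⟩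
        s r + 0#                             ≈⟨ +-identityʳ (s r) ⟩
        s r                                  ≈⟨ ≈-reflexive (cong s (sym (ℕ.+-identityʳ r))) ⟩
        s (r ℕ.+ 0)                          ∎)
        where
        open SetoidReasoning setoid
        lem₁ : ∀ x y → 1# * 1# * (1# * x + 0# * y) ≈ x
        lem₁ = solve 2 (λ x y → con (+ 1) :* con (+ 1) :* (con (+ 1) :* x :+ con (+ 0) :* y) := x) ≈-refl
        lem₂ : ∀ p x y → p * p * (0# * x + 0# * y) ≈ 0#
        lem₂ = solve 3 (λ p x y → p :* p :* (con (+ 0) :* x :+ con (+ 0) :* y) := con (+ 0)) ≈-refl
      expansion (suc zero) (suc M) _ {s} S = ≈-sym (begin
        term s 1 0 + Σ< M (term s 1 ∘ suc)   ≈⟨ +-cong (lem₁ (s r) (s (r ℕ.+ N))) (Sums.Σ<-0 M λ i →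
                                                  ≈-trans (term-cong s 1 (suc i) (fib-rec 0 i) refl) (lem₂ (p^ (suc i)) (w₀ s (suc i)) (w₁ s (suc i)))) ⟩
        s (r ℕ.+ N) + 0#                     ≈⟨ +-identityʳ (s (r ℕ.+ N)) ⟩
        s (r ℕ.+ N)                          ≈⟨ ≈-reflexive (cong (λ m → s (r ℕ.+ m)) (sym (ℕ.+-identityʳ N))) ⟩
        s (r ℕ.+ (N ℕ.+ 0))                  ∎)
        where
        open SetoidReasoning setoid
        lem₁ : ∀ x y → 1# * 1# * (1# * x + 1# * (y - x)) ≈ y
        lem₁ = solve 2 (λ x y → con (+ 1) :* con (+ 1) :* (con (+ 1) :* x :+ con (+ 1) :* (y :- x)) := y) ≈-refl
        lem₂ : ∀ p x y → p * p * (0# * x + 0# * y) ≈ 0#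
        lem₂ = solve 3 (λ p x y → p :* p :* (con (+ 0) :* x :+ con (+ 0) :* y) := con (+ 0)) ≈-refl
      expansion (suc (suc k)) (suc M) (ℕ.s≤s 1+k<M) {s} S = begin
        s (r ℕ.+ (N ℕ.+ (N ℕ.+ k ℕ.* N)))                            ≈⟨ ≈-reflexive (cong s (index₂ r (k ℕ.* N))) ⟩
        s (r ℕ.+ k ℕ.* N ℕ.+ N ℕ.+ N)                                ≈⟨ lem (s (r ℕ.+ k ℕ.* N ℕ.+ N)) _ ⟩
        s (r ℕ.+ k ℕ.* N ℕ.+ N) + (s (r ℕ.+ k ℕ.* N ℕ.+ N ℕ.+ N) - s (r ℕ.+ k ℕ.* N ℕ.+ N))
                                                                     ≈⟨ +-cong (≈-reflexive (cong s (index₁ r (k ℕ.* N)))) (≈-sym (T-exact S (r ℕ.+ k ℕ.* N))) ⟩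
        s (r ℕ.+ suc k ℕ.* N) + p^ 2 * T s (r ℕ.+ k ℕ.* N)           ≈⟨ +-cong (expansion (suc k) (suc M) (ℕ.m≤n⇒m≤1+n 1+k<M) S)
                                                                                (*-congˡ (expansion k M (ℕ.<⇒≤ 1+k<M) (T-solution S))) ⟩
        Σ< (suc M) (term s (suc k)) + p^ 2 * Σ< M (term (T s) k)     ≈⟨ +-congˡ (Sums.Σ<-*ˡ M (p^ 2) (term (T s) k)) ⟩
        term s (suc k) 0 + Σ< M (term s (suc k) ∘ suc) + Σ< M (λ i → p^ 2 * term (T s) k i)
                                                                     ≈⟨ +-assoc (term s (suc k) 0) (Σ< M (term s (suc k) ∘ suc)) (Σ< M (λ i → p^ 2 * term (T s) k i)) ⟩
        term s (suc k) 0 + (Σ< M (term s (suc k) ∘ suc) + Σ< M (λ i → p^ 2 * term (T s) k i))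
                                                                     ≈⟨ +-congˡ (Sums.Σ<-+ M (term s (suc k) ∘ suc) (λ i → p^ 2 * term (T s) k i)) ⟨
        term s (suc k) 0 + Σ< M (λ i → term s (suc k) (suc i) + p^ 2 * term (T s) k i)
                                                                     ≈⟨ +-congˡ (Sums.Σ<-cong M λ i → term-rec s k i) ⟨
        -- The terms with i = 0 agree for k + 1 and k + 2 by computation: all their Fibonacci
        -- coefficients are 1.
        Σ< (suc M) (term s (suc (suc k)))                            ∎
        where
        open SetoidReasoning setoid
        lem : ∀ x y → y ≈ x + (y - x)
        lem = solve 2 (λ x y → y := x :+ (y :- x)) ≈-refl
        index₁ : ∀ r m → r ℕ.+ m ℕ.+ N ≡ r ℕ.+ (N ℕ.+ m)
        index₁ r m = trans (ℕ.+-assoc r m N) (cong (r ℕ.+_) (ℕ.+-comm m N))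
        index₂ : ∀ r m → r ℕ.+ (N ℕ.+ (N ℕ.+ m)) ≡ r ℕ.+ m ℕ.+ N ℕ.+ N
        index₂ r m = sym (trans (cong (ℕ._+ N) (index₁ r m)) (trans (ℕ.+-assoc r (N ℕ.+ m) N) (cong (r ℕ.+_) (ℕ.+-comm (N ℕ.+ m) N))))

      -- The argument y = c + k m determines k = u (y - c), where u = 1/m.
      module _ (s : ℕ → Carrier) (S : Solution s) (m : ℕ) (u : Carrier) (mu≈1 : fromℕ m * u ≈ 1#) (c : ℕ) where

        ρ : ℕ → Carrier
        ρ i = proj₁ (p^/! i)

        -- The constant term of k - j = u (y - c) - j as an affine function of y.
        α : ℕ → Carrier
        α j = - (u * fromℕ c) - fromℕ j

        -- At y = c + k m this is pⁱ times C(k - i, i) `w₀ s i` + C(k - 1 - i, i) `w₁ s i`, with the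
        -- binomial coefficients read as polynomials in k.
        Q : ℕ → Carrier → Carrier
        Q i y = w₀ s i * (ρ i * (α i + u * y) ↓ i) + w₁ s i * (ρ i * (α (suc i) + u * y) ↓ i)

        Q-polynomial : ∀ i → IsPolynomial i (Q i)
        Q-polynomial i = add (scale (w₀ s i) (scale (ρ i) (↓-polynomial (α i) u i)))
                             (scale (w₁ s i) (scale (ρ i) (↓-polynomial (α (suc i)) u i)))

        fromℕ-∸ : ∀ {k j} → j ℕ.≤ k → fromℕ k - fromℕ j ≈ fromℕ (k ℕ.∸ j)
        fromℕ-∸ {k} {j} j≤k = ≈-trans (+-congʳ (≈-trans (≈-reflexive (cong fromℕ (sym (ℕ.m∸n+n≡m j≤k)))) (fromℕ-+ (k ℕ.∸ j) j)))
          (lem (fromℕ (k ℕ.∸ j)) (fromℕ j))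
          where
          lem : ∀ x y → x + y - y ≈ x
          lem = solve 2 (λ x y → x :+ y :- y := x) ≈-refl

        argument : ∀ {k j} → j ℕ.≤ k → α j + u * fromℕ (c ℕ.+ k ℕ.* m) ≈ fromℕ (k ℕ.∸ j)
        argument {k} {j} j≤k = begin
          α j + u * fromℕ (c ℕ.+ k ℕ.* m)                  ≈⟨ +-congˡ (*-congˡ (≈-trans (fromℕ-+ c (k ℕ.* m)) (+-congˡ (fromℕ-* k m)))) ⟩
          α j + u * (fromℕ c + fromℕ k * fromℕ m)          ≈⟨ lem u (fromℕ c) (fromℕ j) (fromℕ k) (fromℕ m) ⟩
          fromℕ k * (fromℕ m * u) - fromℕ j                ≈⟨ +-congʳ (≈-trans (*-congˡ mu≈1) (*-identityʳ (fromℕ k))) ⟩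
          fromℕ k - fromℕ j                                ≈⟨ fromℕ-∸ j≤k ⟩
          fromℕ (k ℕ.∸ j)                                  ∎
          where
          open SetoidReasoning setoid
          lem : ∀ u c j k m → - (u * c) - j + u * (c + k * m) ≈ k * (m * u) - j
          lem = solve 5 (λ u c j k m → :- (u :* c) :- j :+ u :* (c :+ k :* m) := k :* (m :* u) :- j) ≈-refl

        -- Restricted to j ≤ k, because beyond it the polynomial has a negative upper entry k - j,
        -- whereas `k ∸ j` is 0.
        ρ-↓ : ∀ {k j i} → j ℕ.≤ k → ρ i * (α j + u * fromℕ (c ℕ.+ k ℕ.* m)) ↓ i ≈ p^ i * fromℕ ((k ℕ.∸ j) C i)
        ρ-↓ {k} {j} {i} j≤k = begin
          ρ i * (α j + u * fromℕ (c ℕ.+ k ℕ.* m)) ↓ i             ≈⟨ *-congˡ (≈-trans (↓-cong i (argument j≤k)) (↓-binomial (k ℕ.∸ j) i)) ⟩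
          ρ i * (fromℕ ((k ℕ.∸ j) C i) * fromℕ (i !))             ≈⟨ lem (ρ i) (fromℕ ((k ℕ.∸ j) C i)) (fromℕ (i !)) ⟩
          ρ i * fromℕ (i !) * fromℕ ((k ℕ.∸ j) C i)               ≈⟨ *-congʳ (proj₂ (p^/! i)) ⟩
          p^ i * fromℕ ((k ℕ.∸ j) C i)                            ∎
          where
          open SetoidReasoning setoid
          lem : ∀ a b c → a * (b * c) ≈ a * c * b
          lem = solve 3 (λ a b c → a :* (b :* c) := a :* c :* b) ≈-refl

        -- For i < k both k - i and k - 1 - i are natural numbers, so the binomial polynomials take
        -- the values that occur in `fib`.
        Q-term : ∀ k i → i ℕ.< k → p^ i * Q i (fromℕ (c ℕ.+ k ℕ.* m)) ≈ term s k i
        Q-term (suc k) i (ℕ.s≤s i≤k) = ≈-trans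
          (*-congˡ (+-cong (*-congˡ (ρ-↓ {suc k} {i} {i} (ℕ.m≤n⇒m≤1+n i≤k))) (*-congˡ (ρ-↓ {suc k} {suc i} {i} (ℕ.s≤s i≤k)))))
          (lem (p^ i) (w₀ s i) (fromℕ ((suc k ℕ.∸ i) C i)) (w₁ s i) (fromℕ ((k ℕ.∸ i) C i)))
          where
          lem : ∀ P w a v b → P * (w * (P * a) + v * (P * b)) ≈ P * P * (a * w + b * v)
          lem = solve 5 (λ P w a v b → P :* (w :* (P :* a) :+ v :* (P :* b)) := P :* P :* (a :* w :+ b :* v)) ≈-refl

        interpolates : ∀ k → s (r ℕ.+ k ℕ.* N) ≈[ k ] series Q-polynomial (fromℕ (c ℕ.+ k ℕ.* m))
        interpolates k = begin
          s (r ℕ.+ k ℕ.* N)                                        ≈⟨ ≈⇒≈[] (expansion k (suc k) ℕ.≤-refl S) ⟩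
          Σ< (suc k) (term s k)                                    ≈⟨ Sums[].Σ<-last k k (term s k) ⟩
          -- The exact expansion needs k + 1 terms. The last one lies outside the range of `Q-term`
          -- and is dropped as a multiple of pᵏ.
          Σ< k (term s k) + term s k k                             ≈⟨ +-congˡ[] (≈[]-trans (≈⇒≈[] (*-assoc (p^ k) (p^ k) _)) (p^*≈[]0 k _)) ⟩
          Σ< k (term s k) + 0#                                     ≈⟨ ≈⇒≈[] (+-identityʳ (Σ< k (term s k))) ⟩
          Σ< k (term s k)                                          ≈⟨ Sums[].Σ<-cong< k k (λ i i<k → ≈⇒≈[] (Q-term k i i<k)) ⟨
          Σ< k (λ i → p^ i * Q i (fromℕ (c ℕ.+ k ℕ.* m)))          ≈⟨ Σ∞-partial k (λ i → Q i (fromℕ (c ℕ.+ k ℕ.* m))) ⟨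
          series Q-polynomial (fromℕ (c ℕ.+ k ℕ.* m))              ∎
          where
          open Mod k
          open SetoidReasoning setoid[]

  -- In the application N = pᵉm and c = ⌊r/pᵉ⌋, so that c + k m is ⌊n/pᵉ⌋ for n = r + k N.
  record Interpolant (s : ℕ → Carrier) (N m r c : ℕ) : Set where
    field
      F            : Carrier → Carrier
      F-coeff      : ℕ → Carrier
      F-≈[]        : ∀ {n x y} → x ≈[ n ] y → F x ≈[ n ] F y
      F-partial    : ∀ n y → Σ< n (λ d → F-coeff d * y ^ d) ≈[ n ] F y
      interpolates : ∀ k → s (r ℕ.+ k ℕ.* N) ≈[ k ] F (fromℕ (c ℕ.+ k ℕ.* m))

  record InterpolationData (s : ℕ → Carrier) : Set where
    field
      e m     : ℕ
      m≢0     : ℕ.NonZero m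
      m⁻¹     : Carrier
      m-unit  : fromℕ m * m⁻¹ ≈ 1#
      interpolant : ∀ r c → Interpolant s (p ℕ.^ e ℕ.* m) m r c

  -- N must be a multiple of `states ℓ !` and also a power of p times a unit; the second factor pᶠ⁺¹
  -- - 1 is a unit because it is -1 modulo p.
  interpolation : ∀ {ℓ} (a : Fin ℓ → Carrier) {s} → Recurrence.Solution a s → InterpolationData s
  interpolation {ℓ} a {s} S = build (∣p^e*[p^f-1] p (states ℓ !) {{states ℓ ℕ.!≢0}})
    where
    build : (∃₂ λ e f → states ℓ ! ℕ∣.∣ p ℕ.^ e ℕ.* (p ℕ.^ suc f ℕ.∸ 1)) → InterpolationData s
    build (e , f , states!∣N) = record
      { e = e ; m = m ; m≢0 = m≢0 ; m⁻¹ = proj₁ inverse ; m-unit = proj₂ inverse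
      ; interpolant = λ r c → let open Interpolation a (p ℕ.^ e ℕ.* m) {{ℕ.m*n≢0 (p ℕ.^ e) m {{ℕ.m^n≢0 p e}} {{m≢0}}}} states!∣N
                                  P = Q-polynomial r s S m (proj₁ inverse) (proj₂ inverse) c in record
        { F = series P ; F-coeff = series-coeff P ; F-≈[] = series-≈[] P ; F-partial = series-partial P
        ; interpolates = interpolates r s S m (proj₁ inverse) (proj₂ inverse) c
        }
      }
      where
      m = p ℕ.^ suc f ℕ.∸ 1
      1<p^ : 1 ℕ.< p ℕ.^ suc f
      1<p^ = ℕ.<-≤-trans (ℕ.nonTrivial⇒n>1 p {{prime⇒nonTrivial p-prime}}) (ℕ.m≤m*n p (p ℕ.^ f) {{ℕ.m^n≢0 p f}})
      m≢0 : ℕ.NonZero m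
      m≢0 = ℕ.>-nonZero (ℕ.m<n⇒0<n∸m 1<p^)
      p∤m : ¬ p ℕ∣.∣ m
      p∤m p∣m = p∤1 p-prime (ℕ∣.∣m+n∣m⇒∣n (subst (p ℕ∣.∣_) (sym (ℕ.m∸n+n≡m (ℕ.<⇒≤ 1<p^))) (ℕ∣.m∣m*n (p ℕ.^ f))) p∣m)
      inverse : ∃ λ v → fromℕ m * v ≈ 1#
      inverse = p∤⇒unit m p∤m

  -- Divisibility by powers of p

  ≈[]0? : ∀ x n → Dec (x ≈[ n ] 0#)
  ≈[]0? x n with + (p ℕ.^ n) ℤ∣.∣? residue x n ℤ.- + 0
  ... | yes d = yes (≈[]-trans (≈[]-residue x n) (p^∣⇒≈[] d))
  ... | no ¬d = no λ x≈0 → ¬d (≈[]⇒p^∣ (≈[]-trans (≈[]-sym (≈[]-residue x n)) x≈0))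

  ℕ-approximation : ∀ x n → ∃ λ k → x ≈[ n ] fromℕ k
  ℕ-approximation x n = a , ≈[]-trans (≈[]-residue x n) (p^∣⇒≈[] (divides (X /ℕ q)
    (trans (cong (ℤ._- + a) (a≡a%ℕn+[a/ℕn]*n X q)) (lem (+ a) ((X /ℕ q) ℤ.* + q)))))
    where
    instance _ = ℕ.m^n≢0 p n
    q = p ℕ.^ n
    X = residue x n
    a = X %ℕ q
    lem : ∀ a b → a ℤ.+ b ℤ.- a ≡ b
    lem = solve-∀

  unit : ∀ x → ¬ x ≈[ 1 ] 0# → ∃ λ v → x * v ≈ 1#
  unit x x≉0 = unit-inverse x v (≈[]-trans (≈[]-* x≈a (Mod.≈[]-refl 1)) (≈⇒≈[] av≈1))
    where
    a = proj₁ (ℕ-approximation x 1)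
    x≈a : x ≈[ 1 ] fromℕ a
    x≈a = proj₂ (ℕ-approximation x 1)
    p∤a : ¬ p ℕ∣.∣ a
    p∤a p∣a = x≉0 (≈[]-trans x≈a (p^∣⇒≈[] (subst₂ _∣_ (cong +_ (sym (ℕ.*-identityʳ p))) (sym (ℤ.+-identityʳ (+ a))) (ℤ∣.∣ᵤ⇒∣ {+ p} {+ a} p∣a))))
    v = proj₁ (p∤⇒unit a p∤a)
    av≈1 = proj₂ (p∤⇒unit a p∤a)

  -- In ℤₚ the equation c + k m = z has the solution k = u (z - c); a natural number congruent to it
  -- modulo pᴹ is good enough.
  progression-dense : ∀ M r q c m {u x z} → fromℕ m * u ≈ 1# → x ≈ fromℕ r + fromℕ q * z →
                      ∃ λ k → fromℕ (r ℕ.+ q ℕ.* (c ℕ.+ k ℕ.* m)) - x ≈[ M ] 0#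
  progression-dense M r q c m {u} {x} {z} mu≈1 x≈ = k , (begin
    fromℕ (r ℕ.+ q ℕ.* (c ℕ.+ k ℕ.* m)) - x
      ≈⟨ ≈⇒≈[] (+-cong (≈-trans (fromℕ-+ r (q ℕ.* (c ℕ.+ k ℕ.* m))) (+-congˡ (≈-trans (fromℕ-* q (c ℕ.+ k ℕ.* m))
           (*-congˡ (≈-trans (fromℕ-+ c (k ℕ.* m)) (+-congˡ (fromℕ-* k m))))))) (-‿cong x≈)) ⟩
    fromℕ r + fromℕ q * (fromℕ c + fromℕ k * fromℕ m) - (fromℕ r + fromℕ q * z)
      ≈⟨ +-congʳ[] (+-congˡ[] (*-congˡ[] (+-congˡ[] (*-congʳ[] (proj₂ approximation))))) ⟨
    fromℕ r + fromℕ q * (fromℕ c + u * (z - fromℕ c) * fromℕ m) - (fromℕ r + fromℕ q * z)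
      ≈⟨ ≈⇒≈[] (lem (fromℕ r) (fromℕ q) (fromℕ c) u z (fromℕ m)) ⟩
    fromℕ q * (z - fromℕ c) * (fromℕ m * u - 1#)
      ≈⟨ ≈⇒≈[] (≈-trans (*-congˡ (≈-trans (+-congʳ mu≈1) (-‿inverseʳ 1#))) (zeroʳ (fromℕ q * (z - fromℕ c)))) ⟩
    0# ∎)
    where
    open Mod M
    open SetoidReasoning setoid[]
    approximation = ℕ-approximation (u * (z - fromℕ c)) M
    k = proj₁ approximation
    lem : ∀ r q c u z m → r + q * (c + u * (z - c) * m) - (r + q * z) ≈ q * (z - c) * (m * u - 1#)
    lem = solve 6 (λ r q c u z m → r :+ q :* (c :+ u :* (z :- c) :* m) :- (r :+ q :* z) := q :* (z :- c) :* (m :* u :- con (+ 1))) ≈-refl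

  ≈[]0-* : ∀ {a b x y} → x ≈[ a ] 0# → y ≈[ b ] 0# → x * y ≈[ a ℕ.+ b ] 0#
  ≈[]0-* {a} {b} {x} {y} x≈0 y≈0 = ≈[]-trans (≈⇒≈[] (begin
    x * y                                  ≈⟨ *-cong (≈-sym (/p^-exact a x≈0)) (≈-sym (/p^-exact b y≈0)) ⟩
    p^ a * (x /p^ a) * (p^ b * (y /p^ b))  ≈⟨ lem (p^ a) (x /p^ a) (p^ b) (y /p^ b) ⟩
    p^ a * p^ b * (x /p^ a * (y /p^ b))    ≈⟨ *-congʳ (≈-sym (p^-+ a b)) ⟩
    p^ (a ℕ.+ b) * (x /p^ a * (y /p^ b))   ∎)) (p^*≈[]0 (a ℕ.+ b) _)
    where
    open SetoidReasoning setoid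
    lem : ∀ a x b y → a * x * (b * y) ≈ a * b * (x * y)
    lem = solve 4 (λ a x b y → a :* x :* (b :* y) := a :* b :* (x :* y)) ≈-refl

  -- The quotient x / pᵃ is not divisible by p, hence a unit, and v is its inverse.
  exact-inverse : ∀ a x → x ≈[ a ] 0# → ¬ x ≈[ suc a ] 0# → ∃ λ v → x * v ≈ p^ a
  exact-inverse a x x≈0 x≉0 = v , (begin
    x * v                 ≈⟨ *-congʳ (≈-sym (/p^-exact a x≈0)) ⟩
    p^ a * (x /p^ a) * v  ≈⟨ *-assoc (p^ a) (x /p^ a) v ⟩
    p^ a * (x /p^ a * v)  ≈⟨ *-congˡ (proj₂ u) ⟩
    p^ a * 1#             ≈⟨ *-identityʳ (p^ a) ⟩
    p^ a                  ∎)
    where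
    open SetoidReasoning setoid
    u = unit (x /p^ a) λ x/p^≈0 → x≉0 (subst (λ k → x ≈[ k ] 0#) (ℕ.+-comm a 1)
      (≈[]-trans (≈⇒≈[] (≈-sym (/p^-exact a x≈0))) (≈[]-trans (p^*-cong[] a x/p^≈0) (≈⇒≈[] (zeroʳ (p^ a))))))
    v = proj₁ u

  -- Multiplying xy by v with xv = pᵃ turns it into pᵃ y.
  ≉[]0-* : ∀ {a b x y} → x ≈[ a ] 0# → ¬ x ≈[ suc a ] 0# → ¬ y ≈[ suc b ] 0# → ¬ x * y ≈[ suc (a ℕ.+ b) ] 0#
  ≉[]0-* {a} {b} {x} {y} x≈0 x≉0 y≉0 xy≈0 = y≉0 (p^*-cancel[] a
    (≈[]-trans (≈⇒≈[] (≈-sym (≈-trans (lem x y v) (*-congʳ xv≈p^a))))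
    (≈[]-trans (Mod.*-congʳ[] _ (subst (λ k → x * y ≈[ k ] 0#) (sym (ℕ.+-suc a b)) xy≈0))
      (≈⇒≈[] (≈-trans (zeroˡ v) (≈-sym (zeroʳ (p^ a))))))))
    where
    v = proj₁ (exact-inverse a x x≈0 x≉0)
    xv≈p^a = proj₂ (exact-inverse a x x≈0 x≉0)
    lem : ∀ x y v → x * y * v ≈ x * v * y
    lem = solve 3 (λ x y v → x :* y :* v := x :* v :* y) ≈-refl

  -- The equation (x / pᵏ)(v pᵏ / pᵃ) = 1 of ℚₚ with denominators cleared; here `k`, `P`, `q` stand
  -- for pᵏ, pᵃ, pᵏ⁺ᵃ.
  exact-inverse-cross : ∀ {x v P k q} → x * v ≈ P → q ≈ k * P → x * (v * k) * 1# ≈ 1# * q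
  exact-inverse-cross {x} {v} {P} {k} {q} xv≈P q≈kP = ≈-trans (lem₁ x v k) (≈-trans (*-congˡ xv≈P) (≈-trans (≈-sym q≈kP) (≈-sym (*-identityˡ q))))
    where
    lem₁ : ∀ x v k → x * (v * k) * 1# ≈ k * (x * v)
    lem₁ = solve 3 (λ x v k → x :* (v :* k) :* con (+ 1) := k :* (x :* v)) ≈-refl

  ≈[0] : ∀ x → x ≈[ 0 ] 0#
  ≈[0] x = ≈[]-trans (≈⇒≈[] (≈-sym (*-identityˡ x))) (p^*≈[]0 0 x)

  -- Finds the valuation of x by a search downwards from n, possible since divisibility by a power
  -- of p is decidable.
  leading-digit : ∀ n x → ¬ x ≈[ n ] 0# → ∃ λ a → x ≈[ a ] 0# × ¬ x ≈[ suc a ] 0#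
  leading-digit zero    x x≉0 = contradiction (≈[0] x) x≉0
  leading-digit (suc n) x x≉0 with ≈[]0? x n
  ... | yes x≈0  = n , x≈0 , x≉0
  ... | no  x≉0′ = leading-digit n x x≉0′

  ≉[]0-cross : ∀ {x y n} l k → x * p^ l ≈ y * p^ k → ¬ x ≈[ n ] 0# → ¬ y ≈[ l ℕ.+ n ] 0#
  ≉[]0-cross {x} {y} l k xl≈yk x≉0 y≈0 = x≉0 (p^*-cancel[] l
    (≈[]-trans (≈⇒≈[] (≈-trans (*-comm (p^ l) x) xl≈yk))
    (≈[]-trans (Mod.*-congʳ[] _ y≈0) (≈⇒≈[] (≈-trans (zeroˡ (p^ k)) (≈-sym (zeroʳ (p^ l))))))))

  ≉[]0-+ : ∀ {n} x u y v → ¬ x * u + y * v ≈[ n ] 0# → ¬ x ≈[ n ] 0# ⊎ ¬ y ≈[ n ] 0#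
  ≉[]0-+ {n} x u y v ≉0 with ≈[]0? x n
  ... | no  x≉0 = inj₁ x≉0
  ... | yes x≈0 = inj₂ λ y≈0 → ≉0 (≈[]-trans (≈[]-+ (Mod.*-congʳ[] n x≈0) (Mod.*-congʳ[] n y≈0))
    (≈⇒≈[] (≈-trans (+-cong (zeroˡ u) (zeroˡ v)) (+-identityˡ 0#))))

  ≉[]0-*ˡ : ∀ {n} x y → ¬ x * y ≈[ n ] 0# → ¬ x ≈[ n ] 0#
  ≉[]0-*ˡ {n} x y xy≉0 x≈0 = xy≉0 (≈[]-trans (Mod.*-congʳ[] n x≈0) (≈⇒≈[] (zeroˡ y)))

  ≉[]0-‿ : ∀ {n} x → ¬ - x ≈[ n ] 0# → ¬ x ≈[ n ] 0#
  ≉[]0-‿ {n} x -x≉0 x≈0 = -x≉0 (≈[]-trans (≈[]-‿ x≈0) (≈⇒≈[] -0≈0))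
    where
    -0≈0 : - 0# ≈ 0#
    -0≈0 = solve 0 (:- con (+ 0) := con (+ 0)) ≈-refl

  1≉[1]0 : ¬ 1# ≈[ 1 ] 0#
  1≉[1]0 1≈0 = p∤1 p-prime (subst (ℕ∣._∣ 1) (ℕ.*-identityʳ p) (ℤ∣.∣⇒∣ᵤ (≈[]⇒p^∣ 1≈0)))

  ≈[]0-*+* : ∀ {a b l k c x y z w} → x ≈[ a ] 0# → z ≈[ l ] 0# → y ≈[ b ] 0# → w ≈[ k ] 0# →
             c ℕ.≤ a ℕ.+ l → c ℕ.≤ b ℕ.+ k → x * z + y * w ≈[ c ] 0#
  ≈[]0-*+* x≈0 z≈0 y≈0 w≈0 c≤a+l c≤b+k = ≈[]-trans
    (≈[]-+ (≈[]-≤ c≤a+l (≈[]0-* x≈0 z≈0)) (≈[]-≤ c≤b+k (≈[]0-* y≈0 w≈0))) (≈⇒≈[] (+-identityˡ 0#))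

  ≈[]0-cross : ∀ {b c x y} k l → x * p^ l ≈ y * p^ k → y ≈[ b ] 0# → l ℕ.≤ c → c ℕ.≤ b ℕ.+ k → x ≈[ c ℕ.∸ l ] 0#
  ≈[]0-cross {b} {c} {x} {y} k l xl≈yk y≈0 l≤c c≤b+k = p^*-cancel[] l
    (subst (λ m → p^ l * x ≈[ m ] p^ l * 0#) (sym (ℕ.m+[n∸m]≡n l≤c))
      (≈[]-trans (≈⇒≈[] (≈-trans (*-comm (p^ l) x) xl≈yk))
        (≈[]-trans (≈[]-≤ c≤b+k (≈[]0-* y≈0 p^k≈0)) (≈⇒≈[] (≈-sym (zeroʳ (p^ l)))))))
    where
    p^k≈0 : p^ k ≈[ k ] 0#
    p^k≈0 = ≈[]-trans (≈⇒≈[] (≈-sym (*-identityʳ (p^ k)))) (p^*≈[]0 k 1#)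

-- The inverse limit ℤₚ as a model of the axioms

module ℤₚ-Interpolation (p : ℕ) (p-prime : Prime p) where

  open Padic p p-prime
  open GroupProperties (AbelianGroup.group ℤ.+-0-abelianGroup) using () renaming (∙-cancelˡ to +-cancelˡ)

  ∣-divisor : ∀ {i j k} → i ≡ j → i ∣ k → j ∣ k
  ∣-divisor refl d = d

  module ℤₚ-ring = CommutativeRing ℤₚ-commutativeRing

  0ᶻ : ℤₚ
  0ᶻ = fromℤ (+ 0)

  pᶻ : ℕ → ℤₚ
  pᶻ i = fromℤ (p^ i)

  pᶻ-+ : ∀ m n → pᶻ (m ℕ.+ n) ≈ᶻ pᶻ m *ᶻ pᶻ n
  pᶻ-+ m n = pointwise λ _ → p^-+ m n

  infix 4 _≈[_]_

  -- Comparing the n-th residues is enough: by coherence all later residues agree with them modulo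
  -- pⁿ.
  record _≈[_]_ (x : ℤₚ) (n : ℕ) (y : ℤₚ) : Set where
    constructor level
    field
      at : residue x n ≡ residue y n mod-p^ n

  open _≈[_]_ public

  ≈ᶻ⇒≈[] : ∀ {n x y} → x ≈ᶻ y → x ≈[ n ] y
  ≈ᶻ⇒≈[] {n} e = level (mod e n)

  ≈[]⇒≈ᶻ : ∀ {x y} → (∀ n → x ≈[ n ] y) → x ≈ᶻ y
  ≈[]⇒≈ᶻ e = mk≈ᶻ λ n → at (e n)

  p^∣p^ : ∀ {m n} → m ℕ.≤ n → p^ m ∣ p^ n
  p^∣p^ {m} {n} m≤n = divides (p^ (n ℕ.∸ m)) (trans (cong p^ (sym (ℕ.m∸n+n≡m m≤n))) (p^-+ (n ℕ.∸ m) m))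

  residue-≤ : ∀ x {m n} → m ℕ.≤ n → residue x n ≡ residue x m mod-p^ m
  residue-≤ x m≤n = go (ℕ.≤⇒≤′ m≤n)
    where
    go : ∀ {m n} → m ℕ.≤′ n → residue x n ≡ residue x m mod-p^ m
    go ℕ.≤′-refl             = mod-≡ refl
    go {n = suc n} (ℕ.≤′-step l) =
      mod-trans (mk-mod (∣-trans (p^∣p^ (ℕ.≤′⇒≤ l)) (p^∣ (coherent x n)))) (go l)

  ≈[]-≤ : ∀ {x y m n} → m ℕ.≤ n → x ≈[ n ] y → x ≈[ m ] y
  ≈[]-≤ {x} {y} m≤n e = level (mod-trans (mod-sym (residue-≤ x m≤n))
    (mod-trans (mk-mod (∣-trans (p^∣p^ m≤n) (p^∣ (at e)))) (residue-≤ y m≤n)))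

  p^∣⇒≈[]0 : ∀ {x n} → p^ n ∣ residue x n → x ≈[ n ] 0ᶻ
  p^∣⇒≈[]0 {x} {n} d = level (mk-mod (∣-by (sym (ℤ.+-identityʳ (residue x n))) d))

  ≈[]0⇒p^∣ : ∀ {x n} → x ≈[ n ] 0ᶻ → p^ n ∣ residue x n
  ≈[]0⇒p^∣ {x} {n} e = ∣-by (ℤ.+-identityʳ (residue x n)) (p^∣ (at e))

  pᶻ-*-cong : ∀ {m n x y} → x ≈[ n ] y → pᶻ m *ᶻ x ≈[ m ℕ.+ n ] pᶻ m *ᶻ y
  pᶻ-*-cong {m} {n} {x} {y} e = level (mk-mod
    (∣-divisor (sym (p^-+ m n)) (∣-by (lem (p^ m) X Y) (mul (p^ m) d))))
    where
    X = residue x (m ℕ.+ n)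
    Y = residue y (m ℕ.+ n)
    d : p^ n ∣ X ℤ.- Y
    d = p^∣ (mod-trans (residue-≤ x (ℕ.m≤n+m n m)) (mod-trans (at e) (mod-sym (residue-≤ y (ℕ.m≤n+m n m)))))
    lem : ∀ a x y → a ℤ.* (x ℤ.- y) ≡ a ℤ.* x ℤ.- a ℤ.* y
    lem = solve-∀
    mul : ∀ k {i j} → i ∣ j → k ℤ.* i ∣ k ℤ.* j
    mul k {i} (divides q refl) = divides q (lem′ k q i)
      where
      lem′ : ∀ k q i → k ℤ.* (q ℤ.* i) ≡ q ℤ.* (k ℤ.* i)
      lem′ = solve-∀

  pᶻ-*-cancel : ∀ m {n x y} → pᶻ m *ᶻ x ≈[ m ℕ.+ n ] pᶻ m *ᶻ y → x ≈[ n ] y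
  pᶻ-*-cancel m {n} {x} {y} e = level
    (mod-trans (mod-sym (residue-≤ x (ℕ.m≤n+m n m)))
    (mod-trans (mk-mod (*-cancelʳ-∣ (p^ m) {{p^n≢0 m}}
      (subst (_∣ (X ℤ.- Y) ℤ.* p^ m) (trans (p^-+ m n) (ℤ.*-comm (p^ m) (p^ n))) (∣-by (lem (p^ m) X Y) (p^∣ (at e))))))
      (residue-≤ y (ℕ.m≤n+m n m))))
    where
    X = residue x (m ℕ.+ n)
    Y = residue y (m ℕ.+ n)
    lem : ∀ a x y → a ℤ.* x ℤ.- a ℤ.* y ≡ (x ℤ.- y) ℤ.* a
    lem = solve-∀

  -- The diagonal of residues, coherent because `x (suc n)` and `x n` have congruent n-th residues.
  limit : (x : ℕ → ℤₚ) → (∀ n → x (suc n) ≈[ n ] x n) → ℤₚ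
  residue  (limit x _)      n = residue (x n) n
  coherent (limit x stable) n = mod-trans (coherent (x (suc n)) n) (at (stable n))

  limit-≈[] : ∀ x stable n → limit x stable ≈[ n ] x n
  limit-≈[] x stable n = level (mod-≡ refl)

  -- Euclidean division by pᵉ

  %-unique : ∀ {a b} q → a ℕ.< q → b ℕ.< q → + q ∣ + a ℤ.- + b → a ≡ b
  %-unique {a} {b} q a<q b<q d = ℤ.+-injective (ℤ.i-j≡0⇒i≡j (+ a) (+ b) (ℤ.∣i∣≡0⇒i≡0 (vanish (∣⇒∣ᵤ d) small)))
    where
    small : ℤ.∣ + a ℤ.- + b ∣ ℕ.< q
    small = ℕ.≤-<-trans (ℕ.≤-trans (ℕ.≤-reflexive (cong ℤ.∣_∣ (ℤ.m-n≡m⊖n a b))) (ℤ.∣m⊝n∣≤m⊔n a b)) (ℕ.⊔-lub a<q b<q)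
    vanish : ∀ {k} → q ℕ∣.∣ k → k ℕ.< q → k ≡ 0
    vanish {zero}  _ _   = refl
    vanish {suc k} d k<q = contradiction (ℕ∣.∣⇒≤ d) (ℕ.<⇒≱ k<q)

  module _ (q : ℕ) .{{_ : ℕ.NonZero q}} where

    private
      lem : ∀ r b r′ b′ q → r ℤ.+ b ℤ.* q ℤ.- (r′ ℤ.+ b′ ℤ.* q) ≡ (r ℤ.- r′) ℤ.+ (b ℤ.- b′) ℤ.* q
      lem = solve-∀

    %ℕ-cong : ∀ x y → + q ∣ x ℤ.- y → x %ℕ q ≡ y %ℕ q
    %ℕ-cong x y d = %-unique q (n%ℕd<d x q) (n%ℕd<d y q)
      (∣-by (lem′ (+ (x %ℕ q)) (+ (y %ℕ q)) ((x /ℕ q ℤ.- y /ℕ q) ℤ.* + q))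
        (∣m∣n⇒∣m-n (∣-by (trans (cong₂ ℤ._-_ (a≡a%ℕn+[a/ℕn]*n x q) (a≡a%ℕn+[a/ℕn]*n y q))
          (lem (+ (x %ℕ q)) (x /ℕ q) (+ (y %ℕ q)) (y /ℕ q) (+ q))) d)
          (∣n⇒∣m*n (x /ℕ q ℤ.- y /ℕ q) ∣-refl)))
      where
      lem′ : ∀ a b c → a ℤ.- b ℤ.+ c ℤ.- c ≡ a ℤ.- b
      lem′ = solve-∀

    -- The remainders of x and y are equal, so x - y is exactly q times the difference of the
    -- quotients.
    /ℕ-cong : ∀ k x y → k ℤ.* + q ∣ x ℤ.- y → k ∣ x /ℕ q ℤ.- y /ℕ q
    /ℕ-cong k x y d = *-cancelʳ-∣ (+ q) (∣-by
      (trans (cong₂ ℤ._-_ (a≡a%ℕn+[a/ℕn]*n x q) (trans (a≡a%ℕn+[a/ℕn]*n y q)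
               (cong (λ r → + r ℤ.+ (y /ℕ q) ℤ.* + q) (sym (%ℕ-cong x y (∣-trans (∣n⇒∣m*n k ∣-refl) d))))))
        (lem′ (+ (x %ℕ q)) (x /ℕ q) (y /ℕ q) (+ q))) d)
      where
      lem′ : ∀ r b b′ q → r ℤ.+ b ℤ.* q ℤ.- (r ℤ.+ b′ ℤ.* q) ≡ (b ℤ.- b′) ℤ.* q
      lem′ = solve-∀

    /ℕ-unique : ∀ {r} b → r ℕ.< q → (+ r ℤ.+ b ℤ.* + q) /ℕ q ≡ b
    /ℕ-unique {r} b r<q = ℤ.*-cancelʳ-≡ (x /ℕ q) b (+ q) (+-cancelˡ (+ r) _ _
      (sym (trans (a≡a%ℕn+[a/ℕn]*n x q) (cong (λ t → + t ℤ.+ (x /ℕ q) ℤ.* + q) x%q≡r))))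
      where
      x = + r ℤ.+ b ℤ.* + q
      x%q≡r : x %ℕ q ≡ r
      x%q≡r = sym (%-unique q r<q (n%ℕd<d x q) (∣-by (lem″ (+ r) (b ℤ.* + q) (+ (x %ℕ q)) ((x /ℕ q) ℤ.* + q)
        (a≡a%ℕn+[a/ℕn]*n x q)) (∣m∣n⇒∣m-n (∣n⇒∣m*n (x /ℕ q) ∣-refl) (∣n⇒∣m*n b ∣-refl))))
        where
        lem₁ : ∀ r bq s → r ℤ.+ bq ℤ.- s ℤ.- bq ≡ r ℤ.- s
        lem₁ = solve-∀
        lem₂ : ∀ s cq bq → cq ℤ.- bq ≡ s ℤ.+ cq ℤ.- s ℤ.- bq
        lem₂ = solve-∀
        lem″ : ∀ r bq s cq → r ℤ.+ bq ≡ s ℤ.+ cq → cq ℤ.- bq ≡ r ℤ.- s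
        lem″ r bq s cq eq = trans (lem₂ s cq bq) (trans (cong (λ t → t ℤ.- s ℤ.- bq) (sym eq)) (lem₁ r bq s))

  infixl 7 _/ᶻp^_

  -- The continuous extension of ⌊n/pᵉ⌋ to ℤₚ. Division loses e digits, hence the residue at n + e.
  _/ᶻp^_ : ℤₚ → ℕ → ℤₚ
  residue  (x /ᶻp^ e) n = _/ℕ_ (residue x (n ℕ.+ e)) (p ℕ.^ e) {{p^n≢0 e}}
  coherent (x /ᶻp^ e) n = mk-mod (/ℕ-cong (p ℕ.^ e) {{p^n≢0 e}} (p^ n) (residue x (suc n ℕ.+ e)) (residue x (n ℕ.+ e))
    (∣-divisor (p^-+ n e) (p^∣ (coherent x (n ℕ.+ e)))))

  /ᶻp^-cong : ∀ e {n x y} → x ≈[ n ℕ.+ e ] y → x /ᶻp^ e ≈[ n ] y /ᶻp^ e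
  /ᶻp^-cong e {n} {x} {y} eq = level (mk-mod (/ℕ-cong (p ℕ.^ e) {{p^n≢0 e}} (p^ n) (residue x (n ℕ.+ e)) (residue y (n ℕ.+ e))
    (∣-divisor (p^-+ n e) (p^∣ (at eq)))))

  /ᶻp^-unique : ∀ e {r} x t → r ℕ.< p ℕ.^ e → (∀ n → residue t n ≡ + r ℤ.+ residue x n ℤ.* p^ e) → t /ᶻp^ e ≈ᶻ x
  /ᶻp^-unique e {r} x t r<q t≡ = mk≈ᶻ λ n → mod-trans
    (mod-≡ (trans (cong (λ a → _/ℕ_ a (p ℕ.^ e) {{p^n≢0 e}}) (t≡ (n ℕ.+ e)))
                  (/ℕ-unique (p ℕ.^ e) {{p^n≢0 e}} (residue x (n ℕ.+ e)) r<q)))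
    (residue-≤ x (ℕ.m≤m+n n e))

  /ᶻp^-exact : ∀ e x → x ≈[ e ] 0ᶻ → pᶻ e *ᶻ (x /ᶻp^ e) ≈ᶻ x
  /ᶻp^-exact e x x≈0 = mk≈ᶻ λ n → mod-trans (mod-≡ (sym (X≡ n))) (residue-≤ x (ℕ.m≤m+n n e))
    where
    instance _ = p^n≢0 e
    q = p ℕ.^ e
    X≡ : ∀ n → residue x (n ℕ.+ e) ≡ p^ e ℤ.* (residue x (n ℕ.+ e) /ℕ q)
    X≡ n = trans (a≡a%ℕn+[a/ℕn]*n X q) (trans (cong (λ r → + r ℤ.+ (X /ℕ q) ℤ.* + q) X%q≡0)
             (trans (ℤ.+-identityˡ _) (ℤ.*-comm (X /ℕ q) (+ q))))
      where
      X = residue x (n ℕ.+ e)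
      q∣X-0 : + q ∣ X ℤ.- + 0
      q∣X-0 = p^∣ (mod-trans (residue-≤ x (ℕ.m≤n+m e n)) (at x≈0))
      X%q≡0 : X %ℕ q ≡ 0
      X%q≡0 = %-unique q (n%ℕd<d X q) (ℕ.>-nonZero⁻¹ q)
        (∣-by (trans (cong (ℤ._- (X /ℕ q) ℤ.* + q) (trans (ℤ.+-identityʳ X) (a≡a%ℕn+[a/ℕn]*n X q)))
                (lem (+ (X %ℕ q)) ((X /ℕ q) ℤ.* + q)))
          (∣m∣n⇒∣m-n q∣X-0 (∣n⇒∣m*n (X /ℕ q) ∣-refl)))
        where
        lem : ∀ r s → r ℤ.+ s ℤ.- s ≡ r ℤ.- + 0
        lem = solve-∀


  ℤₚ-padicRing : PadicRing p
  ℤₚ-padicRing = record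
    { Carrier = ℤₚ ; _≈_ = _≈ᶻ_ ; _+_ = _+ᶻ_ ; _*_ = _*ᶻ_ ; -_ = -ᶻ_ ; fromℤ = fromℤ
    ; isCommutativeRing = ℤₚ-ring.isCommutativeRing
    ; fromℤ-+ = λ a b → pointwise λ _ → refl
    ; fromℤ-* = λ a b → pointwise λ _ → refl
    ; fromℤ-‿ = λ a → pointwise λ _ → refl
    ; _≈[_]_ = _≈[_]_
    ; ≈⇒≈[] = ≈ᶻ⇒≈[]
    ; ≈[]⇒≈ = ≈[]⇒≈ᶻ
    ; ≈[]-sym = λ e → level (mod-sym (at e))
    ; ≈[]-trans = λ e f → level (mod-trans (at e) (at f))
    ; ≈[]-+ = λ e f → level (mod-+ (at e) (at f))
    ; ≈[]-* = λ e f → level (mod-* (at e) (at f))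
    ; ≈[]-‿ = λ e → level (mod-neg (at e))
    ; ≈[]-≤ = ≈[]-≤
    ; p^∣⇒≈[] = λ d → level (mk-mod d)
    ; ≈[]⇒p^∣ = λ e → p^∣ (at e)
    ; residue = residue
    ; ≈[]-residue = λ x n → level (mod-≡ refl)
    ; limit = limit
    ; limit-≈[] = limit-≈[]
    ; p^*-cong[] = λ e → pᶻ-*-cong {e}
    ; p^*-cancel[] = λ e → pᶻ-*-cancel e
    ; _/p^_ = _/ᶻp^_
    ; /p^-exact = λ e {x} → /ᶻp^-exact e x
    }

  module T = Theory p-prime ℤₚ-padicRing

  -- ℚₚ as a Heyting field and a finite extension of itself

  NonZeroᵠ : ℚₚ → Set
  NonZeroᵠ w = ∃ λ n → ¬ num w ≈[ n ] 0ᶻ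

  -- Being nonzero is witnessed by a level n at which the numerator does not vanish. The search
  -- below n then finds the valuation, and with it the inverse.
  ℚₚ-isNonZero : IsNonZero ℚₚ-commutativeRing NonZeroᵠ
  ℚₚ-isNonZero = record
    { resp    = λ {x} {y} e (n , x≉0) → exp y ℕ.+ n , T.≉[]0-cross {num x} {num y} (exp y) (exp x) (mk≈ᶻ λ k → mod (cross e) k) x≉0
    ; split-+ = λ x y (n , ≉0) → ⊎-map (n ,_) (n ,_) (T.≉[]0-+ {n} (num x) (pᶻ (exp y)) (num y) (pᶻ (exp x)) λ e → ≉0 (level (at e)))
    ; split-* = λ x y (n , ≉0) → n , T.≉[]0-*ˡ {n} (num x) (num y) λ e → ≉0 (level (at e))
    ; unneg   = λ x (n , ≉0) → n , T.≉[]0-‿ {n} (num x) λ e → ≉0 (level (at e))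
    ; one     = 1 , T.1≉[1]0
    ; zero∉   = λ (n , ≉0) → ≉0 (≈ᶻ⇒≈[] ℤₚ-ring.refl)
    ; tight   = λ x ¬nz → mk≈ᵠ (ℤₚ-ring.trans (ℤₚ-ring.*-congʳ {pᶻ 0} (≈[]⇒≈ᶻ λ n → stable x ¬nz n))
                                (pointwise λ _ → refl))
    ; inverse = λ x (n , x≉0) → inverse x (T.leading-digit n (num x) x≉0)
    }
    where
    stable : ∀ x → ¬ NonZeroᵠ x → ∀ n → num x ≈[ n ] 0ᶻ
    stable x ¬nz n with T.≈[]0? (num x) n
    ... | yes x≈0 = x≈0
    ... | no  x≉0 = contradiction (n , x≉0) ¬nz
    inverse : ∀ x → (∃ λ a → num x ≈[ a ] 0ᶻ × ¬ num x ≈[ suc a ] 0ᶻ) → ∃ λ y → x *ᵠ y ≈ᵠ 1ᵠ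
    inverse x (a , x≈0 , x≉0) = (v *ᶻ pᶻ (exp x) /p^ a) , mk≈ᵠ
      (mk≈ᶻ λ n → mod (T.exact-inverse-cross {num x} {v} {pᶻ a} {pᶻ (exp x)} {pᶻ (exp x ℕ.+ a)}
        (mk≈ᶻ λ n → mod (proj₂ (T.exact-inverse a (num x) x≈0 x≉0)) n) (mk≈ᶻ λ n → mod (pᶻ-+ (exp x) a) n)) n)
      where v = proj₁ (T.exact-inverse a (num x) x≈0 x≉0)

  x*1+0≈x : ∀ x → x *ᵠ 1ᵠ +ᵠ 0ᵠ ≈ᵠ x
  x*1+0≈x x = pointwiseᵠ λ n → subst (λ k → (residue (num x) n ℤ.* + 1 ℤ.* + 1 ℤ.+ + 0 ℤ.* p^ (exp x ℕ.+ 0)) ℤ.* p^ (exp x) ≡ residue (num x) n ℤ.* p^ k)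
    (sym (trans (ℕ.+-identityʳ (exp x ℕ.+ 0)) (ℕ.+-identityʳ (exp x)))) (lem (residue (num x) n) (p^ (exp x ℕ.+ 0)) (p^ (exp x)))
    where
    lem : ∀ a b c → (a ℤ.* + 1 ℤ.* + 1 ℤ.+ + 0 ℤ.* b) ℤ.* c ≡ a ℤ.* c
    lem = solve-∀

  ℚₚ-homomorphism : IsRingHomomorphism (CommutativeRing.rawRing ℚₚ-commutativeRing) (CommutativeRing.rawRing ℚₚ-commutativeRing) (λ x → x)
  ℚₚ-homomorphism = Identity.isRingHomomorphism (CommutativeRing.rawRing ℚₚ-commutativeRing) (λ {x} → CommutativeRing.refl ℚₚ-commutativeRing {x})

  spans : ∀ x → x ≈ᵠ x *ᵠ 1ᵠ +ᵠ 0ᵠ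
  spans x = ≈ᵠ-sym (x*1+0≈x x)

  independent : ∀ x → x *ᵠ 1ᵠ +ᵠ 0ᵠ ≈ᵠ 0ᵠ → x ≈ᵠ 0ᵠ
  independent x e = ≈ᵠ-trans (spans x) e

  ℚₚ-extension : FiniteExtension
  ℚₚ-extension = record
    { heytingField      = heytingField ℚₚ-commutativeRing ℚₚ-isNonZero
    ; ι                 = λ x → x
    ; ι-isHomomorphism  = ℚₚ-homomorphism
    ; degree            = 1
    ; basis             = λ _ → 1ᵠ
    ; basis-spans       = λ x → (λ _ → x) , mk≈ᵠ (mk≈ᶻ λ n → mod (cross (spans x)) n)
    ; basis-independent = λ { c e zero → independent (c zero) (mk≈ᵠ (mk≈ᶻ λ n → mod (cross e) n)) }
    }

  -- The truncated valuation

  ord≤-≤ : ∀ x n → ord≤ x n ℕ.≤ n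
  ord≤-≤ x zero    = ℕ.z≤n
  ord≤-≤ x (suc n) with p^ (suc n) ∣? residue x (suc n)
  ... | yes _ = ℕ.≤-refl
  ... | no  _ = ℕ.m≤n⇒m≤1+n (ord≤-≤ x n)

  ord≤-≈[]0 : ∀ x n → x ≈[ ord≤ x n ] 0ᶻ
  ord≤-≈[]0 x zero    = T.≈[0] x
  ord≤-≈[]0 x (suc n) with p^ (suc n) ∣? residue x (suc n)
  ... | yes d = p^∣⇒≈[]0 d
  ... | no  _ = ord≤-≈[]0 x n

  -- Together with `ord≤-≈[]0` and `ord≤-≤` this characterises the truncated valuation by
  -- divisibility, which is how it is used from here on.
  ord≤-max : ∀ x n {j} → j ℕ.≤ n → x ≈[ j ] 0ᶻ → j ℕ.≤ ord≤ x n
  ord≤-max x zero    j≤0 _ = j≤0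
  ord≤-max x (suc n) j≤1+n x≈0 with p^ (suc n) ∣? residue x (suc n)
  ... | yes _ = j≤1+n
  ... | no ¬d with ℕ.m≤n⇒m<n∨m≡n j≤1+n
  ...   | inj₁ (ℕ.s≤s j≤n) = ord≤-max x n j≤n x≈0
  ...   | inj₂ refl        = contradiction (≈[]0⇒p^∣ {x} x≈0) ¬d

  ord≤<⇒≉0 : ∀ x {n} → ord≤ x n ℕ.< n → ¬ x ≈[ suc (ord≤ x n) ] 0ᶻ
  ord≤<⇒≉0 x {n} a<n x≈0 = ℕ.<⇒≱ (ℕ.n<1+n _) (ord≤-max x n a<n x≈0)

  -- Here and below, a product or sum t is specified by its residues, as t need not be judgmentally x *ᶻ y.

  ord≤-* : ∀ x y t → (∀ m → residue t m ≡ residue x m ℤ.* residue y m) → ∀ n → ord≤ t n ≡ (ord≤ x n ℕ.+ ord≤ y n) ℕ.⊓ n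
  ord≤-* x y t t≡xy n = ℕ.≤-antisym upper (ord≤-max t n (ℕ.m⊓n≤n (a ℕ.+ b) n) (≈[]-≤ {t} {0ᶻ} (ℕ.m⊓n≤m (a ℕ.+ b) n) t≈0))
    where
    a = ord≤ x n
    b = ord≤ y n
    t≈0 : t ≈[ a ℕ.+ b ] 0ᶻ
    t≈0 = level (mod-trans (mod-≡ (t≡xy (a ℕ.+ b))) (at (T.≈[]0-* {a} {b} {x} {y} (ord≤-≈[]0 x n) (ord≤-≈[]0 y n))))
    upper : ord≤ t n ℕ.≤ (a ℕ.+ b) ℕ.⊓ n
    upper with a ℕ.+ b ℕ.<? n
    ... | no  a+b≮n = ℕ.⊓-glb (ℕ.≤-trans (ord≤-≤ t n) (ℕ.≮⇒≥ a+b≮n)) (ord≤-≤ t n)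
    ... | yes a+b<n = ℕ.⊓-glb (ℕ.≮⇒≥ λ a+b<c → T.≉[]0-* {a} {b} {x} {y} (ord≤-≈[]0 x n)
        (ord≤<⇒≉0 x (ℕ.≤-<-trans (ℕ.m≤m+n a b) a+b<n)) (ord≤<⇒≉0 y (ℕ.≤-<-trans (ℕ.m≤n+m b a) a+b<n))
        (level (mod-trans (mod-≡ (sym (t≡xy (suc (a ℕ.+ b))))) (at (≈[]-≤ {t} {0ᶻ} a+b<c (ord≤-≈[]0 t n))))))
      (ord≤-≤ t n)

  -- The strong triangle inequality for x / pᵏ + y / pˡ: t is the numerator over pᵏ⁺ˡ, and n is
  -- where valuations are truncated.
  ord≤-+ : ∀ x y k l t → (∀ m → residue t m ≡ residue x m ℤ.* p^ l ℤ.+ residue y m ℤ.* p^ k) →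
           ∀ n → (ord≤ x n ℕ.+ l) ℕ.⊓ (ord≤ y n ℕ.+ k) ℕ.⊓ n ℕ.≤ ord≤ t n
  ord≤-+ x y k l t t≡ n = ord≤-max t n (ℕ.m⊓n≤n (a ℕ.⊓ b) n)
    (level (mod-trans (mod-≡ (t≡ (a ℕ.⊓ b ℕ.⊓ n))) (at (T.≈[]0-*+* {ord≤ x n} {ord≤ y n} {l} {k} {a ℕ.⊓ b ℕ.⊓ n} {x} {y} {pᶻ l} {pᶻ k}
      (ord≤-≈[]0 x n) (p^∣⇒≈[]0 {pᶻ l} {l} ℤ∣.∣-refl) (ord≤-≈[]0 y n) (p^∣⇒≈[]0 {pᶻ k} {k} ℤ∣.∣-refl)
      (ℕ.≤-trans (ℕ.m⊓n≤m (a ℕ.⊓ b) n) (ℕ.m⊓n≤m a b)) (ℕ.≤-trans (ℕ.m⊓n≤m (a ℕ.⊓ b) n) (ℕ.m⊓n≤n a b))))))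
    where
    a = ord≤ x n ℕ.+ l
    b = ord≤ y n ℕ.+ k

  -- Equality of the fractions x / pᵏ and y / pˡ means that ord x + l = ord y + k. Truncation leaves
  -- this inequality capped at n, to be used in both directions.
  ord≤-cross : ∀ {x y} k l → (∀ m → residue x m ℤ.* p^ l ≡ residue y m ℤ.* p^ k mod-p^ m) →
               ∀ n → (ord≤ y n ℕ.+ k) ℕ.⊓ n ℕ.≤ ord≤ x n ℕ.+ l
  ord≤-cross {x} {y} k l xl≡yk n = [ (λ l≤c → subst (ℕ._≤ ord≤ x n ℕ.+ l) (ℕ.m∸n+n≡m l≤c) (ℕ.+-monoˡ-≤ l
      (ord≤-max x n (ℕ.≤-trans (ℕ.m∸n≤m c l) (ℕ.m⊓n≤n (ord≤ y n ℕ.+ k) n))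
        (T.≈[]0-cross {ord≤ y n} {c} {x} {y} k l (mk≈ᶻ xl≡yk) (ord≤-≈[]0 y n) l≤c (ℕ.m⊓n≤m (ord≤ y n ℕ.+ k) n)))))
    , (λ c≤l → ℕ.≤-trans c≤l (ℕ.m≤n+m l (ord≤ x n))) ]′ (ℕ.≤-total l c)
    where
    c = (ord≤ y n ℕ.+ k) ℕ.⊓ n

  -- Rational powers of p

  /-* : ∀ i j m n .{{_ : ℕ.NonZero m}} .{{_ : ℕ.NonZero n}} →
        (i ℚ./ m) ℚ.* (j ℚ./ n) ≡ ℚ._/_ (i ℤ.* j) (m ℕ.* n) {{ℕ.m*n≢0 m n}}
  /-* i j (suc m) (suc n) = ℚ.toℚᵘ-injective
    (ℚᵘ.≃-trans (ℚ.toℚᵘ-homo-* (i ℚ./ suc m) (j ℚ./ suc n))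
    (ℚᵘ.≃-trans (ℚᵘ.*-cong (ℚ.toℚᵘ-fromℚᵘ (ℚᵘ.mkℚᵘ i m)) (ℚ.toℚᵘ-fromℚᵘ (ℚᵘ.mkℚᵘ j n)))
      (ℚᵘ.≃-sym (ℚ.toℚᵘ-fromℚᵘ (ℚᵘ.mkℚᵘ (i ℤ.* j) (n ℕ.+ m ℕ.* suc n))))))

  p^-+ᵠ : ∀ a b → p^- (a ℕ.+ b) ≡ p^- a ℚ.* p^- b
  p^-+ᵠ a b = sym (trans (/-* (+ 1) (+ 1) (p ℕ.^ a) (p ℕ.^ b) {{p^n≢0 a}} {{p^n≢0 b}})
    (ℚ./-cong {+ 1} {p ℕ.^ a ℕ.* p ℕ.^ b} {+ 1} {p ℕ.^ (a ℕ.+ b)} {{ℕ.m*n≢0 (p ℕ.^ a) (p ℕ.^ b) {{p^n≢0 a}} {{p^n≢0 b}}}} {{p^n≢0 (a ℕ.+ b)}} refl (sym (ℕ.^-distribˡ-+-* p a b))))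

  opaque
    P : ℕ → ℚ
    P k = p^ k ℚ./ 1

    P-+ : ∀ k l → P (k ℕ.+ l) ≡ P k ℚ.* P l
    P-+ k l = sym (trans (/-* (p^ k) (p^ l) 1 1) (cong (λ i → i ℚ./ 1) (sym (p^-+ k l))))

    P*p^- : ∀ k → P k ℚ.* p^- k ≡ 1ℚ
    P*p^- k = trans (/-* (p^ k) (+ 1) 1 (p ℕ.^ k) {{_}} {{p^n≢0 k}})
      (trans (ℚ./-cong {p^ k ℤ.* + 1} {1 ℕ.* p ℕ.^ k} {p^ k} {p ℕ.^ k} {{ℕ.m*n≢0 1 (p ℕ.^ k) {{_}} {{p^n≢0 k}}}} {{p^n≢0 k}} (ℤ.*-identityʳ (p^ k)) (ℕ.*-identityˡ (p ℕ.^ k))) (n/n≡1 (p ℕ.^ k) {{p^n≢0 k}}))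
      where
      n/n≡1 : ∀ n .{{_ : ℕ.NonZero n}} → + n ℚ./ n ≡ 1ℚ
      n/n≡1 (suc n) = ℚ.toℚᵘ-injective (ℚᵘ.≃-trans (ℚ.toℚᵘ-fromℚᵘ (ℚᵘ.mkℚᵘ (+ suc n) n)) (ℚᵘ.*≡* (ℤ.*-comm (+ suc n) (+ 1))))

    0≤P : ∀ k → 0ℚ ℚ.≤ P k
    0≤P k = ℚ.nonNegative⁻¹ (P k) {{nonneg (p ℕ.^ k)}}
      where
      nonneg : ∀ n → ℚ.NonNegative (+ n ℚ./ 1)
      nonneg n = ℚ.normalize-nonNeg n 1

    P-def : ∀ k → p^ k ℚ./ 1 ≡ P k
    P-def k = refl

  P*p^-+ : ∀ k a → P k ℚ.* p^- (k ℕ.+ a) ≡ p^- a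
  P*p^-+ k a = trans (cong (P k ℚ.*_) (p^-+ᵠ k a)) (trans (sym (ℚ.*-assoc (P k) (p^- k) (p^- a)))
    (trans (cong (ℚ._* p^- a) (P*p^- k)) (ℚ.*-identityˡ (p^- a))))

  P*p^-∸ : ∀ k n → k ℕ.≤ n → P k ℚ.* p^- n ≡ p^- (n ℕ.∸ k)
  P*p^-∸ k n k≤n = trans (cong (λ m → P k ℚ.* p^- m) (sym (ℕ.m+[n∸m]≡n k≤n))) (P*p^-+ k (n ℕ.∸ k))

  P*-mono : ∀ k {a b} → a ℚ.≤ b → P k ℚ.* a ℚ.≤ P k ℚ.* b
  P*-mono k = ℚ.*-monoˡ-≤-nonNeg (P k) {{ℚ.nonNegative (0≤P k)}}

  p^-≤1 : ∀ k → p^- k ℚ.≤ 1ℚ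
  p^-≤1 k = p^-antitone {0} {k} ℕ.z≤n

  1≤P : ∀ k → 1ℚ ℚ.≤ P k
  1≤P k = ℚ.≤-trans (ℚ.≤-reflexive (sym (P*p^- k))) (ℚ.≤-trans (P*-mono k (p^-≤1 k)) (ℚ.≤-reflexive (ℚ.*-identityʳ (P k))))

  p^-<⇒≤ : ∀ {a b} → p^- a ℚ.< p^- b → b ℕ.≤ a
  p^-<⇒≤ {a} {b} lt = ℕ.≮⇒≥ λ a<b → ℚ.<-irrefl refl (ℚ.<-≤-trans lt (p^-antitone {a} {b} (ℕ.<⇒≤ a<b)))

  p^-small : ∀ ε → 0ℚ ℚ.< ε → ∀ {n} → ℚ.↧ₙ ε ℕ.≤ n → p^- n ℚ.< ε
  p^-small ε 0<ε {n} N≤n = ℚ.≤-<-trans (p^-antitone {ℚ.↧ₙ ε} {n} N≤n) (1/<ε ε 0<ε (p ℕ.^ N) {{p^n≢0 N}} (n<p^n N))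
    where N = ℚ.↧ₙ ε

  p^-⊓ : ∀ a b → p^- (a ℕ.⊓ b) ℚ.≤ p^- a ℚ.+ p^- b
  p^-⊓ a b = [ (λ a≤b → subst (λ m → p^- m ℚ.≤ p^- a ℚ.+ p^- b) (sym (ℕ.m≤n⇒m⊓n≡m a≤b))
                   (ℚ.≤-trans (ℚ.≤-reflexive (sym (ℚ.+-identityʳ (p^- a)))) (ℚ.+-monoʳ-≤ (p^- a) (0≤p^- b))))
             , (λ b≤a → subst (λ m → p^- m ℚ.≤ p^- a ℚ.+ p^- b) (sym (ℕ.m≥n⇒m⊓n≡n b≤a))
                   (ℚ.≤-trans (ℚ.≤-reflexive (sym (ℚ.+-identityˡ (p^- b)))) (ℚ.+-monoˡ-≤ (p^- b) (0≤p^- a)))) ]′ (ℕ.≤-total a b)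

  x<x+ε : ∀ x {ε} → 0ℚ ℚ.< ε → x ℚ.< x ℚ.+ ε
  x<x+ε x {ε} 0<ε = subst (ℚ._< x ℚ.+ ε) (ℚ.+-identityʳ x) (ℚ.+-monoʳ-< x 0<ε)

  -- The form in which errors arise: truncation at n costs p⁻ⁿ, and denominators with product pᵏ
  -- magnify this to pᵏ⁻ⁿ, which still tends to 0.
  ≤ᴿ-from : ∀ x y k → (∀ n → k ℕ.≤ n → approx x n ℚ.≤ approx y n ℚ.+ p^- (n ℕ.∸ k)) → x ≤ᴿ y
  ≤ᴿ-from x y k h ε 0<ε = k ℕ.+ ℚ.↧ₙ ε , λ n N≤n → ℚ.≤-<-trans (h n (ℕ.≤-trans (ℕ.m≤m+n k (ℚ.↧ₙ ε)) N≤n))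
    (ℚ.+-monoʳ-< (approx y n) (p^-small ε 0<ε (ℕ.≤-trans (ℕ.≤-reflexive (sym (ℕ.m+n∸m≡n k (ℚ.↧ₙ ε)))) (ℕ.∸-monoˡ-≤ k N≤n))))

  ≃ᴿ-from : ∀ x y k → (∀ n → k ℕ.≤ n → ∣ approx x n ℚ.- approx y n ∣ ℚ.≤ p^- (n ℕ.∸ k)) → x ≃ᴿ y
  ≃ᴿ-from x y k h ε 0<ε = k ℕ.+ ℚ.↧ₙ ε , λ n N≤n → ℚ.≤-<-trans (h n (ℕ.≤-trans (ℕ.m≤m+n k (ℚ.↧ₙ ε)) N≤n))
    (p^-small ε 0<ε (ℕ.≤-trans (ℕ.≤-reflexive (sym (ℕ.m+n∸m≡n k (ℚ.↧ₙ ε)))) (ℕ.∸-monoˡ-≤ k N≤n)))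

  ∣-∣≤ : ∀ a b δ → a ℚ.≤ b ℚ.+ δ → b ℚ.≤ a ℚ.+ δ → ∣ a ℚ.- b ∣ ℚ.≤ δ
  ∣-∣≤ a b δ a≤ b≤ with ℚ.∣p∣≡p∨∣p∣≡-p (a ℚ.- b)
  ... | inj₁ eq = subst (ℚ._≤ δ) (sym eq) (subst (a ℚ.- b ℚ.≤_) (cancel b δ) (ℚ.+-monoˡ-≤ (ℚ.- b) a≤))
    where
    cancel : ∀ b δ → b ℚ.+ δ ℚ.- b ≡ δ
    cancel = solve 2 (λ b δ → b :+ δ :- b := δ) refl
      where open +-*-Solver
  ... | inj₂ eq = subst (ℚ._≤ δ) (sym (trans eq (flip a b))) (subst (b ℚ.- a ℚ.≤_) (cancel a δ) (ℚ.+-monoˡ-≤ (ℚ.- a) b≤))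
    where
    cancel : ∀ b δ → b ℚ.+ δ ℚ.- b ≡ δ
    cancel = solve 2 (λ b δ → b :+ δ :- b := δ) refl
      where open +-*-Solver
    flip : ∀ a b → ℚ.- (a ℚ.- b) ≡ b ℚ.- a
    flip = solve 2 (λ a b → :- (a :- b) := b :- a) refl
      where open +-*-Solver

  -- The absolute value of ℚₚ

  P-split : ∀ k l a → P (k ℕ.+ l) ℚ.* p^- (a ℕ.+ l) ≡ P k ℚ.* p^- a
  P-split k l a = trans (cong₂ ℚ._*_ (P-+ k l) (cong p^- (ℕ.+-comm a l)))
    (trans (ℚ.*-assoc (P k) (P l) (p^- (l ℕ.+ a))) (cong (P k ℚ.*_) (P*p^-+ l a)))

  -- After pᵏ⁺ˡ is taken out of both sides the exponents can be compared; the cap at n contributes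
  -- the last summand.
  scaled-≤ : ∀ {a b k l n} → k ℕ.+ l ℕ.≤ n → (b ℕ.+ k) ℕ.⊓ n ℕ.≤ a ℕ.+ l →
             P k ℚ.* p^- a ℚ.≤ P l ℚ.* p^- b ℚ.+ p^- (n ℕ.∸ (k ℕ.+ l))
  scaled-≤ {a} {b} {k} {l} {n} k+l≤n lower = begin
    P k ℚ.* p^- a                                             ≡⟨ P-split k l a ⟨
    P (k ℕ.+ l) ℚ.* p^- (a ℕ.+ l)                             ≤⟨ P*-mono (k ℕ.+ l) (p^-antitone {(b ℕ.+ k) ℕ.⊓ n} {a ℕ.+ l} lower) ⟩
    P (k ℕ.+ l) ℚ.* p^- ((b ℕ.+ k) ℕ.⊓ n)                     ≤⟨ P*-mono (k ℕ.+ l) (p^-⊓ (b ℕ.+ k) n) ⟩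
    P (k ℕ.+ l) ℚ.* (p^- (b ℕ.+ k) ℚ.+ p^- n)                 ≡⟨ ℚ.*-distribˡ-+ (P (k ℕ.+ l)) (p^- (b ℕ.+ k)) (p^- n) ⟩
    P (k ℕ.+ l) ℚ.* p^- (b ℕ.+ k) ℚ.+ P (k ℕ.+ l) ℚ.* p^- n   ≡⟨ cong₂ ℚ._+_ (trans (cong (λ i → P i ℚ.* p^- (b ℕ.+ k)) (ℕ.+-comm k l)) (P-split l k b)) (P*p^-∸ (k ℕ.+ l) n k+l≤n) ⟩
    P l ℚ.* p^- b ℚ.+ p^- (n ℕ.∸ (k ℕ.+ l))                   ∎
    where open ℚ.≤-Reasoning

  scaled-triangle : ∀ {a b c k l n} → k ℕ.+ l ℕ.≤ n → (a ℕ.+ l) ℕ.⊓ (b ℕ.+ k) ℕ.⊓ n ℕ.≤ c →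
                    P (k ℕ.+ l) ℚ.* p^- c ℚ.≤ P k ℚ.* p^- a ℚ.+ P l ℚ.* p^- b ℚ.+ p^- (n ℕ.∸ (k ℕ.+ l))
  scaled-triangle {a} {b} {c} {k} {l} {n} k+l≤n lower = begin
    P (k ℕ.+ l) ℚ.* p^- c                                               ≤⟨ P*-mono (k ℕ.+ l) (p^-antitone {(a ℕ.+ l) ℕ.⊓ (b ℕ.+ k) ℕ.⊓ n} {c} lower) ⟩
    P (k ℕ.+ l) ℚ.* p^- ((a ℕ.+ l) ℕ.⊓ (b ℕ.+ k) ℕ.⊓ n)                 ≤⟨ P*-mono (k ℕ.+ l) (ℚ.≤-trans (p^-⊓ ((a ℕ.+ l) ℕ.⊓ (b ℕ.+ k)) n) (ℚ.+-monoˡ-≤ (p^- n) (p^-⊓ (a ℕ.+ l) (b ℕ.+ k)))) ⟩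
    P (k ℕ.+ l) ℚ.* (p^- (a ℕ.+ l) ℚ.+ p^- (b ℕ.+ k) ℚ.+ p^- n)         ≡⟨ distrib (P (k ℕ.+ l)) (p^- (a ℕ.+ l)) (p^- (b ℕ.+ k)) (p^- n) ⟩
    P (k ℕ.+ l) ℚ.* p^- (a ℕ.+ l) ℚ.+ P (k ℕ.+ l) ℚ.* p^- (b ℕ.+ k) ℚ.+ P (k ℕ.+ l) ℚ.* p^- n
      ≡⟨ cong₂ ℚ._+_ (cong₂ ℚ._+_ (P-split k l a) (trans (cong (λ i → P i ℚ.* p^- (b ℕ.+ k)) (ℕ.+-comm k l)) (P-split l k b))) (P*p^-∸ (k ℕ.+ l) n k+l≤n) ⟩
    P k ℚ.* p^- a ℚ.+ P l ℚ.* p^- b ℚ.+ p^- (n ℕ.∸ (k ℕ.+ l))           ∎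
    where
    open ℚ.≤-Reasoning
    distrib : ∀ p a b c → p ℚ.* (a ℚ.+ b ℚ.+ c) ≡ p ℚ.* a ℚ.+ p ℚ.* b ℚ.+ p ℚ.* c
    distrib = solve 4 (λ p a b c → p :* (a :+ b :+ c) := p :* a :+ p :* b :+ p :* c) refl
      where open +-*-Solver

  p^-⊓-close : ∀ s n → ∣ p^- (s ℕ.⊓ n) ℚ.- p^- s ∣ ℚ.≤ p^- n
  p^-⊓-close s n = [ (λ s≤n → p^-close {n} {s ℕ.⊓ n} {s} (inj₁ (ℕ.m≤n⇒m⊓n≡m s≤n)))
    , (λ n≤s → subst (λ c → ∣ p^- c ℚ.- p^- s ∣ ℚ.≤ p^- n) (sym (ℕ.m≥n⇒m⊓n≡n n≤s))
        (subst (ℚ._≤ p^- n) (∣-∣-comm (p^- s) (p^- n)) (0≤a≤b⇒∣a-b∣≤b (p^- s) (p^- n) (0≤p^- s) (p^-antitone {n} {s} n≤s)))) ]′ (ℕ.≤-total s n)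

  scaled-* : ∀ {a b c k l n} → k ℕ.+ l ℕ.≤ n → c ≡ (a ℕ.+ b) ℕ.⊓ n →
             ∣ P (k ℕ.+ l) ℚ.* p^- c ℚ.- (P k ℚ.* p^- a) ℚ.* (P l ℚ.* p^- b) ∣ ℚ.≤ p^- (n ℕ.∸ (k ℕ.+ l))
  scaled-* {a} {b} {c} {k} {l} {n} k+l≤n refl = begin
    ∣ P (k ℕ.+ l) ℚ.* p^- c ℚ.- (P k ℚ.* p^- a) ℚ.* (P l ℚ.* p^- b) ∣   ≡⟨ cong (λ t → ∣ t ℚ.* p^- c ℚ.- (P k ℚ.* p^- a) ℚ.* (P l ℚ.* p^- b) ∣) (P-+ k l) ⟩
    ∣ P k ℚ.* P l ℚ.* p^- c ℚ.- (P k ℚ.* p^- a) ℚ.* (P l ℚ.* p^- b) ∣   ≡⟨ cong ∣_∣ (factor (P k) (P l) (p^- c) (p^- a) (p^- b)) ⟩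
    ∣ P k ℚ.* P l ℚ.* (p^- c ℚ.- p^- a ℚ.* p^- b) ∣                     ≡⟨ cong₂ (λ t u → ∣ t ℚ.* (p^- c ℚ.- u) ∣) (P-+ k l) (p^-+ᵠ a b) ⟨
    ∣ P (k ℕ.+ l) ℚ.* (p^- c ℚ.- p^- (a ℕ.+ b)) ∣                       ≡⟨ ℚ.∣p*q∣≡∣p∣*∣q∣ (P (k ℕ.+ l)) (p^- c ℚ.- p^- (a ℕ.+ b)) ⟩
    ∣ P (k ℕ.+ l) ∣ ℚ.* ∣ p^- c ℚ.- p^- (a ℕ.+ b) ∣                     ≡⟨ cong (ℚ._* ∣ p^- c ℚ.- p^- (a ℕ.+ b) ∣) (ℚ.0≤p⇒∣p∣≡p (0≤P (k ℕ.+ l))) ⟩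
    P (k ℕ.+ l) ℚ.* ∣ p^- c ℚ.- p^- (a ℕ.+ b) ∣                         ≤⟨ P*-mono (k ℕ.+ l) (p^-⊓-close (a ℕ.+ b) n) ⟩
    P (k ℕ.+ l) ℚ.* p^- n                                               ≡⟨ P*p^-∸ (k ℕ.+ l) n k+l≤n ⟩
    p^- (n ℕ.∸ (k ℕ.+ l))                                               ∎
    where
    open ℚ.≤-Reasoning
    factor : ∀ a b c d e → a ℚ.* b ℚ.* c ℚ.- (a ℚ.* d) ℚ.* (b ℚ.* e) ≡ a ℚ.* b ℚ.* (c ℚ.- d ℚ.* e)
    factor = solve 5 (λ a b c d e → a :* b :* c :- (a :* d) :* (b :* e) := a :* b :* (c :- d :* e)) refl
      where open +-*-Solver

  0≤scaled : ∀ k a → 0ℚ ℚ.≤ P k ℚ.* p^- a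
  0≤scaled k a = ℚ.≤-trans (ℚ.≤-reflexive (sym (ℚ.*-zeroʳ (P k)))) (P*-mono k (0≤p^- a))

  p^-≤scaled : ∀ k a → p^- a ℚ.≤ ∣ P k ℚ.* p^- a ℚ.- 0ℚ ∣
  p^-≤scaled k a = begin
    p^- a                       ≡⟨ ℚ.*-identityˡ (p^- a) ⟨
    1ℚ ℚ.* p^- a                ≤⟨ ℚ.*-monoʳ-≤-nonNeg (p^- a) {{ℚ.nonNegative (0≤p^- a)}} (1≤P k) ⟩
    P k ℚ.* p^- a               ≡⟨ ℚ.0≤p⇒∣p∣≡p (0≤scaled k a) ⟨
    ∣ P k ℚ.* p^- a ∣           ≡⟨ cong ∣_∣ (ℚ.+-identityʳ (P k ℚ.* p^- a)) ⟨
    ∣ P k ℚ.* p^- a ℚ.- 0ℚ ∣    ∎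
    where open ℚ.≤-Reasoning

  ∣∣ᵠ-approx : ∀ x n → approx ∣ x ∣ᵠ n ≡ P (exp x) ℚ.* p^- (ord≤ (num x) n)
  ∣∣ᵠ-approx x n = cong (ℚ._* p^- (ord≤ (num x) n)) (P-def (exp x))

  ∣∣ᵠ-≤ : ∀ x y → x ≈ᵠ y → ∀ n → exp x ℕ.+ exp y ℕ.≤ n →
          approx ∣ x ∣ᵠ n ℚ.≤ approx ∣ y ∣ᵠ n ℚ.+ p^- (n ℕ.∸ (exp x ℕ.+ exp y))
  ∣∣ᵠ-≤ x y e n k+l≤n = subst₂ (λ u v → u ℚ.≤ v ℚ.+ p^- (n ℕ.∸ (exp x ℕ.+ exp y))) (sym (∣∣ᵠ-approx x n)) (sym (∣∣ᵠ-approx y n))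
    (scaled-≤ {ord≤ (num x) n} {ord≤ (num y) n} {exp x} {exp y} k+l≤n (ord≤-cross {num x} {num y} (exp x) (exp y) (λ m → mod (cross e) m) n))

  ∣∣ᵠ-cong : ∀ x y → x ≈ᵠ y → ∣ x ∣ᵠ ≃ᴿ ∣ y ∣ᵠ
  ∣∣ᵠ-cong x y e = ≃ᴿ-from ∣ x ∣ᵠ ∣ y ∣ᵠ (exp x ℕ.+ exp y) λ n k+l≤n →
    ∣-∣≤ (approx ∣ x ∣ᵠ n) (approx ∣ y ∣ᵠ n) (p^- (n ℕ.∸ (exp x ℕ.+ exp y))) (∣∣ᵠ-≤ x y e n k+l≤n)
      (subst (λ m → approx ∣ y ∣ᵠ n ℚ.≤ approx ∣ x ∣ᵠ n ℚ.+ p^- (n ℕ.∸ m)) (ℕ.+-comm (exp y) (exp x))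
        (∣∣ᵠ-≤ y x (≈ᵠ-sym {x} {y} e) n (subst (ℕ._≤ n) (ℕ.+-comm (exp x) (exp y)) k+l≤n)))

  -- A single approximation below p⁻ᴹ shows that pᴹ divides the numerator, because the factor from
  -- the denominator is at least 1 and only enlarges the value.
  ∣∣ᵠ-definite : ∀ x → ∣ x ∣ᵠ ≃ᴿ 0ᴿ → x ≈ᵠ 0ᵠ
  ∣∣ᵠ-definite x small = mk≈ᵠ (mk≈ᶻ λ M → mod-trans (mod-* (at (vanish M)) (mod-≡ refl)) (mod-≡ refl))
    where
    vanish : ∀ M → num x ≈[ M ] 0ᶻ
    vanish M with small (p^- M) (0<1/ (p ℕ.^ M) {{p^n≢0 M}})
    ... | N , h = ≈[]-≤ {num x} {0ᶻ} (p^-<⇒≤ {ord≤ (num x) N} {M} (ℚ.≤-<-trans (p^-≤scaled (exp x) (ord≤ (num x) N))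
        (subst (λ t → ∣ t ℚ.- 0ℚ ∣ ℚ.< p^- M) (∣∣ᵠ-approx x N) (h N ℕ.≤-refl)))) (ord≤-≈[]0 (num x) N)

  ∣∣ᵠ-* : ∀ x y → ∣ x *ᵠ y ∣ᵠ ≃ᴿ ∣ x ∣ᵠ *ᴿ ∣ y ∣ᵠ
  ∣∣ᵠ-* x y = ≃ᴿ-from ∣ x *ᵠ y ∣ᵠ (∣ x ∣ᵠ *ᴿ ∣ y ∣ᵠ) (exp x ℕ.+ exp y) λ n k+l≤n →
    subst₂ (λ u v → ∣ u ℚ.- v ∣ ℚ.≤ p^- (n ℕ.∸ (exp x ℕ.+ exp y)))
      (sym (∣∣ᵠ-approx (x *ᵠ y) n)) (sym (cong₂ ℚ._*_ (∣∣ᵠ-approx x n) (∣∣ᵠ-approx y n)))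
      (scaled-* {ord≤ (num x) n} {ord≤ (num y) n} {ord≤ (num (x *ᵠ y)) n} {exp x} {exp y} k+l≤n (ord≤-* (num x) (num y) (num (x *ᵠ y)) (λ _ → refl) n))

  ∣∣ᵠ-triangle : ∀ x y → ∣ x +ᵠ y ∣ᵠ ≤ᴿ ∣ x ∣ᵠ +ᴿ ∣ y ∣ᵠ
  ∣∣ᵠ-triangle x y = ≤ᴿ-from ∣ x +ᵠ y ∣ᵠ (∣ x ∣ᵠ +ᴿ ∣ y ∣ᵠ) (exp x ℕ.+ exp y) λ n k+l≤n →
    subst₂ (λ u v → u ℚ.≤ v ℚ.+ p^- (n ℕ.∸ (exp x ℕ.+ exp y)))
      (sym (∣∣ᵠ-approx (x +ᵠ y) n)) (sym (cong₂ ℚ._+_ (∣∣ᵠ-approx x n) (∣∣ᵠ-approx y n)))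
      (scaled-triangle {ord≤ (num x) n} {ord≤ (num y) n} {ord≤ (num (x +ᵠ y)) n} {exp x} {exp y} k+l≤n
        (ord≤-+ (num x) (num y) (exp x) (exp y) (num (x +ᵠ y)) (λ _ → refl) n))

  ℚₚ-absoluteValue : AbsoluteValue ℚₚ-extension
  ℚₚ-absoluteValue = record
    { ∥_∥      = ∣_∣ᵠ
    ; cong-∥∥  = λ {x} {y} → ∣∣ᵠ-cong x y
    ; nonNeg   = λ x ε 0<ε → 0 , λ n _ → ℚ.≤-<-trans (subst (0ℚ ℚ.≤_) (sym (∣∣ᵠ-approx x n)) (0≤scaled (exp x) (ord≤ (num x) n))) (x<x+ε (approx ∣ x ∣ᵠ n) 0<ε)
    ; definite = ∣∣ᵠ-definite
    ; mult     = ∣∣ᵠ-*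
    ; triangle = ∣∣ᵠ-triangle
    ; extends  = λ x ε 0<ε → 0 , λ n _ → subst (ℚ._< ε) (sym (cong ∣_∣ (ℚ.+-inverseʳ (approx ∣ x ∣ᵠ n)))) 0<ε
    }

  -- Geometric decay

  infixr 8 _^ℚ_

  _^ℚ_ : ℚ → ℕ → ℚ
  d ^ℚ zero  = 1ℚ
  d ^ℚ suc n = d ℚ.* d ^ℚ n

  ^ℚ-+ : ∀ d m n → d ^ℚ (m ℕ.+ n) ≡ d ^ℚ m ℚ.* d ^ℚ n
  ^ℚ-+ d zero    n = sym (ℚ.*-identityˡ (d ^ℚ n))
  ^ℚ-+ d (suc m) n = trans (cong (d ℚ.*_) (^ℚ-+ d m n)) (sym (ℚ.*-assoc d (d ^ℚ m) (d ^ℚ n)))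

  approx-^ᴿ : ∀ d n i → approx (fromℚ d ^ᴿ n) i ≡ d ^ℚ n
  approx-^ᴿ d zero    i = refl
  approx-^ᴿ d (suc n) i = cong (d ℚ.*_) (approx-^ᴿ d n i)

  *-mono-≤ : ∀ {a b c d} → 0ℚ ℚ.≤ a → 0ℚ ℚ.≤ d → a ℚ.≤ b → c ℚ.≤ d → a ℚ.* c ℚ.≤ b ℚ.* d
  *-mono-≤ {a} {b} {c} {d} 0≤a 0≤d a≤b c≤d = ℚ.≤-trans (ℚ.*-monoˡ-≤-nonNeg a {{ℚ.nonNegative 0≤a}} c≤d)
    (ℚ.*-monoʳ-≤-nonNeg d {{ℚ.nonNegative 0≤d}} a≤b)

  0≤* : ∀ {a b} → 0ℚ ℚ.≤ a → 0ℚ ℚ.≤ b → 0ℚ ℚ.≤ a ℚ.* b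
  0≤* {a} {b} 0≤a 0≤b = subst (ℚ._≤ a ℚ.* b) (ℚ.*-zeroʳ a) (ℚ.*-monoˡ-≤-nonNeg a {{ℚ.nonNegative 0≤a}} 0≤b)

  0≤^ℚ : ∀ {d} n → 0ℚ ℚ.≤ d → 0ℚ ℚ.≤ d ^ℚ n
  0≤^ℚ zero    0≤d = ℚ.nonNegative⁻¹ 1ℚ
  0≤^ℚ (suc n) 0≤d = 0≤* 0≤d (0≤^ℚ n 0≤d)

  ^ℚ≤1 : ∀ {d} n → 0ℚ ℚ.≤ d → d ℚ.≤ 1ℚ → d ^ℚ n ℚ.≤ 1ℚ
  ^ℚ≤1 zero    0≤d d≤1 = ℚ.≤-refl
  ^ℚ≤1 {d} (suc n) 0≤d d≤1 = *-mono-≤ {d} {1ℚ} {d ^ℚ n} {1ℚ} 0≤d (ℚ.nonNegative⁻¹ 1ℚ) d≤1 (^ℚ≤1 n 0≤d d≤1)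

  -- Averaging with 1 at least takes the square root, since ((1 + a)/2)² - a = ((1 - a)/2)².
  root-below-1 : ∀ N {a} → 0ℚ ℚ.≤ a → a ℚ.< 1ℚ → ∃ λ d → a ℚ.≤ d × d ℚ.< 1ℚ × a ℚ.≤ d ^ℚ N
  root-below-1 zero    {a} 0≤a a<1 = a , ℚ.≤-refl , a<1 , ℚ.<⇒≤ a<1
  root-below-1 (suc N) {a} 0≤a a<1 = extend (root-below-1 N {b} 0≤b b<1)
    where
    b h : ℚ
    b = ½ ℚ.* (1ℚ ℚ.+ a)
    h = ½ ℚ.* (1ℚ ℚ.- a)
    b≡a+h : ∀ a → ½ ℚ.* (1ℚ ℚ.+ a) ≡ a ℚ.+ ½ ℚ.* (1ℚ ℚ.- a)
    b≡a+h = solve 1 (λ a → con ½ :* (con 1ℚ :+ a) := a :+ con ½ :* (con 1ℚ :- a)) refl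
      where open +-*-Solver
    b+h≡1 : ∀ a → ½ ℚ.* (1ℚ ℚ.+ a) ℚ.+ ½ ℚ.* (1ℚ ℚ.- a) ≡ 1ℚ
    b+h≡1 = solve 1 (λ a → con ½ :* (con 1ℚ :+ a) :+ con ½ :* (con 1ℚ :- a) := con 1ℚ) refl
      where open +-*-Solver
    b²≡a+h² : ∀ a → ½ ℚ.* (1ℚ ℚ.+ a) ℚ.* (½ ℚ.* (1ℚ ℚ.+ a)) ≡ a ℚ.+ ½ ℚ.* (1ℚ ℚ.- a) ℚ.* (½ ℚ.* (1ℚ ℚ.- a))
    b²≡a+h² = solve 1 (λ a → con ½ :* (con 1ℚ :+ a) :* (con ½ :* (con 1ℚ :+ a)) := a :+ con ½ :* (con 1ℚ :- a) :* (con ½ :* (con 1ℚ :- a))) refl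
      where open +-*-Solver
    0<h : 0ℚ ℚ.< h
    0<h = 0<half (subst (ℚ._< 1ℚ ℚ.- a) (ℚ.+-inverseʳ a) (ℚ.+-monoˡ-< (ℚ.- a) a<1))
    x≤x+y : ∀ x {y} → 0ℚ ℚ.≤ y → x ℚ.≤ x ℚ.+ y
    x≤x+y x {y} 0≤y = subst (ℚ._≤ x ℚ.+ y) (ℚ.+-identityʳ x) (ℚ.+-monoʳ-≤ x 0≤y)
    a≤b : a ℚ.≤ b
    a≤b = subst (a ℚ.≤_) (sym (b≡a+h a)) (x≤x+y a (ℚ.<⇒≤ 0<h))
    0≤b : 0ℚ ℚ.≤ b
    0≤b = ℚ.≤-trans 0≤a a≤b
    b<1 : b ℚ.< 1ℚ
    b<1 = subst₂ ℚ._<_ (ℚ.+-identityʳ b) (b+h≡1 a) (ℚ.+-monoʳ-< b 0<h)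
    extend : (∃ λ d → b ℚ.≤ d × d ℚ.< 1ℚ × b ℚ.≤ d ^ℚ N) → ∃ λ d → a ℚ.≤ d × d ℚ.< 1ℚ × a ℚ.≤ d ^ℚ suc N
    extend (d , b≤d , d<1 , b≤d^N) = d , ℚ.≤-trans a≤b b≤d , d<1 ,
      ℚ.≤-trans (subst (a ℚ.≤_) (sym (b²≡a+h² a)) (x≤x+y a (0≤* (ℚ.<⇒≤ 0<h) (ℚ.<⇒≤ 0<h))))
        (*-mono-≤ 0≤b (ℚ.≤-trans 0≤b b≤d^N) b≤d b≤d^N)

  p^-1<1 : p^- 1 ℚ.< 1ℚ
  p^-1<1 = 1/<ε 1ℚ (ℚ.positive⁻¹ 1ℚ) (p ℕ.^ 1) {{p^n≢0 1}}
    (ℕ.<-≤-trans (ℕ.nonTrivial⇒n>1 p {{prime⇒nonTrivial p-prime}}) (ℕ.≤-reflexive (sym (ℕ.*-identityʳ p))))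

  -- A rational d with dᴺ ≥ 1/p takes the place of the N-th root of 1/p. Then d to the power kN is
  -- at least p⁻ᵏ, and a remainder r < N costs at most one more factor 1/p, which `P 1` = p
  -- compensates.
  decay : ∀ N .{{_ : ℕ.NonZero N}} → ∃ λ d → 0ℚ ℚ.≤ d × d ℚ.< 1ℚ × ∀ r k → r ℕ.< N → p^- k ℚ.≤ P 1 ℚ.* d ^ℚ (r ℕ.+ k ℕ.* N)
  decay N with root-below-1 N (0≤p^- 1) p^-1<1
  ... | d , p^-1≤d , d<1 , p^-1≤d^N = d , 0≤d , d<1 , λ r k r<N → bound-at r k r<N
    where
    0≤d : 0ℚ ℚ.≤ d
    0≤d = ℚ.≤-trans (0≤p^- 1) p^-1≤d
    multiple : ∀ k → p^- k ℚ.≤ d ^ℚ (k ℕ.* N)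
    multiple zero    = ℚ.≤-reflexive refl
    multiple (suc k) = subst₂ ℚ._≤_ (sym (p^-+ᵠ 1 k)) (sym (^ℚ-+ d N (k ℕ.* N)))
      (*-mono-≤ (0≤p^- 1) (0≤^ℚ (k ℕ.* N) 0≤d) p^-1≤d^N (multiple k))
    remainder : ∀ r → r ℕ.< N → p^- 1 ℚ.≤ d ^ℚ r
    remainder r r<N = ℚ.≤-trans p^-1≤d^N (subst (ℚ._≤ d ^ℚ r)
      (trans (sym (^ℚ-+ d r (N ℕ.∸ r))) (cong (d ^ℚ_) (ℕ.m+[n∸m]≡n (ℕ.<⇒≤ r<N))))
      (subst (d ^ℚ r ℚ.* d ^ℚ (N ℕ.∸ r) ℚ.≤_) (ℚ.*-identityʳ (d ^ℚ r))
        (*-mono-≤ (0≤^ℚ r 0≤d) (ℚ.nonNegative⁻¹ 1ℚ) ℚ.≤-refl (^ℚ≤1 (N ℕ.∸ r) 0≤d (ℚ.<⇒≤ d<1)))))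
    bound-at : ∀ r k → r ℕ.< N → p^- k ℚ.≤ P 1 ℚ.* d ^ℚ (r ℕ.+ k ℕ.* N)
    bound-at r k r<N = subst₂ ℚ._≤_ (P*p^-+ 1 k) (cong (P 1 ℚ.*_) (sym (^ℚ-+ d r (k ℕ.* N))))
      (P*-mono 1 (subst (ℚ._≤ d ^ℚ r ℚ.* d ^ℚ (k ℕ.* N)) (sym (p^-+ᵠ 1 k))
        (*-mono-≤ (0≤p^- 1) (0≤^ℚ (k ℕ.* N) 0≤d) (remainder r r<N) (multiple k))))

  -- A positive real exceeds some rational η > 0. With p⁻ᴹ < η/4, the number x is eventually below
  -- p⁻ᴹ + η/4 < η/2, which leaves the gap η/2 that strict inequality demands.
  small : ∀ ε → 0ᴿ <ᴿ ε → ∃ λ M → ∀ x → x ≤ᴿ fromℚ (p^- M) → x <ᴿ ε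
  small ε (η , 0<η , N₀ , ε-bound) = ℚ.↧ₙ h′ , λ x x≤ → h , 0<half 0<η , proj₁ (x≤ h′ 0<h′) ℕ.⊔ N₀ , λ n N≤n →
    ℚ.<-trans (ℚ.+-monoˡ-< h (ℚ.<-trans (proj₂ (x≤ h′ 0<h′) n (ℕ.≤-trans (ℕ.m≤m⊔n (proj₁ (x≤ h′ 0<h′)) N₀) N≤n))
        (subst (p^- (ℚ.↧ₙ h′) ℚ.+ h′ ℚ.<_) (half+half h) (ℚ.+-monoˡ-< h′ (p^-small h′ 0<h′ ℕ.≤-refl)))))
      (subst (ℚ._< approx ε n) (trans (ℚ.+-identityˡ η) (sym (half+half η))) (ε-bound n (ℕ.≤-trans (ℕ.m≤n⊔m (proj₁ (x≤ h′ 0<h′)) N₀) N≤n)))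
    where
    h h′ : ℚ
    h  = ½ ℚ.* η
    h′ = ½ ℚ.* h
    0<h′ : 0ℚ ℚ.< h′
    0<h′ = 0<half (0<half 0<η)

  -- Congruences and absolute values

  ∣∣ᶻ-≤ : ∀ x {M} → x ≈[ M ] 0ᶻ → ∀ n → M ℕ.≤ n → approx ∣ x ∣ᶻ n ℚ.≤ p^- M
  ∣∣ᶻ-≤ x {M} x≈0 n M≤n = p^-antitone {M} {ord≤ x n} (ord≤-max x n M≤n x≈0)

  ∣∣ᶻ-<⇒≈0 : ∀ x M → ∣ x ∣ᶻ <ᴿ fromℚ (p^- M) → x ≈[ M ] 0ᶻ
  ∣∣ᶻ-<⇒≈0 x M (η , 0<η , N , h) = ≈[]-≤ {x} {0ᶻ} (p^-<⇒≤ {ord≤ x N} {M}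
    (ℚ.<-trans (subst (ℚ._< p^- (ord≤ x N) ℚ.+ η) (ℚ.+-identityʳ (p^- (ord≤ x N))) (ℚ.+-monoʳ-< (p^- (ord≤ x N)) 0<η)) (h N ℕ.≤-refl)))
    (ord≤-≈[]0 x N)

  0<p^- : ∀ M → 0ᴿ <ᴿ fromℚ (p^- M)
  0<p^- M = ½ ℚ.* p^- M , 0<half 0<d , 0 , λ _ _ → subst₂ ℚ._<_ (sym (ℚ.+-identityˡ (½ ℚ.* p^- M))) (half+half (p^- M))
    (subst (ℚ._< ½ ℚ.* p^- M ℚ.+ ½ ℚ.* p^- M) (ℚ.+-identityʳ (½ ℚ.* p^- M)) (ℚ.+-monoʳ-< (½ ℚ.* p^- M) (0<half 0<d)))
    where
    0<d : 0ℚ ℚ.< p^- M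
    0<d = 0<1/ (p ℕ.^ M) {{p^n≢0 M}}

  fromℚ-< : ∀ {a b} → a ℚ.< b → fromℚ a <ᴿ fromℚ b
  fromℚ-< {a} {b} a<b = ½ ℚ.* (b ℚ.- a) , 0<h , 0 , λ _ _ → subst (a ℚ.+ ½ ℚ.* (b ℚ.- a) ℚ.<_) (eq a b) (x<x+ε (a ℚ.+ ½ ℚ.* (b ℚ.- a)) 0<h)
    where
    0<h : 0ℚ ℚ.< ½ ℚ.* (b ℚ.- a)
    0<h = 0<half (subst (ℚ._< b ℚ.- a) (ℚ.+-inverseʳ a) (ℚ.+-monoˡ-< (ℚ.- a) a<b))
    eq : ∀ a b → a ℚ.+ ½ ℚ.* (b ℚ.- a) ℚ.+ ½ ℚ.* (b ℚ.- a) ≡ b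
    eq = solve 2 (λ a b → a :+ con ½ :* (b :- a) :+ con ½ :* (b :- a) := b) refl
      where open +-*-Solver

  ≤ᴿ-fromℚ : ∀ x c N → (∀ n → N ℕ.≤ n → approx x n ℚ.≤ c) → x ≤ᴿ fromℚ c
  ≤ᴿ-fromℚ x c N h ε 0<ε = N , λ n N≤n → ℚ.≤-<-trans (h n N≤n) (x<x+ε c 0<ε)

  ≃ᴿ-≤ᴿ-trans : ∀ x y c → x ≃ᴿ y → y ≤ᴿ fromℚ c → x ≤ᴿ fromℚ c
  ≃ᴿ-≤ᴿ-trans x y c x≃y y≤c ε 0<ε = proj₁ (x≃y h 0<h) ℕ.⊔ proj₁ (y≤c h 0<h) , λ n N≤n →
    ℚ.≤-<-trans (ℚ.≤-trans (ℚ.≤-reflexive (split (approx x n) (approx y n))) (ℚ.+-monoˡ-≤ (approx y n) (p≤∣p∣ (approx x n ℚ.- approx y n))))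
      (subst (∣ approx x n ℚ.- approx y n ∣ ℚ.+ approx y n ℚ.<_) (combine ε c)
        (ℚ.+-mono-< (proj₂ (x≃y h 0<h) n (ℕ.≤-trans (ℕ.m≤m⊔n (proj₁ (x≃y h 0<h)) (proj₁ (y≤c h 0<h))) N≤n))
                    (proj₂ (y≤c h 0<h) n (ℕ.≤-trans (ℕ.m≤n⊔m (proj₁ (x≃y h 0<h)) (proj₁ (y≤c h 0<h))) N≤n))))
    where
    h = ½ ℚ.* ε
    0<h : 0ℚ ℚ.< h
    0<h = 0<half 0<ε
    split : ∀ a b → a ≡ a ℚ.- b ℚ.+ b
    split = solve 2 (λ a b → a := a :- b :+ b) refl
      where open +-*-Solver
    combine : ∀ ε c → ½ ℚ.* ε ℚ.+ (c ℚ.+ ½ ℚ.* ε) ≡ c ℚ.+ ε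
    combine = solve 2 (λ ε c → con ½ :* ε :+ (c :+ con ½ :* ε) := c :+ ε) refl
      where open +-*-Solver
    p≤∣p∣ : ∀ p → p ℚ.≤ ∣ p ∣
    p≤∣p∣ p with ℚ.≤-total 0ℚ p
    ... | inj₁ 0≤p = ℚ.≤-reflexive (sym (ℚ.0≤p⇒∣p∣≡p 0≤p))
    ... | inj₂ p≤0 = ℚ.≤-trans p≤0 (ℚ.0≤∣p∣ p)

  P0≡1 : P 0 ≡ 1ℚ
  P0≡1 = trans (sym (ℚ.*-identityʳ (P 0))) (P*p^- 0)

  ∣fromℤₚ∣-≤ : ∀ t {M} → t ≈[ M ] 0ᶻ → ∣ fromℤₚ t ∣ᵠ ≤ᴿ fromℚ (p^- M)
  ∣fromℤₚ∣-≤ t {M} t≈0 = ≤ᴿ-fromℚ ∣ fromℤₚ t ∣ᵠ (p^- M) M λ n M≤n → subst (ℚ._≤ p^- M)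
    (sym (trans (∣∣ᵠ-approx (fromℤₚ t) n) (trans (cong (ℚ._* p^- (ord≤ t n)) P0≡1) (ℚ.*-identityˡ (p^- (ord≤ t n))))))
    (∣∣ᶻ-≤ t t≈0 n M≤n)

  ≤ᴿ-decay : ∀ x a c d n → x ≤ᴿ fromℚ a → a ℚ.≤ c ℚ.* d ^ℚ n → x ≤ᴿ fromℚ c *ᴿ fromℚ d ^ᴿ n
  ≤ᴿ-decay x a c d n x≤a a≤cdⁿ ε 0<ε = proj₁ (x≤a ε 0<ε) , λ i N≤i → ℚ.<-≤-trans (proj₂ (x≤a ε 0<ε) i N≤i)
    (ℚ.+-monoˡ-≤ ε (subst (a ℚ.≤_) (cong (c ℚ.*_) (sym (approx-^ᴿ d n i))) a≤cdⁿ))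

  0≤fromℚ : ∀ {a} → 0ℚ ℚ.≤ a → 0ᴿ ≤ᴿ fromℚ a
  0≤fromℚ {a} 0≤a ε 0<ε = 0 , λ _ _ → ℚ.≤-<-trans 0≤a (x<x+ε a 0<ε)

  open RawSemiringDefs (RawRing.rawSemiring (CommutativeRing.rawRing (PadicRing.ring ℤₚ-padicRing))) using () renaming (_^_ to _^ᶻ_)

  -- Passage from ℤₚ to an extension K with an absolute value

  module Extension {K : FiniteExtension} (abs : AbsoluteValue K) where

    open FiniteExtension K using (Carrier; _≈_; _+_; _*_; -_; _-_; _^_; sum; ι; ιᶻ; ι-isHomomorphism; commutativeRing)
    open AbsoluteValue abs
    module ι = IsRingHomomorphism ι-isHomomorphism
    open CommutativeRing commutativeRing using ()
      renaming (refl to ≈-refl; sym to ≈-sym; trans to ≈-trans; +-cong to ≈-+; *-cong to ≈-*)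

    ιᶻ-+ : ∀ {a b t} → (∀ k → residue t k ≡ residue a k ℤ.+ residue b k) → ιᶻ t ≈ ιᶻ a + ιᶻ b
    ιᶻ-+ {a} {b} {t} t≡ = ≈-sym (≈-trans (≈-sym (ι.+-homo (fromℤₚ a) (fromℤₚ b)))
      (ι.⟦⟧-cong (pointwiseᵠ λ k → cong (ℤ._* + 1) (sym (trans (t≡ k) (lem (residue a k) (residue b k)))))))
      where
      lem : ∀ a b → a ℤ.+ b ≡ a ℤ.* + 1 ℤ.+ b ℤ.* + 1
      lem = solve-∀

    ιᶻ-* : ∀ {a b t} → (∀ k → residue t k ≡ residue a k ℤ.* residue b k) → ιᶻ t ≈ ιᶻ a * ιᶻ b
    ιᶻ-* {a} {b} {t} t≡ = ≈-sym (≈-trans (≈-sym (ι.*-homo (fromℤₚ a) (fromℤₚ b)))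
      (ι.⟦⟧-cong (pointwiseᵠ λ k → cong (ℤ._* + 1) (sym (t≡ k)))))

    ιᶻ-‿ : ∀ {a t} → (∀ k → residue t k ≡ ℤ.- residue a k) → ιᶻ t ≈ - ιᶻ a
    ιᶻ-‿ {a} {t} t≡ = ≈-sym (≈-trans (≈-sym (ι.-‿homo (fromℤₚ a)))
      (ι.⟦⟧-cong (pointwiseᵠ λ k → cong (ℤ._* + 1) (sym (t≡ k)))))

    ιᶻ-^ : ∀ x d → ιᶻ x ^ d ≈ ιᶻ (x ^ᶻ d)
    ιᶻ-^ x zero    = ≈-sym ι.1#-homo
    ιᶻ-^ x (suc d) = ≈-trans (≈-* ≈-refl (ιᶻ-^ x d)) (≈-sym (ιᶻ-* {x} {x ^ᶻ d} λ _ → refl))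

    ιᶻ-sum : ∀ n (f : ℕ → Carrier) (g : ℕ → ℤₚ) → (∀ d → f d ≈ ιᶻ (g d)) → sum {n} (λ i → f (toℕ i)) ≈ ιᶻ (T.Σ< n g)
    ιᶻ-sum zero    f g f≈g = ≈-sym ι.0#-homo
    ιᶻ-sum (suc n) f g f≈g = ≈-trans (≈-+ (f≈g 0) (ιᶻ-sum n (f ∘ suc) (g ∘ suc) (f≈g ∘ suc)))
      (≈-sym (ιᶻ-+ {g 0} {T.Σ< n (g ∘ suc)} λ _ → refl))

    -- The difference is the image of a - b, whose absolute value is the p-adic one. All estimates
    -- in K are reduced through this to congruences in ℤₚ.
    ∥ιᶻ-ιᶻ∥-≤ : ∀ {w a b M} → w ≈ ιᶻ a → a ≈[ M ] b → ∥ w - ιᶻ b ∥ ≤ᴿ fromℚ (p^- M)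
    ∥ιᶻ-ιᶻ∥-≤ {w} {a} {b} {M} w≈a a≈b = ≃ᴿ-≤ᴿ-trans ∥ w - ιᶻ b ∥ ∥ ιᶻ t ∥ (p^- M) (cong-∥∥ (≈-trans (≈-+ w≈a (≈-sym (ιᶻ-‿ {b} {u} λ _ → refl))) (≈-sym (ιᶻ-+ {a} {u} {t} λ _ → refl))))
      (≃ᴿ-≤ᴿ-trans ∥ ιᶻ t ∥ ∣ fromℤₚ t ∣ᵠ (p^- M) (extends (fromℤₚ t)) (∣fromℤₚ∣-≤ t {M} (level (mk-mod (∣-by (sym (ℤ.+-identityʳ (residue a M ℤ.- residue b M))) (p^∣ (at a≈b)))))))
      where
      u t : ℤₚ
      u = -ᶻ b
      t = a +ᶻ u

  -- The twisted interpolation on the residue classes modulo N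

  module Assembly {K : FiniteExtension} (abs : AbsoluteValue K) {s : ℕ → ℤₚ} (I : T.InterpolationData s) where

    open Extension abs
    open FiniteExtension K using (Carrier; ιᶻ; sum; _^_; _*_; _-_; _≈_; commutativeRing)
    open AbsoluteValue abs using (∥_∥)

    open T.InterpolationData I

    q N : ℕ
    q = p ℕ.^ e
    N = q ℕ.* m

    instance
      q-nonZero : ℕ.NonZero q
      q-nonZero = p^n≢0 e
      N-nonZero : ℕ.NonZero N
      N-nonZero = ℕ.m*n≢0 q m {{q-nonZero}} {{m≢0}}

    -- Division by q, using N = q m: the remainder depends on j alone, and the quotient has the form
    -- c + k m expected by the interpolant.
    regroup : ∀ j k → j ℕ.+ k ℕ.* N ≡ j ℕ.% q ℕ.+ q ℕ.* (j ℕ./ q ℕ.+ k ℕ.* m)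
    regroup j k = trans (cong₂ ℕ._+_ (ℕ.m≡m%n+[m/n]*n j q) (trans (sym (ℕ.*-assoc k q m)) (trans (cong (ℕ._* m) (ℕ.*-comm k q)) (ℕ.*-assoc q k m))))
      (trans (ℕ.+-assoc (j ℕ.% q) (j ℕ./ q ℕ.* q) (q ℕ.* (k ℕ.* m)))
        (cong (j ℕ.% q ℕ.+_) (trans (cong (ℕ._+ q ℕ.* (k ℕ.* m)) (ℕ.*-comm (j ℕ./ q) q)) (sym (ℕ.*-distribˡ-+ q (j ℕ./ q) (k ℕ.* m))))))

    split : ∀ n → n ≡ n ℕ.% N ℕ.+ n ℕ./ N ℕ.* N
    split n = ℕ.m≡m%n+[m/n]*n n N

    A : Fin N → Pred ℕ 0ℓ
    A j n = n ℕ.% N ≡ toℕ j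

    A-split : ∀ j n → A j n → n ≡ toℕ j ℕ.% q ℕ.+ q ℕ.* (toℕ j ℕ./ q ℕ.+ n ℕ./ N ℕ.* m)
    A-split j n n∈A = trans (split n) (trans (cong (ℕ._+ n ℕ./ N ℕ.* N) n∈A) (regroup (toℕ j) (n ℕ./ N)))

    -- As m is a unit, j + Nℤₚ = j + qℤₚ, and the natural numbers j + kN are dense in it.
    A-dense : ∀ j → IsDenseIn toℕ j ℕ.% q + q ℤₚ (A j)
    A-dense j = record
      { subset = λ n n∈A → fromℕ (y n) , pointwise λ _ → trans (cong +_ (A-split j n n∈A))
          (trans (ℤ.pos-+ (toℕ j ℕ.% q) (q ℕ.* y n)) (cong (ℤ._+_ (+ (toℕ j ℕ.% q))) (ℤ.pos-* q (y n))))
      ; dense = λ x (z , x≈) ε 0<ε → let M , small-M = small ε 0<ε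
                                         n , n∈A , n≡x = near x z M (λ k → mod x≈ k) in
          n , n∈A , small-M ∣ fromℕ n +ᶻ -ᶻ x ∣ᶻ (≤ᴿ-fromℚ ∣ fromℕ n +ᶻ -ᶻ x ∣ᶻ (p^- M) M (∣∣ᶻ-≤ (fromℕ n +ᶻ -ᶻ x) (level n≡x)))
      }
      where
      y : ℕ → ℕ
      y n = toℕ j ℕ./ q ℕ.+ n ℕ./ N ℕ.* m
      near : ∀ x z M → (∀ k → residue x k ≡ + (toℕ j ℕ.% q) ℤ.+ + q ℤ.* residue z k mod-p^ k) →
             ∃ λ n → A j n × + n ℤ.+ ℤ.- residue x M ≡ + 0 mod-p^ M
      near x z M x≡ = from-k (proj₁ close) (at (proj₂ close))
        where
        close = T.progression-dense M (toℕ j ℕ.% q) q (toℕ j ℕ./ q) m {m⁻¹} {x} {z} (mk≈ᶻ λ k → mod m-unit k) (mk≈ᶻ x≡)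
        from-k : ∀ k → + (toℕ j ℕ.% q ℕ.+ q ℕ.* (toℕ j ℕ./ q ℕ.+ k ℕ.* m)) ℤ.+ ℤ.- residue x M ≡ + 0 mod-p^ M →
                 ∃ λ n → A j n × + n ℤ.+ ℤ.- residue x M ≡ + 0 mod-p^ M
        from-k k d = toℕ j ℕ.+ k ℕ.* N ,
          trans (ℕ.[m+kn]%n≡m%n (toℕ j) k N) (ℕ.m<n⇒m%n≡m (Fin.toℕ<n j)) ,
          subst (λ t → + t ℤ.+ ℤ.- residue x M ≡ + 0 mod-p^ M) (sym (regroup (toℕ j) k)) d

    partition : TwistedPartition
    partition = record
      { e = e ; size = N ; A = A
      ; cover    = λ n → fromℕ< (ℕ.m%n<n n N) , sym (Fin.toℕ-fromℕ< (ℕ.m%n<n n N))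
      ; disjoint = λ i j n n∈Aᵢ n∈Aⱼ → Fin.toℕ-injective (trans (sym n∈Aᵢ) n∈Aⱼ)
      ; r        = λ j → toℕ j ℕ.% q
      ; r<q      = λ j → ℕ.m%n<n (toℕ j) q
      ; A-dense  = A-dense
      }

    module F (j : Fin N) = T.Interpolant (interpolant (toℕ j) (toℕ j ℕ./ q))

    -- On r + qℤₚ with r = j % q this is `F` at (x - r)/q; taking the floor of x/q instead gives a
    -- function on all of ℤₚ.
    sⱼ : Fin N → ℤₚ → Carrier
    sⱼ j x = ιᶻ (F.F j (x /ᶻp^ e))

    sⱼ-continuous : ∀ j → Continuous abs (sⱼ j)
    -- Division by pᵉ loses e digits, so M + e digits of the argument are needed for M digits of the
    -- value.
    sⱼ-continuous j x ε 0<ε = fromℚ (p^- (M ℕ.+ e)) , 0<p^- (M ℕ.+ e) , λ y close →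
      proj₂ (small ε 0<ε) ∥ sⱼ j y - sⱼ j x ∥
        (∥ιᶻ-ιᶻ∥-≤ {sⱼ j y} {F.F j (y /ᶻp^ e)} {F.F j (x /ᶻp^ e)} {M} (CommutativeRing.refl commutativeRing {sⱼ j y}) (F.F-≈[] j {M} {y /ᶻp^ e} {x /ᶻp^ e} (/ᶻp^-cong e {M} {y} {x} (y≈x y (y +ᶻ -ᶻ x) refl (∣∣ᶻ-<⇒≈0 (y +ᶻ -ᶻ x) (M ℕ.+ e) close)))))
      where
      M = proj₁ (small ε 0<ε)
      y≈x : ∀ y t → residue t (M ℕ.+ e) ≡ residue y (M ℕ.+ e) ℤ.- residue x (M ℕ.+ e) → t ≈[ M ℕ.+ e ] 0ᶻ → y ≈[ M ℕ.+ e ] x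
      y≈x y t t≡ d = level (mk-mod (∣-by (trans (ℤ.+-identityʳ (residue t (M ℕ.+ e))) t≡) (p^∣ (at d))))

    interpolates : ∀ j n → A j n → ∀ t → (∀ k → residue t k ≡ + n) → s n ≈[ n ℕ./ N ] F.F j (t /ᶻp^ e)
    interpolates j n n∈A t t≡n = level (mod-trans
      (at (subst (λ l → s l ≈[ k ] F.F j (fromℕ y)) (sym (trans (split n) (cong (ℕ._+ k ℕ.* N) n∈A))) (F.interpolates j k)))
      (mod-sym (at (F.F-≈[] j {k} {t /ᶻp^ e} {fromℕ y} (≈ᶻ⇒≈[] (/ᶻp^-unique e (fromℕ y) t (ℕ.m%n<n (toℕ j) q) t≡))))))
      where
      k y : ℕ
      k = n ℕ./ N
      y = toℕ j ℕ./ q ℕ.+ k ℕ.* m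
      t≡ : ∀ l → residue t l ≡ + (toℕ j ℕ.% q) ℤ.+ + y ℤ.* p^ e
      t≡ l = trans (t≡n l) (trans (cong +_ (A-split j n n∈A)) (trans (ℤ.pos-+ (toℕ j ℕ.% q) (q ℕ.* y))
        (cong (ℤ._+_ (+ (toℕ j ℕ.% q))) (trans (ℤ.pos-* q y) (ℤ.*-comm (+ q) (+ y))))))

    Approximates : ℚ → Set
    Approximates d = ∀ j n → A j n → ∥ ιᶻ (s n) - sⱼ j (fromℕ n) ∥ ≤ᴿ fromℚ (P 1) *ᴿ fromℚ d ^ᴿ n

    approximates : ∀ {d} → (∀ r k → r ℕ.< N → p^- k ℚ.≤ P 1 ℚ.* d ^ℚ (r ℕ.+ k ℕ.* N)) → Approximates d
    approximates {d} bounded j n n∈A = ≤ᴿ-decay ∥ ιᶻ (s n) - sⱼ j (fromℕ n) ∥ (p^- (n ℕ./ N)) (P 1) d n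
      (∥ιᶻ-ιᶻ∥-≤ {ιᶻ (s n)} {s n} {F.F j (fromℕ n /ᶻp^ e)} {n ℕ./ N} (CommutativeRing.refl commutativeRing {ιᶻ (s n)})
        (interpolates j n n∈A (fromℕ n) λ _ → refl))
      (subst (λ t → p^- (n ℕ./ N) ℚ.≤ P 1 ℚ.* d ^ℚ t) (sym (split n)) (bounded (n ℕ.% N) (n ℕ./ N) (ℕ.m%n<n n N)))

    -- On r + q x the division by q returns x, so the function of x is the power series `F` itself.
    power-series : ∀ j (argument : ℤₚ → ℤₚ) → (∀ x k → residue (argument x) k ≡ + (toℕ j ℕ.% q) ℤ.+ residue x k ℤ.* p^ e) →
                   IsPowerSeriesOnℤₚ abs (λ x → sⱼ j (argument x))
    power-series j argument argument≡ = c , λ x ε 0<ε → proj₁ (small ε 0<ε) , λ n M≤n →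
      proj₂ (small ε 0<ε) ∥ sum {n} (λ i → c (toℕ i) * ιᶻ x ^ toℕ i) - sⱼ j (argument x) ∥
        (∥ιᶻ-ιᶻ∥-≤ {sum {n} (λ i → c (toℕ i) * ιᶻ x ^ toℕ i)} {T.Σ< n (term x)} {F.F j (argument x /ᶻp^ e)} {proj₁ (small ε 0<ε)} (partial-sum n x) (value x (argument x) (argument≡ x) n M≤n))
      where
      open CommutativeRing commutativeRing using () renaming (sym to ≈-sym; trans to ≈-trans; refl to ≈-refl; *-cong to ≈-*)
      r = toℕ j ℕ.% q
      c : ℕ → Carrier
      c d = ιᶻ (F.F-coeff j d)
      term : ℤₚ → ℕ → ℤₚ
      term x d = F.F-coeff j d *ᶻ x ^ᶻ d
      partial-sum : ∀ n x → sum {n} (λ i → c (toℕ i) * ιᶻ x ^ toℕ i) ≈ ιᶻ (T.Σ< n (term x))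
      partial-sum n x = ιᶻ-sum n (λ d → c d * ιᶻ x ^ d) (term x) λ d →
        ≈-trans (≈-* ≈-refl (ιᶻ-^ x d)) (≈-sym (ιᶻ-* {F.F-coeff j d} {x ^ᶻ d} λ _ → refl))
      value : ∀ x y → (∀ k → residue y k ≡ + r ℤ.+ residue x k ℤ.* p^ e) → ∀ n {M} → M ℕ.≤ n → T.Σ< n (term x) ≈[ M ] F.F j (y /ᶻp^ e)
      value x y y≡ n {M} M≤n = level (mod-trans (at (≈[]-≤ {T.Σ< n (term x)} {F.F j x} M≤n (F.F-partial j n x)))
        (mod-sym (at (F.F-≈[] j {M} {y /ᶻp^ e} {x} (≈ᶻ⇒≈[] (/ᶻp^-unique e x y (ℕ.m%n<n (toℕ j) q) y≡))))))

    module _ {d : ℚ} (0≤d : 0ℚ ℚ.≤ d) (d<1 : d ℚ.< 1ℚ) (bounded : ∀ r k → r ℕ.< N → p^- k ℚ.≤ P 1 ℚ.* d ^ℚ (r ℕ.+ k ℕ.* N)) where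

      twistedInterpolation : ApproximateTwistedInterpolation s
      twistedInterpolation = record
        { partition     = partition
        ; K             = K
        ; abs           = abs
        ; sⱼ            = sⱼ
        ; sⱼ-continuous = sⱼ-continuous
        ; C             = fromℚ (P 1)
        ; D             = fromℚ d
        ; 0≤C           = 0≤fromℚ (0≤P 1)
        ; 0≤D           = 0≤fromℚ 0≤d
        ; D<1           = fromℚ-< d<1
        ; approximates  = approximates bounded
        }

      analytic : IsAnalytic twistedInterpolation
      analytic j = power-series j
        (λ x → fromℕ (TwistedPartition.q (ApproximateTwistedInterpolation.partition twistedInterpolation)) *ᶻ x
               +ᶻ fromℕ (TwistedPartition.r (ApproximateTwistedInterpolation.partition twistedInterpolation) j))
        (λ x k → lem (+ q) (residue x k) (+ (toℕ j ℕ.% q)))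
        where
        lem : ∀ q x r → q ℤ.* x ℤ.+ r ≡ r ℤ.+ x ℤ.* q
        lem = solve-∀

  recurrence⇒solution : ∀ {ℓ} (a : Fin ℓ → ℤₚ) {s} → SatisfiesRecurrence a s → T.Recurrence.Solution a s
  recurrence⇒solution a rec = T.Recurrence.solution λ n → mk≈ᶻ λ k → mod (rec n) k

  analytic-interpolation : (ℓ : ℕ) (a : Fin ℓ → ℤₚ) (s : ℕ → ℤₚ) → SatisfiesRecurrence a s → ∃ λ (I : ApproximateTwistedInterpolation s) → IsAnalytic I
  analytic-interpolation ℓ a s rec = from-decay (decay N)
    where
    open Assembly ℚₚ-absoluteValue {s = s} (T.interpolation a {s} (recurrence⇒solution a {s} rec))
    from-decay : (∃ λ d → 0ℚ ℚ.≤ d × d ℚ.< 1ℚ × ∀ r k → r ℕ.< N → p^- k ℚ.≤ P 1 ℚ.* d ^ℚ (r ℕ.+ k ℕ.* N)) →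
                 ∃ λ (I : ApproximateTwistedInterpolation s) → IsAnalytic I
    from-decay (d , 0≤d , d<1 , bounded) = twistedInterpolation 0≤d d<1 bounded , analytic 0≤d d<1 bounded

theorem3p4 : (p : ℕ) (p-prime : Prime p) →
    let open Padic p p-prime in
    (ℓ : ℕ) (a : Fin ℓ → ℤₚ) (s : ℕ → ℤₚ) →
    SatisfiesRecurrence a s →
    ∃ λ (I : ApproximateTwistedInterpolation s) → IsAnalytic I
theorem3p4 = ℤₚ-Interpolation.analytic-interpolation
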